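{- For every integer $r\geq 4$, let $k=\lceil r/e\rceil$. Then for every sufficiently large $n$, $\mathrm{ex}(n,\mathcal{F}_{r,k})=|E(T^r(n))|$, and $T^r(n)$ is the unique (up to isomorphism) $\mathcal{F}_{r,k}$-free $r$-uniform hypergraph on $n$ vertices with this many edges.
   Context: For a family $\mathcal{F}$ of $r$-uniform hypergraphs, an $r$-uniform hypergraph is $\mathcal{F}$-free if it contains no member of $\mathcal{F}$ as a subgraph; $\mathrm{ex}(n,\mathcal{F})$ is the maximum number of edges in an $\mathcal{F}$-free $r$-uniform hypergraph on $n$ vertices. $T^r(n)$ denotes the balanced complete $r$-partite $r$-uniform hypergraph on $n$ vertices (vertex set split into $r$ parts of sizes differing by at most one, edges are all $r$-sets meeting every part in exactly one vertex). For $1\leq i\leq\lfloor r/2\rfloor$, the $(r-i,i)$-tent $\Delta_{(r-i,i)}$ is the $r$-uniform hypergraph with vertex set $\{1,\dots,2r-1\}$ and the three edges $\{1,2,\ldots,r\}$, $\{1,\ldots,i,r+1,\ldots,2r-i-1,2r-1\}$, $\{i+1,\ldots,r,2r-i,\ldots,2r-1\}$. For $1\leq k\leq\lfloor r/2\rfloor$, $\mathcal{F}_{r,k}=\{\Delta_{(r-i,i)}: 1\leq i\leq k\}$. -}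

module Defs where

open import Data.Nat as ℕ using (ℕ; zero; suc; _+_; _∸_; _≤_; _<_; _≤?_; NonZero)
open import Data.Nat.DivMod using (_%_)
open import Data.Bool using (Bool; true; false; _∧_; _∨_; if_then_else_)
open import Data.Bool.Properties using () renaming (_≟_ to _≟ᵇ_)
open import Data.Fin using (Fin; toℕ) renaming (_≟_ to _≟ᶠ_)
open import Data.Fin.Subset using (Subset; ∣_∣)
open import Data.Fin.Properties using (any?)
open import Data.Fin.Permutation using (Permutation′; _⟨$⟩ʳ_)
open import Data.Vec using (Vec; []; _∷_; lookup; tabulate; sum)
open import Data.Vec.Properties using (≡-dec)
open import Data.List using (List; upTo; foldr)
open import Data.Product using (Σ; ∃; _×_; _,_)
open import Function.Definitions using (Injective)
open import Relation.Binary.PropositionalEquality using (_≡_)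
open import Relation.Nullary using (¬_)
open import Relation.Nullary.Decidable using (⌊_⌋; _×-dec_)
open import Data.Integer using (+_)
open import Data.Rational as ℚ using (ℚ; 1ℚ)

invFact : ℕ → ℚ
invFact zero    = 1ℚ
invFact (suc j) = invFact j ℚ.* (+ 1 ℚ./ suc j)

eLower : ℕ → ℚ
eLower zero    = 1ℚ
eLower (suc N) = eLower N ℚ.+ invFact (suc N)

-- upper approximations  u N = s N + 2/(N+1)!  ; u N ≥ e for all N and u N → e
eUpper : ℕ → ℚ
eUpper N = eLower N ℚ.+ (+ 2 ℚ./ 1) ℚ.* invFact (suc N)

ℕtoℚ : ℕ → ℚ
ℕtoℚ m = + m ℚ./ 1

-- x * e < q   (x ≥ 0):  some upper approximation already gives it
MulELt : ℕ → ℕ → Set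
MulELt x q = ∃ λ N → ℕtoℚ x ℚ.* eUpper N ℚ.< ℕtoℚ q

-- q ≤ x * e   (x ≥ 0):  e is the infimum of the upper approximations
LeMulE : ℕ → ℕ → Set
LeMulE q x = ∀ N → ℕtoℚ q ℚ.≤ ℕtoℚ x ℚ.* eUpper N

IsCeilDivE : ℕ → ℕ → Set
IsCeilDivE r k = (1 ≤ k) × MulELt (k ∸ 1) r × LeMulE r k

countSubsets : (n : ℕ) → (Subset n → Bool) → ℕ
countSubsets zero    P = if P [] then 1 else 0
countSubsets (suc n) P = countSubsets n (λ S → P (true ∷ S))
                       + countSubsets n (λ S → P (false ∷ S))

record UHypergraph (n r : ℕ) : Set where
  field
    edge    : Subset n → Bool
    uniform : ∀ S → edge S ≡ true → ∣ S ∣ ≡ r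
open UHypergraph public

numEdges : ∀ {n} → (Subset n → Bool) → ℕ
numEdges {n} E = countSubsets n E

image : ∀ {m n} → (Fin m → Fin n) → Subset m → Subset n
image f e = tabulate λ j → ⌊ any? (λ i → (f i ≟ᶠ j) ×-dec (lookup e i ≟ᵇ true)) ⌋

Contains : ∀ {m n} → (Subset m → Bool) → (Subset n → Bool) → Set
Contains {m} {n} H G =
  Σ (Fin m → Fin n) λ f → Injective _≡_ _≡_ f × (∀ e → H e ≡ true → G (image f e) ≡ true)

Isomorphic : ∀ {n} → (Subset n → Bool) → (Subset n → Bool) → Set
Isomorphic {n} G H = Σ (Permutation′ n) λ π → ∀ S → G S ≡ H (image (π ⟨$⟩ʳ_) S)

-- vertex x : Fin (2r-1) is the vertex labelled toℕ x + 1 ∈ {1,…,2r-1}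
_≤ᵇ_ : ℕ → ℕ → Bool
a ≤ᵇ b = ⌊ a ≤? b ⌋

inRange : ℕ → ℕ → ℕ → Bool
inRange a b v = (a ≤ᵇ v) ∧ (v ≤ᵇ b)

tentEdge1 tentEdge2 tentEdge3 : (r i : ℕ) → Subset (r + r ∸ 1)
tentEdge1 r i = tabulate λ x → inRange 1 r (suc (toℕ x))
tentEdge2 r i = tabulate λ x → let v = suc (toℕ x) in
  inRange 1 i v ∨ inRange (r + 1) (r + r ∸ i ∸ 1) v ∨ inRange (r + r ∸ 1) (r + r ∸ 1) v
tentEdge3 r i = tabulate λ x → let v = suc (toℕ x) in
  inRange (i + 1) r v ∨ inRange (r + r ∸ i) (r + r ∸ 1) v

tent : (r i : ℕ) → Subset (r + r ∸ 1) → Bool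
tent r i S = ⌊ ≡-dec _≟ᵇ_ S (tentEdge1 r i) ⌋
           ∨ ⌊ ≡-dec _≟ᵇ_ S (tentEdge2 r i) ⌋
           ∨ ⌊ ≡-dec _≟ᵇ_ S (tentEdge3 r i) ⌋

FFree : ∀ {n} (r k : ℕ) → (Subset n → Bool) → Set
FFree r k G = ∀ i → 1 ≤ i → i ≤ k → ¬ Contains (tent r i) G

IsExF : (n r k m : ℕ) → Set
IsExF n r k m =
    (Σ (UHypergraph n r) λ G → FFree r k (edge G) × numEdges (edge G) ≡ m)
  × (∀ (G : UHypergraph n r) → FFree r k (edge G) → numEdges (edge G) ≤ m)

-- parts: vertex v lies in part (toℕ v mod r); part sizes differ by at most one
part : (r : ℕ) .{{_ : NonZero r}} → ∀ {n} → Fin n → ℕ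
part r v = toℕ v % r

partCount : (r : ℕ) .{{_ : NonZero r}} → ∀ {n} → Subset n → ℕ → ℕ
partCount r S p = sum (tabulate λ v → if lookup S v ∧ ⌊ part r v ℕ.≟ p ⌋ then 1 else 0)

turanEdge : (r : ℕ) .{{_ : NonZero r}} → (n : ℕ) → Subset n → Bool
turanEdge r n S = foldr (λ p b → ⌊ partCount r S p ℕ.≟ 1 ⌋ ∧ b) true (upTo r)

-- Call a set of vertices robust if many edges of G contain it. All but O(n^(r-1)) edges of G lie in
-- its core, the edges all of whose subsets are robust, and the core contains not even homomorphic
-- images of the forbidden tents. For a set S let L(S) count the vertices w such that S ∪ {w} lies
-- in a core edge. If A ∪ B ∪ C is a core edge with |A| ≤ k, then L(A ∪ C) and L(B ∪ C) count disjoint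
-- sets of vertices, all of which are counted by L(C). Hence the averages X_i of L over the
-- (r-i)-subsets of core edges satisfy X_a + X_b ≤ X_(a+b) for a ≤ k. Since k ≥ r/e gives
-- ∑_{k<i≤r} 1/i ≤ 1, such a sequence has ∑ X_i / i ≤ X_r ≤ n. Choosing the vertices of an ordered
-- core edge one after another and applying the inequality of arithmetic and geometric means to the
-- reciprocal conditional probabilities yields |core| ≤ (n/r)^r; near equality forces a core edge e
-- for which the disjoint sets of vertices extending e − v, v ∈ e, cover almost all vertices. No two
-- vertices of one of these sets lie in a common core edge, so the core is almost r-partite. If G has
-- large minimum degree, then G is r-partite, because vertices with many common links lie in no common
-- edge (the tent with i = 1). Deleting a vertex of low degree increases the surplus over the Turán
-- number, which cannot continue, so extremal hypergraphs have large minimum degree.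
module Submission where

open import Defs
open import Data.Nat using (ℕ; zero; suc; _+_; _*_; _∸_; _^_; _!; _≤_; _<_; _≥_; _≤?_; _<?_; z≤n; s≤s; NonZero; >-nonZero; >-nonZero⁻¹)
open import Data.Nat.Properties
open import Data.Nat.Tactic.RingSolver using (solve-∀)
open import Data.Nat.Divisibility using (_∣_; m≤n⇒m!∣n!; ∣-trans; m∣m*n)
open import Data.Nat.DivMod using (m*[n/m]≡n; _%_; _/_; m≡m%n+[m/n]*n; m%n<n; m<n⇒m%n≡m; [m+n]%n≡m%n; /-monoˡ-≤; m≥n⇒m/n>0)
open import Data.Bool using (Bool; true; false; _∧_; _∨_; not; if_then_else_)
open import Data.Bool.Properties using () renaming (_≟_ to _≟ᵇ_)
open import Data.Fin using (Fin; zero; suc; toℕ; fromℕ<; punchIn; punchOut) renaming (_≟_ to _≟ᶠ_)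
import Data.Fin.Properties as Finₚ
open import Data.Fin.Subset using (Subset; ∣_∣; ⊥) renaming (_∈_ to _∈ˢ_; _∉_ to _∉ˢ_; _⊆_ to _⊆ˢ_)
open import Data.Fin.Subset.Properties using (anySubset?; _∈?_; _⊆?_; ∣⊥∣≡0; ∉⊥; ⊥⊆; ⊆-antisym; p⊆q⇒∣p∣≤∣q∣; drop-∷-⊆)
open import Data.Fin.Permutation as Perm using (Permutation′; _⟨$⟩ʳ_; _⟨$⟩ˡ_; inverseʳ; inverseˡ; permutation)
open import Data.Vec as Vec using (Vec; []; _∷_; lookup; tabulate; _[_]≔_)
open import Data.Vec.Properties as Vecₚ using (lookup∘update; lookup∘update′; []=⇒lookup; lookup⇒[]=; lookup-replicate; lookup∘tabulate; ≡-dec)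
open import Data.List as List using (List; []; _∷_; _++_; map; concatMap; filter; allFin; upTo; length; foldr)
open import Data.Nat.ListAction using (sum; product)
import Data.List.Properties as Listₚ
open import Data.List.Membership.Propositional using (_∈_; _∉_; find; lose)
open import Data.List.Membership.Propositional.Properties using (∈-++⁺ˡ; ∈-++⁺ʳ; ∈-++⁻; ∈-filter⁺; ∈-filter⁻; ∈-allFin; ∈-upTo⁺; ∈-upTo⁻; ∈-map⁺; ∈-map⁻; ∈-concatMap⁻)
open import Data.List.Relation.Unary.All as All using (All; []; _∷_)
open import Data.List.Relation.Unary.Any as Any using (Any; here; there)
open import Data.List.Relation.Unary.AllPairs using ([]; _∷_)
open import Data.List.Relation.Unary.Unique.Propositional using (Unique)
import Data.List.Relation.Unary.Unique.Propositional.Properties as Uniqueₚ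
open import Data.Product using (Σ; ∃; ∃₂; _×_; _,_; proj₁; proj₂)
open import Data.Sum using (_⊎_; inj₁; inj₂; [_,_])
open import Data.Maybe using (Maybe; just; nothing)
open import Data.Empty using (⊥-elim) renaming (⊥ to Empty)
open import Function using (_∘_; id; case_of_)
open import Relation.Binary.PropositionalEquality using (_≡_; _≢_; refl; sym; trans; cong; cong₂; subst; subst₂; module ≡-Reasoning)
open import Relation.Nullary using (¬_; Dec; yes; no; contradiction)
open import Relation.Nullary.Decidable using (⌊_⌋; _×-dec_; _→-dec_; ¬?; decidable-stable)
open import Data.Integer as ℤ using ()
import Data.Integer.Properties as ℤₚ
open import Data.Rational as ℚ using (ℚ; 1ℚ)
import Data.Rational.Properties as ℚₚ
open import Data.Rational.Unnormalised as ℚᵘ using (mkℚᵘ; *≡*; *≤*)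
import Data.Rational.Unnormalised.Properties as ℚᵘₚ
open import Data.Unit using (⊤; tt)
import Data.List.Relation.Unary.Any.Properties as Anyₚ
import Data.Maybe.Properties as Maybeₚ
open Maybeₚ using (just-injective)

-- Finite sums

-- The weights 1/i come from the extremal example: if r divides n, an (r-i)-subset S of an edge of
-- the complete balanced r-partite hypergraph has L(S) = i n/r, so all X_i / i agree, the equality
-- case of the inequality of means. The number e enters through 1/i ≤ log (i/(i-1)), whose sum over
-- k < i ≤ r is log (r/k) ≤ 1. For stability the weight of X_1 is raised by the factor 1 + 1/q, and
-- the product of the weights grows by the same factor. If for every core edge e the sets extending
-- e - v together had at most (1 - 1/q) n vertices, the weighted sum would grow too little, and the
-- core would fall short of (n/r)^r by a constant factor. Since the core misses only O(n^(r-1))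
-- edges of G, this fails for large n. The core controls no individual vertex, which may have lost
-- most of its edges. The classes around e therefore leave out such vertices, and afterwards every
-- vertex is recoloured by means of the edges of G itself. Inequalities are cleared of denominators
-- throughout, which accounts for factors such as r! and q.

∑ : {A : Set} → List A → (A → ℕ) → ℕ
∑ xs f = sum (map f xs)

module _ {A : Set} where

  ∑-mono-∈ : (xs : List A) {f g : A → ℕ} → (∀ x → x ∈ xs → f x ≤ g x) → ∑ xs f ≤ ∑ xs g
  ∑-mono-∈ []       f≤g = z≤n
  ∑-mono-∈ (x ∷ xs) f≤g = +-mono-≤ (f≤g x (here refl)) (∑-mono-∈ xs (λ y p → f≤g y (there p)))

  ∑-mono : (xs : List A) {f g : A → ℕ} → (∀ x → f x ≤ g x) → ∑ xs f ≤ ∑ xs g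
  ∑-mono xs f≤g = ∑-mono-∈ xs (λ x _ → f≤g x)

  ∑-cong : (xs : List A) {f g : A → ℕ} → (∀ x → f x ≡ g x) → ∑ xs f ≡ ∑ xs g
  ∑-cong xs f≡g = cong sum (Listₚ.map-cong f≡g xs)

  ∑-+ : (xs : List A) (f g : A → ℕ) → ∑ xs (λ x → f x + g x) ≡ ∑ xs f + ∑ xs g
  ∑-+ []       f g = refl
  ∑-+ (x ∷ xs) f g = trans (cong (f x + g x +_) (∑-+ xs f g)) (lemma (f x) (g x) (∑ xs f) (∑ xs g))
    where
    lemma : ∀ a b c d → a + b + (c + d) ≡ a + c + (b + d)
    lemma = solve-∀

  ∑-*ˡ : (xs : List A) (c : ℕ) (f : A → ℕ) → ∑ xs (λ x → c * f x) ≡ c * ∑ xs f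
  ∑-*ˡ []       c f = sym (*-zeroʳ c)
  ∑-*ˡ (x ∷ xs) c f = trans (cong (c * f x +_) (∑-*ˡ xs c f)) (sym (*-distribˡ-+ c (f x) (∑ xs f)))

  ∑-*ʳ : (xs : List A) (c : ℕ) (f : A → ℕ) → ∑ xs (λ x → f x * c) ≡ ∑ xs f * c
  ∑-*ʳ xs c f = trans (∑-cong xs (λ x → *-comm (f x) c)) (trans (∑-*ˡ xs c f) (*-comm c _))

  ∑-const : (xs : List A) (c : ℕ) → ∑ xs (λ _ → c) ≡ length xs * c
  ∑-const []       c = refl
  ∑-const (x ∷ xs) c = cong (c +_) (∑-const xs c)

  ∑-zero : (xs : List A) {f : A → ℕ} → (∀ x → f x ≡ 0) → ∑ xs f ≡ 0
  ∑-zero xs f≡0 = trans (∑-cong xs f≡0) (trans (∑-const xs 0) (*-zeroʳ (length xs)))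

  ∑-++ : (xs ys : List A) (f : A → ℕ) → ∑ (xs ++ ys) f ≡ ∑ xs f + ∑ ys f
  ∑-++ []       ys f = refl
  ∑-++ (x ∷ xs) ys f = trans (cong (f x +_) (∑-++ xs ys f)) (sym (+-assoc (f x) (∑ xs f) (∑ ys f)))

  ∑-term : {xs : List A} (f : A → ℕ) {x : A} → x ∈ xs → f x ≤ ∑ xs f
  ∑-term f (here refl) = m≤m+n _ _
  ∑-term f (there p)   = ≤-trans (∑-term f p) (m≤n+m _ _)

  ∑-pos : (xs : List A) (f : A → ℕ) → 0 < ∑ xs f → ∃ λ x → x ∈ xs × 0 < f x
  ∑-pos (x ∷ xs) f pos with f x in eq
  ... | suc a = x , here refl , subst (0 <_) (sym eq) (s≤s z≤n)
  ... | zero with ∑-pos xs f pos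
  ...   | y , y∈ , y> = y , there y∈ , y>

∑-map : {A B : Set} (g : A → B) (xs : List A) (f : B → ℕ) → ∑ (map g xs) f ≡ ∑ xs (f ∘ g)
∑-map g xs f = cong sum (sym (Listₚ.map-∘ xs))

∑-concatMap : {A B : Set} (g : A → List B) (xs : List A) (f : B → ℕ) →
  ∑ (concatMap g xs) f ≡ ∑ xs (λ x → ∑ (g x) f)
∑-concatMap g []       f = refl
∑-concatMap g (x ∷ xs) f = trans (∑-++ (g x) (concatMap g xs) f) (cong (∑ (g x) f +_) (∑-concatMap g xs f))

∑-swap : {A B : Set} (xs : List A) (ys : List B) (f : A → B → ℕ) →
  ∑ xs (λ x → ∑ ys (f x)) ≡ ∑ ys (λ y → ∑ xs (λ x → f x y))
∑-swap []       ys f = sym (∑-zero ys (λ _ → refl))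
∑-swap (x ∷ xs) ys f = trans (cong (∑ ys (f x) +_) (∑-swap xs ys f)) (sym (∑-+ ys (f x) _))

∑-allFin : ∀ n (f : Fin (suc n) → ℕ) → ∑ (allFin (suc n)) f ≡ f zero + ∑ (allFin n) (f ∘ suc)
∑-allFin n f = cong (f zero +_) (trans (cong (λ zs → ∑ zs f) (sym (Listₚ.map-tabulate id suc))) (∑-map suc (allFin n) f))

ind : Bool → ℕ
ind true  = 1
ind false = 0

ind≤1 : ∀ b → ind b ≤ 1
ind≤1 true  = ≤-refl
ind≤1 false = z≤n

ind-mono : ∀ {b c} → (b ≡ true → c ≡ true) → ind b ≤ ind c
ind-mono {false} {c}     f = z≤n
ind-mono {true}  {true}  f = ≤-refl
ind-mono {true}  {false} f with () ← f refl

ind-≡ : ∀ {b c} → (b ≡ true → c ≡ true) → (c ≡ true → b ≡ true) → ind b ≡ ind c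
ind-≡ f g = ≤-antisym (ind-mono f) (ind-mono g)

ind-∧ : ∀ b c → ind (b ∧ c) ≡ ind b * ind c
ind-∧ true  c = sym (+-identityʳ (ind c))
ind-∧ false c = refl

∧-true : ∀ {b c} → b ∧ c ≡ true → b ≡ true × c ≡ true
∧-true {true} p = refl , p

∧-intro : ∀ {b c} → b ≡ true → c ≡ true → b ∧ c ≡ true
∧-intro refl refl = refl

∨-true : ∀ {b c} → b ∨ c ≡ true → b ≡ true ⊎ c ≡ true
∨-true {true}  p = inj₁ refl
∨-true {false} p = inj₂ p

∨-introˡ : ∀ {b} c → b ≡ true → b ∨ c ≡ true
∨-introˡ c refl = refl

∨-introʳ : ∀ b {c} → c ≡ true → b ∨ c ≡ true
∨-introʳ true  p = refl
∨-introʳ false p = p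

true≢false : ∀ {b} → b ≡ true → b ≡ false → Empty
true≢false refl ()

¬true : ∀ {b} → ¬ b ≡ true → b ≡ false
¬true {true}  h = contradiction refl h
¬true {false} h = refl

not-true : ∀ {b} → not b ≡ true → b ≡ false
not-true {false} _ = refl

not-false : ∀ {b} → b ≡ false → not b ≡ true
not-false refl = refl

⌊⌋-true : {P : Set} (P? : Dec P) → ⌊ P? ⌋ ≡ true → P
⌊⌋-true (yes p) _ = p

true-⌊⌋ : {P : Set} (P? : Dec P) → P → ⌊ P? ⌋ ≡ true
true-⌊⌋ (yes _) _ = refl
true-⌊⌋ (no ¬p) p = contradiction p ¬p

ind-partition : ∀ {a b c : Bool} → (a ≡ true → b ≡ true ⊎ c ≡ true) → ind a ≤ ind b + ind c
ind-partition {false} _ = z≤n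
ind-partition {true}  h with h refl
... | inj₁ refl = s≤s z≤n
... | inj₂ refl = m≤n+m 1 _

∑-ind≤1 : {A : Set} {xs : List A} → Unique xs → (P : A → Bool) →
  (∀ x y → x ∈ xs → y ∈ xs → P x ≡ true → P y ≡ true → x ≡ y) → ∑ xs (ind ∘ P) ≤ 1
∑-ind≤1 {xs = []}     _         P h = z≤n
∑-ind≤1 {xs = x ∷ xs} (x∉ ∷ un) P h with P x in eq
... | false = ∑-ind≤1 un P (λ y z y∈ z∈ → h y z (there y∈) (there z∈))
... | true  = s≤s (≤-trans (∑-mono-∈ xs none) (≤-reflexive (∑-zero xs {λ _ → 0} (λ _ → refl))))
  where
  none : ∀ y → y ∈ xs → ind (P y) ≤ 0
  none y y∈ with P y in eq′
  ... | false = z≤n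
  ... | true  = contradiction (h x y (here refl) (there y∈) eq eq′) (All.lookup x∉ y∈)

∑-ind≥1 : {A : Set} (xs : List A) (P : A → Bool) {x : A} → x ∈ xs → P x ≡ true → 1 ≤ ∑ xs (ind ∘ P)
∑-ind≥1 xs P x∈ px = ≤-trans (≤-reflexive (cong ind (sym px))) (∑-term (ind ∘ P) x∈)

-- Reduces an inequality to a known one A ≤ B and a semiring identity, with slack s.
≤-by : ∀ {A B} a b s → A ≤ B → a + B + s ≡ b + A → a ≤ b
≤-by {A} {B} a b s A≤B eq = +-cancelʳ-≤ B a b
  (≤-trans (m≤m+n (a + B) s) (≤-trans (≤-reflexive eq) (+-monoʳ-≤ b A≤B)))

^-distribʳ-* : ∀ j a b → (a * b) ^ j ≡ a ^ j * b ^ j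
^-distribʳ-* zero    a b = refl
^-distribʳ-* (suc j) a b = trans (cong (a * b *_) (^-distribʳ-* j a b)) (lemma a b (a ^ j) (b ^ j))
  where
  lemma : ∀ a b p q → a * b * (p * q) ≡ a * p * (b * q)
  lemma = solve-∀

-- Subsets of Fin n

infixr 5 _◃_
infixl 5 _▹_

_◃_ : ∀ {n} → Fin n → Subset n → Subset n
x ◃ S = S [ x ]≔ true

_▹_ : ∀ {n} → Subset n → Fin n → Subset n
S ▹ x = S [ x ]≔ false

∈⇒true : ∀ {n} {x : Fin n} {S} → x ∈ˢ S → lookup S x ≡ true
∈⇒true = []=⇒lookup

true⇒∈ : ∀ {n} {x : Fin n} {S} → lookup S x ≡ true → x ∈ˢ S
true⇒∈ {x = x} {S} = lookup⇒[]= x S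

∉⇒false : ∀ {n} {x : Fin n} {S} → x ∉ˢ S → lookup S x ≡ false
∉⇒false x∉ = ¬true (λ eq → x∉ (true⇒∈ eq))

false⇒∉ : ∀ {n} {x : Fin n} {S} → lookup S x ≡ false → x ∉ˢ S
false⇒∉ eq x∈ = true≢false (∈⇒true x∈) eq

∈∉⇒≢ : ∀ {n} {S : Subset n} {x y} → x ∈ˢ S → y ∉ˢ S → x ≢ y
∈∉⇒≢ x∈ y∉ refl = y∉ x∈

∈-◃-here : ∀ {n} (x : Fin n) S → x ∈ˢ x ◃ S
∈-◃-here x S = true⇒∈ (lookup∘update x S true)

∈-◃-there : ∀ {n} (x : Fin n) {y S} → y ∈ˢ S → y ∈ˢ x ◃ S
∈-◃-there x {y} {S} y∈ with y ≟ᶠ x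
... | yes refl = ∈-◃-here x S
... | no y≢x   = true⇒∈ (trans (lookup∘update′ y≢x S true) (∈⇒true y∈))

∈-◃⁻ : ∀ {n} {x y : Fin n} {S} → y ∈ˢ x ◃ S → y ≡ x ⊎ y ∈ˢ S
∈-◃⁻ {x = x} {y} {S} y∈ with y ≟ᶠ x
... | yes y≡x = inj₁ y≡x
... | no y≢x  = inj₂ (true⇒∈ (trans (sym (lookup∘update′ y≢x S true)) (∈⇒true y∈)))

∉-▹-here : ∀ {n} (x : Fin n) S → x ∉ˢ S ▹ x
∉-▹-here x S = false⇒∉ (lookup∘update x S false)

∈-▹⁺ : ∀ {n} {x y : Fin n} {S} → y ∈ˢ S → y ≢ x → y ∈ˢ S ▹ x
∈-▹⁺ {S = S} y∈ y≢x = true⇒∈ (trans (lookup∘update′ y≢x S false) (∈⇒true y∈))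

∈-▹⁻ : ∀ {n} {x y : Fin n} {S} → y ∈ˢ S ▹ x → y ∈ˢ S × y ≢ x
∈-▹⁻ {x = x} {y} {S} y∈ with y ≟ᶠ x
... | yes refl = contradiction y∈ (∉-▹-here x S)
... | no y≢x   = true⇒∈ (trans (sym (lookup∘update′ y≢x S false)) (∈⇒true y∈)) , y≢x

◃-⊆ : ∀ {n} {x : Fin n} {S T} → x ∈ˢ T → S ⊆ˢ T → x ◃ S ⊆ˢ T
◃-⊆ x∈T S⊆T y∈ with ∈-◃⁻ y∈
... | inj₁ refl = x∈T
... | inj₂ y∈S  = S⊆T y∈S

◃-mono : ∀ {n} (x : Fin n) {S T} → S ⊆ˢ T → x ◃ S ⊆ˢ x ◃ T
◃-mono x {T = T} S⊆T = ◃-⊆ (∈-◃-here x T) (λ y∈ → ∈-◃-there x (S⊆T y∈))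

◃-comm : ∀ {n} (x y : Fin n) S → x ◃ y ◃ S ≡ y ◃ x ◃ S
◃-comm x y S = ⊆-antisym (half x y) (half y x)
  where
  half : ∀ x y → x ◃ y ◃ S ⊆ˢ y ◃ x ◃ S
  half x y = ◃-⊆ (∈-◃-there y (∈-◃-here x S)) (◃-mono y (∈-◃-there x))

◃-idem : ∀ {n} {x : Fin n} {S} → x ∈ˢ S → x ◃ S ≡ S
◃-idem {x = x} x∈ = ⊆-antisym (◃-⊆ x∈ id) (∈-◃-there x)

▹-◃ : ∀ {n} {x : Fin n} {S} → x ∈ˢ S → x ◃ (S ▹ x) ≡ S
▹-◃ {x = x} {S} x∈ = ⊆-antisym (◃-⊆ x∈ (λ p → proj₁ (∈-▹⁻ p))) back
  where
  back : S ⊆ˢ x ◃ (S ▹ x)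
  back {y} y∈ with y ≟ᶠ x
  ... | yes refl = ∈-◃-here x _
  ... | no y≢x   = ∈-◃-there x (∈-▹⁺ y∈ y≢x)

◃-▹ : ∀ {n} {x : Fin n} {S} → x ∉ˢ S → (x ◃ S) ▹ x ≡ S
◃-▹ {x = x} {S} x∉ = ⊆-antisym fwd (λ y∈ → ∈-▹⁺ (∈-◃-there x y∈) (∈∉⇒≢ y∈ x∉))
  where
  fwd : (x ◃ S) ▹ x ⊆ˢ S
  fwd y∈ with ∈-▹⁻ y∈
  ... | p , y≢x with ∈-◃⁻ p
  ...   | inj₁ y≡x = contradiction y≡x y≢x
  ...   | inj₂ q   = q

▹-⊆ : ∀ {n} (S : Subset n) x → S ▹ x ⊆ˢ S
▹-⊆ S x p = proj₁ (∈-▹⁻ p)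

∣◃∣ : ∀ {n} {x : Fin n} {S} → x ∉ˢ S → ∣ x ◃ S ∣ ≡ suc ∣ S ∣
∣◃∣ {S = S} x∉ = go S (∉⇒false x∉)
  where
  go : ∀ {n} {x : Fin n} S → lookup S x ≡ false → ∣ x ◃ S ∣ ≡ suc ∣ S ∣
  go {x = zero}  (false ∷ S) _ = refl
  go {x = suc x} (true ∷ S)  h = cong suc (go S h)
  go {x = suc x} (false ∷ S) h = go S h

∣▹∣ : ∀ {n} {x : Fin n} {S} → x ∈ˢ S → ∣ S ∣ ≡ suc ∣ S ▹ x ∣
∣▹∣ {x = x} {S} x∈ = trans (cong ∣_∣ (sym (▹-◃ x∈))) (∣◃∣ (∉-▹-here x S))

∣◃∣≤ : ∀ {n} (x : Fin n) S → ∣ x ◃ S ∣ ≤ suc ∣ S ∣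
∣◃∣≤ x S with x ∈? S
... | yes x∈ = ≤-trans (≤-reflexive (cong ∣_∣ (◃-idem x∈))) (n≤1+n _)
... | no x∉  = ≤-reflexive (∣◃∣ x∉)

⊆∣≡∣⇒≡ : ∀ {n} {S T : Subset n} → S ⊆ˢ T → ∣ T ∣ ≤ ∣ S ∣ → S ≡ T
⊆∣≡∣⇒≡ {S = []}        {[]}        h le = refl
⊆∣≡∣⇒≡ {S = true ∷ S}  {true ∷ T}  h (s≤s le) = cong (true ∷_) (⊆∣≡∣⇒≡ (drop-∷-⊆ h) le)
⊆∣≡∣⇒≡ {S = true ∷ S}  {false ∷ T} h le with () ← ∈⇒true (h {zero} (true⇒∈ refl))
⊆∣≡∣⇒≡ {S = false ∷ S} {true ∷ T}  h le = ⊥-elim (<-irrefl refl (≤-trans le (p⊆q⇒∣p∣≤∣q∣ (drop-∷-⊆ h))))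
⊆∣≡∣⇒≡ {S = false ∷ S} {false ∷ T} h le = cong (false ∷_) (⊆∣≡∣⇒≡ (drop-∷-⊆ h) le)

∣∣-sum : ∀ {n} (S : Subset n) → ∑ (allFin n) (ind ∘ lookup S) ≡ ∣ S ∣
∣∣-sum {zero}  []          = refl
∣∣-sum {suc n} (true ∷ S)  = trans (∑-allFin n (ind ∘ lookup (true ∷ S))) (cong suc (∣∣-sum S))
∣∣-sum {suc n} (false ∷ S) = trans (∑-allFin n (ind ∘ lookup (false ∷ S))) (∣∣-sum S)

toSet : ∀ {n} → List (Fin n) → Subset n
toSet = foldr _◃_ ⊥

∈-toSet⁺ : ∀ {n} {x : Fin n} {l} → x ∈ l → x ∈ˢ toSet l
∈-toSet⁺ {l = y ∷ l} (here refl) = ∈-◃-here y (toSet l)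
∈-toSet⁺ {l = y ∷ l} (there p)   = ∈-◃-there y (∈-toSet⁺ p)

∈-toSet⁻ : ∀ {n} {x : Fin n} {l} → x ∈ˢ toSet l → x ∈ l
∈-toSet⁻ {l = []}    p = contradiction p ∉⊥
∈-toSet⁻ {l = y ∷ l} p with ∈-◃⁻ p
... | inj₁ refl = here refl
... | inj₂ q    = there (∈-toSet⁻ q)

toSet-⊆ : ∀ {n} {l m : List (Fin n)} → (∀ {x} → x ∈ l → x ∈ m) → toSet l ⊆ˢ toSet m
toSet-⊆ h x∈ = ∈-toSet⁺ (h (∈-toSet⁻ x∈))

toSet-≡ : ∀ {n} {l m : List (Fin n)} → (∀ {x} → x ∈ l → x ∈ m) → (∀ {x} → x ∈ m → x ∈ l) → toSet l ≡ toSet m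
toSet-≡ h h′ = ⊆-antisym (toSet-⊆ h) (toSet-⊆ h′)

∣toSet∣≤ : ∀ {n} (l : List (Fin n)) → ∣ toSet l ∣ ≤ length l
∣toSet∣≤ {n} []  = ≤-reflexive (∣⊥∣≡0 n)
∣toSet∣≤ (x ∷ l) = ≤-trans (∣◃∣≤ x (toSet l)) (s≤s (∣toSet∣≤ l))

∣toSet∣-unique : ∀ {n} {l : List (Fin n)} → Unique l → ∣ toSet l ∣ ≡ length l
∣toSet∣-unique {n} []             = ∣⊥∣≡0 n
∣toSet∣-unique {l = x ∷ l} (x∉ ∷ un) =
  trans (∣◃∣ (λ p → All.lookup x∉ (∈-toSet⁻ {l = l} p) refl)) (cong suc (∣toSet∣-unique un))

elems : ∀ {n} → Subset n → List (Fin n)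
elems {n} S = filter (λ x → lookup S x ≟ᵇ true) (allFin n)

∈-elems⁺ : ∀ {n} {x : Fin n} {S} → x ∈ˢ S → x ∈ elems S
∈-elems⁺ {x = x} {S} x∈ = ∈-filter⁺ (λ x → lookup S x ≟ᵇ true) (∈-allFin x) (∈⇒true x∈)

∈-elems⁻ : ∀ {n} {x : Fin n} {S} → x ∈ elems S → x ∈ˢ S
∈-elems⁻ {n} {S = S} x∈ = true⇒∈ (proj₂ (∈-filter⁻ (λ x → lookup S x ≟ᵇ true) {xs = allFin n} x∈))

elems-unique : ∀ {n} (S : Subset n) → Unique (elems S)
elems-unique {n} S = Uniqueₚ.filter⁺ (λ x → lookup S x ≟ᵇ true) (Uniqueₚ.allFin⁺ n)

toSet-elems : ∀ {n} (S : Subset n) → toSet (elems S) ≡ S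
toSet-elems S = ⊆-antisym (λ p → ∈-elems⁻ (∈-toSet⁻ {l = elems S} p)) (λ p → ∈-toSet⁺ (∈-elems⁺ p))

length-elems : ∀ {n} (S : Subset n) → length (elems S) ≡ ∣ S ∣
length-elems S = trans (sym (∣toSet∣-unique (elems-unique S))) (cong ∣_∣ (toSet-elems S))

-- Sums over subsets and over words

subsets : ∀ n → List (Subset n)
subsets zero    = [] ∷ []
subsets (suc n) = map (true ∷_) (subsets n) ++ map (false ∷_) (subsets n)

∑-subsets : ∀ n (f : Subset (suc n) → ℕ) →
  ∑ (subsets (suc n)) f ≡ ∑ (subsets n) (f ∘ (true ∷_)) + ∑ (subsets n) (f ∘ (false ∷_))
∑-subsets n f = trans (∑-++ (map (true ∷_) (subsets n)) _ f)
  (cong₂ _+_ (∑-map (true ∷_) (subsets n) f) (∑-map (false ∷_) (subsets n) f))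

countSubsets≡∑ : ∀ n (P : Subset n → Bool) → countSubsets n P ≡ ∑ (subsets n) (ind ∘ P)
countSubsets≡∑ zero    P with P []
... | true  = refl
... | false = refl
countSubsets≡∑ (suc n) P = trans (cong₂ _+_ (countSubsets≡∑ n _) (countSubsets≡∑ n _)) (sym (∑-subsets n _))

∈-subsets : ∀ {n} (S : Subset n) → S ∈ subsets n
∈-subsets []          = here refl
∈-subsets (true ∷ S)  = ∈-++⁺ˡ (∈-map⁺ (true ∷_) (∈-subsets S))
∈-subsets (false ∷ S) = ∈-++⁺ʳ _ (∈-map⁺ (false ∷_) (∈-subsets S))

-- Reindexing along the bijection S ↦ `x ◃ S` from the sets avoiding x to the sets containing x;
-- this turns edges through x into links of x.
∑-∈-shift : ∀ {n} (x : Fin n) (f : Subset n → ℕ) →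
  ∑ (subsets n) (λ S → ind (lookup S x) * f S) ≡ ∑ (subsets n) (λ S → ind (not (lookup S x)) * f (x ◃ S))
∑-∈-shift {suc n} zero f = trans (∑-subsets n _) (trans
  (trans (cong (∑ (subsets n) (λ S → 1 * f (true ∷ S)) +_) (∑-zero (subsets n) (λ _ → refl)))
  (trans (+-comm _ 0) (cong (_+ ∑ (subsets n) (λ S → 1 * f (true ∷ S))) (sym (∑-zero (subsets n) {λ _ → 0} (λ _ → refl))))))
  (sym (∑-subsets n _)))
∑-∈-shift {suc n} (suc x) f = trans (∑-subsets n _)
  (trans (cong₂ _+_ (∑-∈-shift x (f ∘ (true ∷_))) (∑-∈-shift x (f ∘ (false ∷_)))) (sym (∑-subsets n _)))

words : ∀ {A : Set} → List A → ℕ → List (List A)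
words as zero    = [] ∷ []
words as (suc j) = concatMap (λ x → map (x ∷_) (words as j)) as

module _ {A : Set} (as : List A) where

  ∑-words : ∀ j (f : List A → ℕ) →
    ∑ (words as (suc j)) f ≡ ∑ as (λ x → ∑ (words as j) (λ l → f (x ∷ l)))
  ∑-words j f = trans (∑-concatMap (λ x → map (x ∷_) (words as j)) as f)
    (∑-cong as (λ x → ∑-map (x ∷_) (words as j) f))

  ∑-words-++ : ∀ i j (f : List A → ℕ) →
    ∑ (words as (i + j)) f ≡ ∑ (words as i) (λ u → ∑ (words as j) (λ v → f (u ++ v)))
  ∑-words-++ zero    j f = sym (+-identityʳ _)
  ∑-words-++ (suc i) j f = trans (∑-words (i + j) f)
    (trans (∑-cong as (λ x → ∑-words-++ i j (λ l → f (x ∷ l)))) (sym (∑-words i _)))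

  ∑-words-mono : ∀ j {f g : List A → ℕ} → (∀ l → length l ≡ j → f l ≤ g l) →
    ∑ (words as j) f ≤ ∑ (words as j) g
  ∑-words-mono zero    h = +-monoˡ-≤ 0 (h [] refl)
  ∑-words-mono (suc j) {f} {g} h = subst₂ _≤_ (sym (∑-words j f)) (sym (∑-words j g))
    (∑-mono as (λ x → ∑-words-mono j (λ l eq → h (x ∷ l) (cong suc eq))))

  ∑-words-cong : ∀ j {f g : List A → ℕ} → (∀ l → length l ≡ j → f l ≡ g l) →
    ∑ (words as j) f ≡ ∑ (words as j) g
  ∑-words-cong j h = ≤-antisym (∑-words-mono j (λ l eq → ≤-reflexive (h l eq)))
    (∑-words-mono j (λ l eq → ≤-reflexive (sym (h l eq))))

  ∑-words-pos : ∀ j (f : List A → ℕ) → 0 < ∑ (words as j) f → ∃ λ l → length l ≡ j × 0 < f l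
  ∑-words-pos zero    f pos = [] , refl , subst (0 <_) (+-identityʳ _) pos
  ∑-words-pos (suc j) f pos with ∑-pos as _ (subst (0 <_) (∑-words j f) pos)
  ... | x , _ , pos′ with ∑-words-pos j _ pos′
  ...   | l , eq , p = x ∷ l , cong suc eq , p

-- Every r-set is the underlying set of r! words.
∑-subsets≤∑-words : ∀ {n} r (f : Subset n → ℕ) →
  r ! * ∑ (subsets n) (λ S → ind ⌊ ∣ S ∣ ≟ r ⌋ * f S) ≤ ∑ (words (allFin n) r) (f ∘ toSet)
∑-subsets≤∑-words {n} zero f = ≤-trans (≤-reflexive (*-identityˡ _)) (≤-trans (only⊥ n f) (≤-reflexive (sym (+-identityʳ _))))
  where
  only⊥ : ∀ n (f : Subset n → ℕ) → ∑ (subsets n) (λ S → ind ⌊ ∣ S ∣ ≟ 0 ⌋ * f S) ≤ f ⊥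
  only⊥ zero    f = ≤-reflexive (trans (+-identityʳ _) (*-identityˡ _))
  only⊥ (suc n) f = ≤-trans (≤-reflexive (trans (∑-subsets n _)
    (cong (_+ ∑ (subsets n) (λ S → ind ⌊ ∣ S ∣ ≟ 0 ⌋ * f (false ∷ S))) (∑-zero (subsets n) (λ _ → refl)))))
    (only⊥ n (f ∘ (false ∷_)))
∑-subsets≤∑-words {n} (suc r) f = begin
  suc r ! * ∑ (subsets n) (λ S → ind ⌊ ∣ S ∣ ≟ suc r ⌋ * f S)
    ≡⟨ *-assoc (suc r) (r !) _ ⟩
  suc r * (r ! * ∑ (subsets n) (λ S → ind ⌊ ∣ S ∣ ≟ suc r ⌋ * f S))
    ≡⟨ lemma (suc r) (r !) _ ⟩
  r ! * (suc r * ∑ (subsets n) (λ S → ind ⌊ ∣ S ∣ ≟ suc r ⌋ * f S))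
    ≡⟨ cong (r ! *_) (sym (∑-*ˡ (subsets n) (suc r) _)) ⟩
  r ! * ∑ (subsets n) (λ S → suc r * (ind ⌊ ∣ S ∣ ≟ suc r ⌋ * f S))
    -- The factor `suc r` becomes the choice of the first letter x among the elements of S.
    ≡⟨ cong (r ! *_) (∑-cong (subsets n) degree) ⟩
  r ! * ∑ (subsets n) (λ S → ∑ (allFin n) (λ x → ind (lookup S x) * (ind ⌊ ∣ S ∣ ≟ suc r ⌋ * f S)))
    ≡⟨ cong (r ! *_) (∑-swap (subsets n) (allFin n) _) ⟩
  r ! * ∑ (allFin n) (λ x → ∑ (subsets n) (λ S → ind (lookup S x) * (ind ⌊ ∣ S ∣ ≟ suc r ⌋ * f S)))
    ≡⟨ cong (r ! *_) (∑-cong (allFin n) (λ x → ∑-∈-shift x _)) ⟩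
  r ! * ∑ (allFin n) (λ x → ∑ (subsets n) (λ S → ind (not (lookup S x)) * (ind ⌊ ∣ x ◃ S ∣ ≟ suc r ⌋ * f (x ◃ S))))
    ≤⟨ *-monoʳ-≤ (r !) (∑-mono (allFin n) (λ x → ∑-mono (subsets n) (drop x))) ⟩
  r ! * ∑ (allFin n) (λ x → ∑ (subsets n) (λ S → ind ⌊ ∣ S ∣ ≟ r ⌋ * f (x ◃ S)))
    ≡⟨ sym (∑-*ˡ (allFin n) (r !) _) ⟩
  ∑ (allFin n) (λ x → r ! * ∑ (subsets n) (λ S → ind ⌊ ∣ S ∣ ≟ r ⌋ * f (x ◃ S)))
    ≤⟨ ∑-mono (allFin n) (λ x → ∑-subsets≤∑-words r (λ S → f (x ◃ S))) ⟩
  ∑ (allFin n) (λ x → ∑ (words (allFin n) r) (λ l → f (x ◃ toSet l)))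
    ≡⟨ sym (∑-words (allFin n) r _) ⟩
  ∑ (words (allFin n) (suc r)) (f ∘ toSet) ∎
  where
  open ≤-Reasoning
  lemma : ∀ a b c → a * (b * c) ≡ b * (a * c)
  lemma = solve-∀
  degree : ∀ S → suc r * (ind ⌊ ∣ S ∣ ≟ suc r ⌋ * f S) ≡ ∑ (allFin n) (λ x → ind (lookup S x) * (ind ⌊ ∣ S ∣ ≟ suc r ⌋ * f S))
  degree S with ∣ S ∣ ≟ suc r
  ... | yes eq = trans (cong (_* (1 * f S)) (trans (sym eq) (sym (∣∣-sum S)))) (sym (∑-*ʳ (allFin n) (1 * f S) (ind ∘ lookup S)))
  ... | no _   = trans (*-zeroʳ (suc r)) (sym (∑-zero (allFin n) (λ x → *-zeroʳ (ind (lookup S x)))))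
  drop : ∀ x S → ind (not (lookup S x)) * (ind ⌊ ∣ x ◃ S ∣ ≟ suc r ⌋ * f (x ◃ S)) ≤ ind ⌊ ∣ S ∣ ≟ r ⌋ * f (x ◃ S)
  drop x S with x ∈? S
  ... | yes x∈ rewrite ∈⇒true x∈ = z≤n
  ... | no x∉ rewrite ∉⇒false x∉ = ≤-trans (≤-reflexive (*-identityˡ _)) (*-monoˡ-≤ (f (x ◃ S))
    (ind-mono (λ t → true-⌊⌋ (∣ S ∣ ≟ r) (suc-injective (trans (sym (∣◃∣ x∉)) (⌊⌋-true (∣ x ◃ S ∣ ≟ suc r) t))))))

-- Pascal's rule on the first coordinate: if it lies outside T, a superset either spends one of its
-- j additional elements on it or omits it. The power n^j replaces the binomial coefficient because
-- only the order of magnitude matters later.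
count-⊇ : ∀ {n} (T : Subset n) j (P : Subset n → Bool) →
  (∀ S → P S ≡ true → T ⊆ˢ S × ∣ S ∣ ≡ ∣ T ∣ + j) → ∑ (subsets n) (ind ∘ P) ≤ n ^ j
count-⊇ {zero} [] zero    P h = +-monoˡ-≤ 0 (ind≤1 (P []))
count-⊇ {zero} [] (suc j) P h with P [] in eq
... | false = z≤n
... | true with () ← proj₂ (h [] eq)
count-⊇ {suc n} (true ∷ T) j P h = begin
  ∑ (subsets (suc n)) (ind ∘ P)
    ≡⟨ ∑-subsets n _ ⟩
  ∑ (subsets n) (λ S → ind (P (true ∷ S))) + ∑ (subsets n) (λ S → ind (P (false ∷ S)))
    ≤⟨ +-mono-≤ (count-⊇ T j (P ∘ (true ∷_)) (λ S p → drop-∷-⊆ (proj₁ (h _ p)) , suc-injective (proj₂ (h _ p))))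
        (≤-reflexive (∑-zero (subsets n) none)) ⟩
  n ^ j + 0
    ≡⟨ +-identityʳ _ ⟩
  n ^ j
    ≤⟨ ^-monoˡ-≤ j (n≤1+n n) ⟩
  suc n ^ j ∎
  where
  open ≤-Reasoning
  none : ∀ S → ind (P (false ∷ S)) ≡ 0
  none S with P (false ∷ S) in eq
  ... | false = refl
  ... | true with () ← ∈⇒true (proj₁ (h _ eq) {zero} (true⇒∈ refl))
count-⊇ {suc n} (false ∷ T) j P h = begin
  ∑ (subsets (suc n)) (ind ∘ P)
    ≡⟨ ∑-subsets n _ ⟩
  ∑ (subsets n) (λ S → ind (P (true ∷ S))) + ∑ (subsets n) (λ S → ind (P (false ∷ S)))
    ≤⟨ bound j h ⟩
  suc n ^ j ∎
  where
  open ≤-Reasoning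
  bound : ∀ j → (∀ S → P S ≡ true → false ∷ T ⊆ˢ S × ∣ S ∣ ≡ ∣ T ∣ + j) →
    ∑ (subsets n) (λ S → ind (P (true ∷ S))) + ∑ (subsets n) (λ S → ind (P (false ∷ S))) ≤ suc n ^ j
  bound zero h = +-mono-≤ (≤-reflexive (∑-zero (subsets n) none))
    (count-⊇ T 0 (P ∘ (false ∷_)) (λ S p → drop-∷-⊆ (proj₁ (h _ p)) , proj₂ (h _ p)))
    where
    none : ∀ S → ind (P (true ∷ S)) ≡ 0
    none S with P (true ∷ S) in eq
    ... | false = refl
    ... | true = ⊥-elim (<-irrefl refl (≤-trans (≤-reflexive (trans (proj₂ (h _ eq)) (+-identityʳ _))) (p⊆q⇒∣p∣≤∣q∣ {p = T} (drop-∷-⊆ (proj₁ (h _ eq))))))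
  bound (suc j) h = ≤-trans (+-mono-≤
    (count-⊇ T j (P ∘ (true ∷_)) (λ S p → drop-∷-⊆ (proj₁ (h _ p)) , suc-injective (trans (proj₂ (h _ p)) (+-suc ∣ T ∣ j))))
    (count-⊇ T (suc j) (P ∘ (false ∷_)) (λ S p → drop-∷-⊆ (proj₁ (h _ p)) , proj₂ (h _ p))))
    (*-monoʳ-≤ (suc n) (^-monoˡ-≤ j (n≤1+n n)))

-- Sums over 1 … n

Σ₁ : ℕ → (ℕ → ℕ) → ℕ
Σ₁ zero    f = 0
Σ₁ (suc n) f = Σ₁ n f + f (suc n)

Σ₁-mono : ∀ n {f g : ℕ → ℕ} → (∀ i → 1 ≤ i → i ≤ n → f i ≤ g i) → Σ₁ n f ≤ Σ₁ n g
Σ₁-mono zero    h = z≤n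
Σ₁-mono (suc n) h = +-mono-≤ (Σ₁-mono n (λ i i≥1 i≤n → h i i≥1 (m≤n⇒m≤1+n i≤n))) (h (suc n) (s≤s z≤n) ≤-refl)

Σ₁-cong : ∀ n {f g : ℕ → ℕ} → (∀ i → 1 ≤ i → i ≤ n → f i ≡ g i) → Σ₁ n f ≡ Σ₁ n g
Σ₁-cong n h = ≤-antisym (Σ₁-mono n (λ i p q → ≤-reflexive (h i p q))) (Σ₁-mono n (λ i p q → ≤-reflexive (sym (h i p q))))

Σ₁-+ : ∀ n (f g : ℕ → ℕ) → Σ₁ n (λ i → f i + g i) ≡ Σ₁ n f + Σ₁ n g
Σ₁-+ zero    f g = refl
Σ₁-+ (suc n) f g = trans (cong (_+ (f (suc n) + g (suc n))) (Σ₁-+ n f g)) (lemma (Σ₁ n f) (Σ₁ n g) (f (suc n)) (g (suc n)))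
  where
  lemma : ∀ a b c d → a + b + (c + d) ≡ a + c + (b + d)
  lemma = solve-∀

Σ₁-*ˡ : ∀ n c (f : ℕ → ℕ) → Σ₁ n (λ i → c * f i) ≡ c * Σ₁ n f
Σ₁-*ˡ zero    c f = sym (*-zeroʳ c)
Σ₁-*ˡ (suc n) c f = trans (cong (_+ c * f (suc n)) (Σ₁-*ˡ n c f)) (sym (*-distribˡ-+ c (Σ₁ n f) (f (suc n))))

Σ₁-const : ∀ n c → Σ₁ n (λ _ → c) ≡ c * n
Σ₁-const zero    c = sym (*-zeroʳ c)
Σ₁-const (suc n) c = trans (cong (_+ c) (Σ₁-const n c)) (trans (+-comm (c * n) c) (sym (*-suc c n)))

Σ₁-split : ∀ k l (f : ℕ → ℕ) → Σ₁ (k + l) f ≡ Σ₁ k f + Σ₁ l (λ i → f (k + i))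
Σ₁-split k zero    f = trans (cong (λ m → Σ₁ m f) (+-identityʳ k)) (sym (+-identityʳ _))
Σ₁-split k (suc l) f = trans (cong (λ m → Σ₁ m f) (+-suc k l))
  (trans (cong₂ _+_ (Σ₁-split k l f) (cong f (sym (+-suc k l)))) (+-assoc (Σ₁ k f) _ _))

Σ₁-head : ∀ n (f : ℕ → ℕ) → Σ₁ (suc n) f ≡ f 1 + Σ₁ n (f ∘ suc)
Σ₁-head n f = Σ₁-split 1 n f

Σ₁-reverse : ∀ n (f : ℕ → ℕ) → Σ₁ n (λ i → f (suc n ∸ i)) ≡ Σ₁ n f
Σ₁-reverse zero    f = refl
Σ₁-reverse (suc n) f = trans (Σ₁-head n (λ i → f (suc (suc n) ∸ i)))
  (trans (cong (f (suc n) +_) (Σ₁-reverse n f)) (+-comm (f (suc n)) (Σ₁ n f)))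

Σ₁-∑ : {A : Set} (xs : List A) → ∀ n (f : ℕ → A → ℕ) → Σ₁ n (λ i → ∑ xs (f i)) ≡ ∑ xs (λ x → Σ₁ n (λ i → f i x))
Σ₁-∑ xs zero    f = sym (∑-zero xs (λ _ → refl))
Σ₁-∑ xs (suc n) f = trans (cong (_+ ∑ xs (f (suc n))) (Σ₁-∑ xs n f)) (sym (∑-+ xs _ _))

-- The linear inequality ∑ X i / i ≤ X r for partially superadditive sequences

-- Averaging over the cycle type of a random permutation of g points, in which
-- the expected number of i-cycles is 1/i.
cycle-average : ∀ Λ (w d : ℕ → ℕ) K → (∀ i → 1 ≤ i → i ≤ K → i * w i ≡ Λ) →
  (∀ a b → 1 ≤ a → 1 ≤ b → a + b ≤ K → d (a + b) ≤ d a + d b) →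
  ∀ g → 1 ≤ g → g ≤ K → Λ * d g ≤ Σ₁ g (λ i → w i * d i)
cycle-average Λ w d K w-inv sub g = upto g g ≤-refl
  where
  S : ℕ → ℕ
  S g = Σ₁ g (λ i → w i * d i)
  -- Partial sums of `S`: summation by parts turns g S(g) into Λ times the sum of d(i) over i ≤ g,
  -- plus the sum of S(j) over j < g. The relation i w(i) = Λ removes the weights.
  T : ℕ → ℕ
  T zero    = 0
  T (suc g) = T g + S g
  identity : ∀ g → g ≤ K → g * S g ≡ Λ * Σ₁ g d + T g
  identity zero    _   = sym (trans (+-identityʳ _) (*-zeroʳ Λ))
  identity (suc g) g≤K = begin
    suc g * (S g + w (suc g) * d (suc g))
      ≡⟨ lemma₁ g (S g) (w (suc g)) (d (suc g)) ⟩
    g * S g + S g + suc g * w (suc g) * d (suc g)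
      ≡⟨ cong₂ (λ a b → a + S g + b * d (suc g)) (identity g (<⇒≤ g≤K)) (w-inv (suc g) (s≤s z≤n) g≤K) ⟩
    Λ * Σ₁ g d + T g + S g + Λ * d (suc g)
      ≡⟨ lemma₂ Λ (Σ₁ g d) (T g) (S g) (d (suc g)) ⟩
    Λ * (Σ₁ g d + d (suc g)) + (T g + S g) ∎
    where
    open ≡-Reasoning
    lemma₁ : ∀ g s w d → suc g * (s + w * d) ≡ g * s + s + suc g * w * d
    lemma₁ = solve-∀
    lemma₂ : ∀ Λ σ t s d → Λ * σ + t + s + Λ * d ≡ Λ * (σ + d) + (t + s)
    lemma₂ = solve-∀
  pairs : ∀ h → suc h ≤ K → h * d (suc h) ≤ Σ₁ h d + Σ₁ h d
  pairs h h<K = begin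
    h * d (suc h)                                 ≡⟨ *-comm h _ ⟩
    d (suc h) * h                                 ≡⟨ sym (Σ₁-const h _) ⟩
    Σ₁ h (λ _ → d (suc h))                        ≤⟨ Σ₁-mono h step ⟩
    Σ₁ h (λ i → d i + d (suc h ∸ i))              ≡⟨ Σ₁-+ h _ _ ⟩
    Σ₁ h d + Σ₁ h (λ i → d (suc h ∸ i))           ≡⟨ cong (Σ₁ h d +_) (Σ₁-reverse h d) ⟩
    Σ₁ h d + Σ₁ h d ∎
    where
    open ≤-Reasoning
    step : ∀ i → 1 ≤ i → i ≤ h → d (suc h) ≤ d i + d (suc h ∸ i)
    step i i≥1 i≤h = subst (λ m → d m ≤ d i + d (suc h ∸ i)) eq
      (sub i (suc h ∸ i) i≥1 (m<n⇒0<n∸m (s≤s i≤h)) (≤-trans (≤-reflexive eq) h<K))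
      where
      eq : i + (suc h ∸ i) ≡ suc h
      eq = m+[n∸m]≡n (m≤n⇒m≤1+n i≤h)
  -- Strong induction with bound g. By `pairs`, h d(h+1) is at most two copies of the sum of d(i)
  -- over i ≤ h. One copy is completed by d(h+1) to the sum up to h+1, the other is bounded by
  -- T(h+1) through the induction hypothesis, and `identity` recombines them.
  upto : ∀ g j → j ≤ g → 1 ≤ j → j ≤ K → Λ * d j ≤ S j
  upto zero    zero    z≤n () _
  upto (suc g) (suc h) (s≤s h≤g) _ h<K = *-cancelˡ-≤ (suc h) (begin
    suc h * (Λ * d (suc h))
      ≡⟨ lemma₁ h Λ (d (suc h)) ⟩
    Λ * (h * d (suc h)) + Λ * d (suc h)
      ≤⟨ +-monoˡ-≤ _ (*-monoʳ-≤ Λ (pairs h h<K)) ⟩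
    Λ * (Σ₁ h d + Σ₁ h d) + Λ * d (suc h)
      ≡⟨ lemma₂ Λ (Σ₁ h d) (d (suc h)) ⟩
    Λ * (Σ₁ h d + d (suc h)) + Λ * Σ₁ h d
      ≤⟨ +-monoʳ-≤ (Λ * Σ₁ (suc h) d) (tail h h≤g (<⇒≤ h<K)) ⟩
    Λ * Σ₁ (suc h) d + T (suc h)
      ≡⟨ sym (identity (suc h) h<K) ⟩
    suc h * S (suc h) ∎)
    where
    open ≤-Reasoning
    lemma₁ : ∀ h Λ d → suc h * (Λ * d) ≡ Λ * (h * d) + Λ * d
    lemma₁ = solve-∀
    lemma₂ : ∀ Λ σ d → Λ * (σ + σ) + Λ * d ≡ Λ * (σ + d) + Λ * σ
    lemma₂ = solve-∀
    tail : ∀ h → h ≤ g → h ≤ K → Λ * Σ₁ h d ≤ T (suc h)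
    tail zero    _   _   = ≤-trans (≤-reflexive (*-zeroʳ Λ)) z≤n
    tail (suc h) h<g h<K = ≤-trans (≤-reflexive (*-distribˡ-+ Λ (Σ₁ h d) (d (suc h))))
      (+-mono-≤ (tail h (<⇒≤ h<g) (<⇒≤ h<K)) (upto g (suc h) h<g (s≤s z≤n) h<K))

max-ratio : ∀ (X : ℕ → ℕ) k → 1 ≤ k →
  ∃ λ p → 1 ≤ p × p ≤ k × (∀ g → 1 ≤ g → g ≤ k → p * X g ≤ X p * g)
max-ratio X (suc zero) _ = 1 , ≤-refl , ≤-refl , only
  where
  only : ∀ g → 1 ≤ g → g ≤ 1 → 1 * X g ≤ X 1 * g
  only (suc zero)    _ _ = ≤-reflexive (*-comm 1 (X 1))
  only (suc (suc g)) _ (s≤s ())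
max-ratio X (suc (suc k)) _ with max-ratio X (suc k) (s≤s z≤n)
... | p , p≥1 , p≤k , best with p * X (suc (suc k)) ≤? X p * suc (suc k)
...   | yes le = p , p≥1 , m≤n⇒m≤1+n p≤k , best′
  where
  best′ : ∀ g → 1 ≤ g → g ≤ suc (suc k) → p * X g ≤ X p * g
  best′ g g≥1 g≤ with m≤n⇒m<n∨m≡n g≤
  ... | inj₁ (s≤s g≤k) = best g g≥1 g≤k
  ... | inj₂ refl      = le
...   | no ¬le = suc (suc k) , s≤s z≤n , ≤-refl , best′
  where
  K = suc (suc k)
  best′ : ∀ g → 1 ≤ g → g ≤ K → K * X g ≤ X K * g
  best′ g g≥1 g≤ with m≤n⇒m<n∨m≡n g≤
  ... | inj₂ refl      = ≤-reflexive (*-comm K (X K))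
  ... | inj₁ (s≤s g≤k) = *-cancelˡ-≤ p {{>-nonZero p≥1}} (begin
    p * (K * X g)  ≡⟨ lemma₁ p K (X g) ⟩
    K * (p * X g)  ≤⟨ *-monoʳ-≤ K (best g g≥1 g≤k) ⟩
    K * (X p * g)  ≡⟨ lemma₂ K (X p) g ⟩
    X p * K * g    ≤⟨ *-monoˡ-≤ g (<⇒≤ (≰⇒> ¬le)) ⟩
    p * X K * g    ≡⟨ *-assoc p (X K) g ⟩
    p * (X K * g)  ∎)
    where
    open ≤-Reasoning
    lemma₁ : ∀ a b c → a * (b * c) ≡ b * (a * c)
    lemma₁ = solve-∀
    lemma₂ : ∀ a b c → a * (b * c) ≡ b * a * c
    lemma₂ = solve-∀

-- Writing d g = ρ g − X g with ρ = max X g / g over g ≤ k, attained at p, the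
-- average D of d bounds every defect ρ g − (X (i + g) − X i), since all but at
-- most k of the g steps can be made in jumps of length p.
superadditive-average : ∀ Λ (w : ℕ → ℕ) k l (X : ℕ → ℕ) → 1 ≤ Λ → 1 ≤ k →
  (∀ i → 1 ≤ i → i ≤ k + l → i * w i ≡ Λ) →
  Σ₁ l (λ i → w (k + i)) ≤ Λ →
  (∀ a b → 1 ≤ a → a ≤ k → 1 ≤ b → a + b ≤ k + l → X a + X b ≤ X (a + b)) →
  Σ₁ (k + l) (λ i → w i * X i) ≤ Λ * X (k + l)
superadditive-average Λ w k l X Λ≥1 k≥1 w-inv tail≤ sup with max-ratio X k k≥1
... | p , p≥1 , p≤k , best = *-cancelˡ-≤ (Λ * p) {{>-nonZero (*-mono-≤ Λ≥1 p≥1)}} final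
  where
  r = k + l
  x = X p
  d : ℕ → ℕ
  -- Scaled by p, as ρ = x / p. The truncated subtraction is exact for 1 ≤ g ≤ k by the choice of p.
  d g = x * g ∸ p * X g
  d-eq : ∀ g → 1 ≤ g → g ≤ k → d g + p * X g ≡ x * g
  d-eq g g≥1 g≤k = m∸n+n≡m (best g g≥1 g≤k)
  d-sub : ∀ a b → 1 ≤ a → 1 ≤ b → a + b ≤ k → d (a + b) ≤ d a + d b
  d-sub a b a≥1 b≥1 ab≤k = ≤-by (d (a + b)) (d a + d b) 0 (*-monoʳ-≤ p (sup a b a≥1 a≤k b≥1 (≤-trans ab≤k (m≤m+n k l)))) (begin
    d (a + b) + p * X (a + b) + 0          ≡⟨ +-identityʳ _ ⟩
    d (a + b) + p * X (a + b)              ≡⟨ d-eq (a + b) (≤-trans a≥1 (m≤m+n a b)) ab≤k ⟩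
    x * (a + b)                            ≡⟨ *-distribˡ-+ x a b ⟩
    x * a + x * b                          ≡⟨ sym (cong₂ _+_ (d-eq a a≥1 a≤k) (d-eq b b≥1 (≤-trans (m≤n+m b a) ab≤k))) ⟩
    d a + p * X a + (d b + p * X b)        ≡⟨ lemma (d a) p (X a) (d b) (X b) ⟩
    d a + d b + p * (X a + X b)            ∎)
    where
    open ≡-Reasoning
    a≤k = ≤-trans (m≤m+n a b) ab≤k
    lemma : ∀ da p xa db xb → da + p * xa + (db + p * xb) ≡ da + db + p * (xa + xb)
    lemma = solve-∀
  D = Σ₁ k (λ i → w i * d i)
  Σ₁-≤ : ∀ j m (f : ℕ → ℕ) → Σ₁ j f ≤ Σ₁ (j + m) f
  Σ₁-≤ j m f = ≤-trans (m≤m+n _ _) (≤-reflexive (sym (Σ₁-split j m f)))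
  d≤D : ∀ g → 1 ≤ g → g ≤ k → Λ * d g ≤ D
  d≤D g g≥1 g≤k = ≤-trans (cycle-average Λ w d k (λ i p q → w-inv i p (≤-trans q (m≤m+n k l))) d-sub g g≥1 g≤k)
    (subst (λ m → Σ₁ g (λ i → w i * d i) ≤ Σ₁ m (λ i → w i * d i)) (m+[n∸m]≡n g≤k) (Σ₁-≤ g (k ∸ g) _))
  -- The first argument bounds the recursion. A gap g ≤ k is crossed at once, at the cost of one
  -- defect d(g); a longer gap starts with a jump of length p, which costs nothing because X p = ρ
  -- p.
  jump : ∀ m g i → g ≤ m → 1 ≤ i → i + g ≤ r → Λ * (p * X i + x * g) ≤ Λ * (p * X (i + g)) + D
  jump m zero i _ _ _ = ≤-trans (≤-reflexive (cong (Λ *_) (trans (cong (p * X i +_) (*-zeroʳ x))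
    (trans (+-identityʳ _) (cong (λ j → p * X j) (sym (+-identityʳ i))))))) (m≤m+n _ D)
  jump (suc m) (suc g) i (s≤s g≤m) i≥1 ≤r with suc g ≤? k
  ... | yes g≤k = ≤-by (Λ * (p * X i + x * suc g)) (Λ * (p * X (i + suc g)) + D) 0
    (+-mono-≤ (*-monoʳ-≤ (Λ * p) (sup (suc g) i (s≤s z≤n) g≤k i≥1 (≤-trans (≤-reflexive (+-comm (suc g) i)) ≤r)))
      (d≤D (suc g) (s≤s z≤n) g≤k))
    (trans (cong (λ y → Λ * (p * X i + y) + (Λ * p * X (suc g + i) + D) + 0) (sym (d-eq (suc g) (s≤s z≤n) g≤k)))
      (trans (cong (λ j → Λ * (p * X i + (d (suc g) + p * X (suc g))) + (Λ * p * X j + D) + 0) (+-comm (suc g) i))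
        (lemma Λ p (X i) (d (suc g)) (X (suc g)) (X (i + suc g)) D)))
    where
    lemma : ∀ Λ p xi dg xg xig D → Λ * (p * xi + (dg + p * xg)) + (Λ * p * xig + D) + 0
      ≡ Λ * (p * xig) + D + (Λ * p * (xg + xi) + Λ * dg)
    lemma = solve-∀
  ... | no g≰k = begin
    Λ * (p * X i + x * suc g)
      ≡⟨ cong (λ y → Λ * (p * X i + x * y)) (sym gp) ⟩
    Λ * (p * X i + x * (p + g′))
      ≡⟨ lemma Λ p (X i) x g′ ⟩
    Λ * (p * (x + X i) + x * g′)
      ≤⟨ *-monoʳ-≤ Λ (+-monoˡ-≤ _ (*-monoʳ-≤ p (sup p i p≥1 p≤k i≥1 (≤-trans (m≤m+n (p + i) g′) (≤-trans (≤-reflexive ig) ≤r))))) ⟩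
    Λ * (p * X (p + i) + x * g′)
      ≤⟨ jump m g′ (p + i) g′≤m (≤-trans p≥1 (m≤m+n p i)) (≤-trans (≤-reflexive ig) ≤r) ⟩
    Λ * (p * X (p + i + g′)) + D
      ≡⟨ cong (λ j → Λ * (p * X j) + D) ig ⟩
    Λ * (p * X (i + suc g)) + D ∎
    where
    open ≤-Reasoning
    g′ = suc g ∸ p
    gp : p + g′ ≡ suc g
    gp = m+[n∸m]≡n (≤-trans p≤k (<⇒≤ (≰⇒> g≰k)))
    g′≤m : g′ ≤ m
    g′≤m = ≤-pred (≤-trans (+-monoˡ-≤ g′ p≥1) (≤-trans (≤-reflexive gp) (s≤s g≤m)))
    ig : p + i + g′ ≡ i + suc g
    ig = trans (cong (_+ g′) (+-comm p i)) (trans (+-assoc i p g′) (cong (i +_) gp))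
    lemma : ∀ Λ p xi x g → Λ * (p * xi + x * (p + g)) ≡ Λ * (p * (x + xi) + x * g)
    lemma = solve-∀
  A = Σ₁ k (λ i → w i * X i)
  B = Σ₁ l (λ i → w (k + i) * X (k + i))
  s = Σ₁ l (λ i → w (k + i))
  small : p * A + D ≡ x * (Λ * k)
  small = begin
    p * A + D
      ≡⟨ cong (_+ D) (sym (Σ₁-*ˡ k p _)) ⟩
    Σ₁ k (λ i → p * (w i * X i)) + D
      ≡⟨ sym (Σ₁-+ k _ _) ⟩
    Σ₁ k (λ i → p * (w i * X i) + w i * d i)
      ≡⟨ Σ₁-cong k (λ i i≥1 i≤k → trans (lemma₁ p (w i) (X i) (d i)) (trans (cong (w i *_) (d-eq i i≥1 i≤k))
           (trans (lemma₂ (w i) x i) (cong (x *_) (w-inv i i≥1 (≤-trans i≤k (m≤m+n k l))))))) ⟩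
    Σ₁ k (λ _ → x * Λ)
      ≡⟨ Σ₁-const k (x * Λ) ⟩
    x * Λ * k
      ≡⟨ *-assoc x Λ k ⟩
    x * (Λ * k) ∎
    where
    open ≡-Reasoning
    lemma₁ : ∀ p w y d → p * (w * y) + w * d ≡ w * (d + p * y)
    lemma₁ = solve-∀
    lemma₂ : ∀ w x i → w * (x * i) ≡ x * (i * w)
    lemma₂ = solve-∀
  large : Λ * p * B + Λ * x * r * s ≤ (Λ * (p * X r) + D) * s + Λ * x * Λ * l
  large = begin
    Λ * p * B + Λ * x * r * s
      ≡⟨ cong₂ _+_ (sym (Σ₁-*ˡ l (Λ * p) _)) (sym (Σ₁-*ˡ l (Λ * x * r) _)) ⟩
    Σ₁ l (λ j → Λ * p * (w (k + j) * X (k + j))) + Σ₁ l (λ j → Λ * x * r * w (k + j))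
      ≡⟨ sym (Σ₁-+ l _ _) ⟩
    Σ₁ l (λ j → Λ * p * (w (k + j) * X (k + j)) + Λ * x * r * w (k + j))
      ≤⟨ Σ₁-mono l step ⟩
    Σ₁ l (λ j → (Λ * (p * X r) + D) * w (k + j) + Λ * x * Λ)
      ≡⟨ Σ₁-+ l _ _ ⟩
    Σ₁ l (λ j → (Λ * (p * X r) + D) * w (k + j)) + Σ₁ l (λ _ → Λ * x * Λ)
      ≡⟨ cong₂ _+_ (Σ₁-*ˡ l (Λ * (p * X r) + D) _) (Σ₁-const l (Λ * x * Λ)) ⟩
    (Λ * (p * X r) + D) * s + Λ * x * Λ * l ∎
    where
    open ≤-Reasoning
    step : ∀ j → 1 ≤ j → j ≤ l → Λ * p * (w (k + j) * X (k + j)) + Λ * x * r * w (k + j) ≤ (Λ * (p * X r) + D) * w (k + j) + Λ * x * Λ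
    step j j≥1 j≤l = begin
      Λ * p * (wi * X i) + Λ * x * r * wi
        ≡⟨ cong (λ y → Λ * p * (wi * X i) + Λ * x * y * wi) (sym ig) ⟩
      Λ * p * (wi * X i) + Λ * x * (i + g) * wi
        ≡⟨ lemma Λ p wi (X i) x i g ⟩
      Λ * (p * X i + x * g) * wi + Λ * x * (i * wi)
        ≤⟨ +-mono-≤ (*-monoˡ-≤ wi (subst (λ m → Λ * (p * X i + x * g) ≤ Λ * (p * X m) + D) ig (jump g g i ≤-refl i≥1 (≤-reflexive ig))))
             (≤-reflexive (cong (Λ * x *_) (w-inv i i≥1 (≤-trans (m≤m+n i g) (≤-reflexive ig))))) ⟩
      (Λ * (p * X r) + D) * wi + Λ * x * Λ ∎
      where
      i = k + j
      g = l ∸ j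
      wi = w i
      i≥1 = ≤-trans k≥1 (m≤m+n k j)
      ig : i + g ≡ r
      ig = trans (+-assoc k j g) (cong (k +_) (m+[n∸m]≡n j≤l))
      lemma : ∀ Λ p w y x i g → Λ * p * (w * y) + Λ * x * (i + g) * w ≡ Λ * (p * y + x * g) * w + Λ * x * (i * w)
      lemma = solve-∀
  top : Λ * x * r ≤ Λ * (p * X r) + D
  top = subst₂ (λ a b → a ≤ Λ * (p * X b) + D)
    (trans (lemma Λ p x (r ∸ p)) (cong (Λ * x *_) pr)) pr
    (jump (r ∸ p) (r ∸ p) p ≤-refl p≥1 (≤-reflexive pr))
    where
    pr : p + (r ∸ p) ≡ r
    pr = m+[n∸m]≡n (≤-trans p≤k (m≤m+n k l))
    lemma : ∀ Λ p x g → Λ * (p * x + x * g) ≡ Λ * x * (p + g)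
    lemma = solve-∀
  -- In `large` the terms with i > k lose D with total weight s, while `small` gains D with weight
  -- Λ. This is where s ≤ Λ is decisive; the remaining weight s′ is filled with copies of `top`.
  s′ = Λ ∸ s
  s+s′ : s + s′ ≡ Λ
  s+s′ = m+[n∸m]≡n tail≤
  final : Λ * p * Σ₁ r (λ i → w i * X i) ≤ Λ * p * (Λ * X r)
  final = ≤-by (Λ * p * Σ₁ r (λ i → w i * X i)) (Λ * p * (Λ * X r)) 0 (+-mono-≤ large (*-monoʳ-≤ s′ top)) (begin
    Λ * p * Σ₁ r (λ i → w i * X i) + ((Λ * (p * X r) + D) * s + Λ * x * Λ * l + s′ * (Λ * (p * X r) + D)) + 0
      ≡⟨ cong (λ z → Λ * p * z + ((Λ * (p * X r) + D) * s + Λ * x * Λ * l + s′ * (Λ * (p * X r) + D)) + 0) (Σ₁-split k l _) ⟩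
    Λ * p * (A + B) + ((Λ * (p * X r) + D) * s + Λ * x * Λ * l + s′ * (Λ * (p * X r) + D)) + 0
      ≡⟨ lemma₁ Λ p A B (X r) D s s′ (Λ * x * Λ * l) ⟩
    Λ * (p * A) + (s + s′) * D + Λ * p * B + (s + s′) * (Λ * (p * X r)) + Λ * x * Λ * l
      ≡⟨ cong (λ z → Λ * (p * A) + z * D + Λ * p * B + z * (Λ * (p * X r)) + Λ * x * Λ * l) s+s′ ⟩
    Λ * (p * A) + Λ * D + Λ * p * B + Λ * (Λ * (p * X r)) + Λ * x * Λ * l
      ≡⟨ lemma₂ Λ p A D B (X r) (Λ * x * Λ * l) ⟩
    Λ * (p * A + D) + Λ * p * B + Λ * (Λ * (p * X r)) + Λ * x * Λ * l
      ≡⟨ cong (λ z → Λ * z + Λ * p * B + Λ * (Λ * (p * X r)) + Λ * x * Λ * l) small ⟩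
    Λ * (x * (Λ * k)) + Λ * p * B + Λ * (Λ * (p * X r)) + Λ * x * Λ * l
      ≡⟨ lemma₃ Λ x k l p B (X r) ⟩
    Λ * p * (Λ * X r) + (Λ * p * B + Λ * x * r * Λ)
      ≡⟨ cong (λ z → Λ * p * (Λ * X r) + (Λ * p * B + Λ * x * r * z)) (sym s+s′) ⟩
    Λ * p * (Λ * X r) + (Λ * p * B + Λ * x * r * (s + s′))
      ≡⟨ lemma₄ (Λ * p * (Λ * X r)) (Λ * p * B) (Λ * x * r) s s′ ⟩
    Λ * p * (Λ * X r) + (Λ * p * B + Λ * x * r * s + s′ * (Λ * x * r)) ∎)
    where
    open ≡-Reasoning
    lemma₁ : ∀ Λ p A B X D s s′ e → Λ * p * (A + B) + ((Λ * (p * X) + D) * s + e + s′ * (Λ * (p * X) + D)) + 0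
      ≡ Λ * (p * A) + (s + s′) * D + Λ * p * B + (s + s′) * (Λ * (p * X)) + e
    lemma₁ = solve-∀
    lemma₂ : ∀ Λ p A D B X e → Λ * (p * A) + Λ * D + Λ * p * B + Λ * (Λ * (p * X)) + e ≡ Λ * (p * A + D) + Λ * p * B + Λ * (Λ * (p * X)) + e
    lemma₂ = solve-∀
    lemma₃ : ∀ Λ x k l p B X → Λ * (x * (Λ * k)) + Λ * p * B + Λ * (Λ * (p * X)) + Λ * x * Λ * l ≡ Λ * p * (Λ * X) + (Λ * p * B + Λ * x * (k + l) * Λ)
    lemma₃ = solve-∀
    lemma₄ : ∀ a b c s s′ → a + (b + c * (s + s′)) ≡ a + (b + c * s + s′ * c)
    lemma₄ = solve-∀

-- Truncated exponentials

-- exp≤ Λ s N = N! Λ^N ∑_{j ≤ N} (s/Λ)^j / j!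
exp≤ : ℕ → ℕ → ℕ → ℕ
exp≤ Λ s zero    = 1
exp≤ Λ s (suc N) = suc N * (Λ * exp≤ Λ s N) + s ^ suc N

-- The mean value theorem for x ↦ x^(j+1), with the derivative estimated at the right end point.
power-increment : ∀ s t j → (s + t) ^ suc j ≤ s ^ suc j + suc j * (t * (s + t) ^ j)
power-increment s t zero    = ≤-reflexive (lemma s t)
  where
  lemma : ∀ s t → (s + t) * 1 ≡ s * 1 + 1 * (t * 1)
  lemma = solve-∀
power-increment s t (suc j) = begin
  (s + t) * (s + t) ^ suc j
    ≡⟨ *-distribʳ-+ ((s + t) ^ suc j) s t ⟩
  s * (s + t) ^ suc j + t * (s + t) ^ suc j
    ≤⟨ +-monoˡ-≤ _ (*-monoʳ-≤ s (power-increment s t j)) ⟩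
  s * (s ^ suc j + suc j * (t * (s + t) ^ j)) + t * (s + t) ^ suc j
    ≤⟨ ≤-trans (m≤m+n _ (suc j * (t * (t * (s + t) ^ j)))) (≤-reflexive (lemma s t j (s ^ suc j) ((s + t) ^ j))) ⟩
  s * s ^ suc j + suc (suc j) * (t * (s + t) ^ suc j) ∎
  where
  open ≤-Reasoning
  lemma : ∀ s t j a p → s * (a + suc j * (t * p)) + t * ((s + t) * p) + suc j * (t * (t * p))
    ≡ s * a + suc (suc j) * (t * ((s + t) * p))
  lemma = solve-∀

-- The same estimate for truncated exponentials: the derivative of the truncation at order N + 1 is
-- the truncation at order N.
exp≤-increment : ∀ Λ s t N → exp≤ Λ (s + t) (suc N) ≤ exp≤ Λ s (suc N) + suc N * (t * exp≤ Λ (s + t) N)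
exp≤-increment Λ s t zero    = ≤-reflexive (lemma Λ s t)
  where
  lemma : ∀ Λ s t → 1 * (Λ * 1) + (s + t) * 1 ≡ 1 * (Λ * 1) + s * 1 + 1 * (t * 1)
  lemma = solve-∀
exp≤-increment Λ s t (suc N) = begin
  suc (suc N) * (Λ * exp≤ Λ (s + t) (suc N)) + (s + t) ^ suc (suc N)
    ≤⟨ +-mono-≤ (*-monoʳ-≤ (suc (suc N)) (*-monoʳ-≤ Λ (exp≤-increment Λ s t N))) (power-increment s t (suc N)) ⟩
  suc (suc N) * (Λ * (exp≤ Λ s (suc N) + suc N * (t * exp≤ Λ (s + t) N))) + (s ^ suc (suc N) + suc (suc N) * (t * (s + t) ^ suc N))
    ≡⟨ lemma Λ t N (exp≤ Λ s (suc N)) (exp≤ Λ (s + t) N) (s ^ suc (suc N)) ((s + t) ^ suc N) ⟩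
  suc (suc N) * (Λ * exp≤ Λ s (suc N)) + s ^ suc (suc N) + suc (suc N) * (t * (suc N * (Λ * exp≤ Λ (s + t) N) + (s + t) ^ suc N)) ∎
  where
  open ≤-Reasoning
  lemma : ∀ Λ t N a b p q → suc (suc N) * (Λ * (a + suc N * (t * b))) + (p + suc (suc N) * (t * q))
    ≡ suc (suc N) * (Λ * a) + p + suc (suc N) * (t * (suc N * (Λ * b) + q))
  lemma = solve-∀

-- exp (x + y) ≤ exp x / (1 − y) at y = 1/(i+1)
exp≤-ratio : ∀ Λ s i w N → suc i * w ≡ Λ → 1 ≤ w → i * exp≤ Λ (s + w) N ≤ suc i * exp≤ Λ s N
exp≤-ratio Λ s i w zero    eq w≥1 = *-monoˡ-≤ 1 (n≤1+n i)
exp≤-ratio Λ s i w (suc N) eq w≥1 = *-cancelˡ-≤ w {{>-nonZero w≥1}}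
  (≤-by (w * (i * e)) (w * (suc i * e₀)) (w * (s + w) ^ suc N) (*-monoʳ-≤ Λ (exp≤-increment Λ s w N)) (begin
    w * (i * e) + Λ * (e₀ + suc N * (w * e₁)) + w * p
      ≡⟨ cong (λ z → w * (i * e) + z * (e₀ + suc N * (w * e₁)) + w * p) (sym eq) ⟩
    w * (i * e) + suc i * w * (e₀ + suc N * (w * e₁)) + w * p
      ≡⟨ lemma w i e e₀ N e₁ p ⟩
    w * (suc i * e₀) + (w * i * e + w * (suc N * (suc i * w * e₁) + p))
      ≡⟨ cong (λ z → w * (suc i * e₀) + (w * i * e + w * (suc N * (z * e₁) + p))) eq ⟩
    w * (suc i * e₀) + (w * i * e + w * e)
      ≡⟨ cong (λ z → w * (suc i * e₀) + z) (trans (lemma′ w i e) (cong (_* e) eq)) ⟩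
    w * (suc i * e₀) + Λ * e ∎))
  where
  open ≡-Reasoning
  p = (s + w) ^ suc N
  e = exp≤ Λ (s + w) (suc N)
  e₀ = exp≤ Λ s (suc N)
  e₁ = exp≤ Λ (s + w) N
  lemma : ∀ w i e e₀ N e₁ p → w * (i * e) + suc i * w * (e₀ + suc N * (w * e₁)) + w * p
    ≡ w * (suc i * e₀) + (w * i * e + w * (suc N * (suc i * w * e₁) + p))
  lemma = solve-∀
  lemma′ : ∀ w i e → w * i * e + w * e ≡ suc i * w * e
  lemma′ = solve-∀

exp≤-0 : ∀ Λ N → exp≤ Λ 0 N ≡ N ! * Λ ^ N
exp≤-0 Λ zero    = refl
exp≤-0 Λ (suc N) = trans (+-identityʳ _) (trans (cong (λ z → suc N * (Λ * z)) (exp≤-0 Λ N)) (lemma N Λ (N !) (Λ ^ N)))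
  where
  lemma : ∀ N Λ a b → suc N * (Λ * (a * b)) ≡ suc N * a * (Λ * b)
  lemma = solve-∀

-- The bounds exp (1/i) ≤ i/(i-1) for k < i ≤ k + l have a telescoping product (k + l)/k.
exp≤-harmonic : ∀ Λ (w : ℕ → ℕ) k → 1 ≤ k → ∀ l N → (∀ i → 1 ≤ i → i ≤ l → (k + i) * w (k + i) ≡ Λ × 1 ≤ w (k + i)) →
  k * exp≤ Λ (Σ₁ l (λ i → w (k + i))) N ≤ (k + l) * (N ! * Λ ^ N)
exp≤-harmonic Λ w k k≥1 zero    N h = ≤-reflexive (cong₂ _*_ (sym (+-identityʳ k)) (exp≤-0 Λ N))
exp≤-harmonic Λ w k k≥1 (suc l) N h = *-cancelˡ-≤ (k + l) {{>-nonZero (≤-trans k≥1 (m≤m+n k l))}} (begin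
  (k + l) * (k * e)                ≡⟨ lemma (k + l) k e ⟩
  k * ((k + l) * e)                ≤⟨ *-monoʳ-≤ k (exp≤-ratio Λ _ (k + l) (w (k + suc l)) N
                                        (trans (cong (_* w (k + suc l)) (sym (+-suc k l))) (proj₁ (h (suc l) (s≤s z≤n) ≤-refl)))
                                        (proj₂ (h (suc l) (s≤s z≤n) ≤-refl))) ⟩
  k * (suc (k + l) * e₀)           ≡⟨ lemma k (suc (k + l)) e₀ ⟩
  suc (k + l) * (k * e₀)           ≤⟨ *-monoʳ-≤ (suc (k + l)) (exp≤-harmonic Λ w k k≥1 l N (λ i p q → h i p (m≤n⇒m≤1+n q))) ⟩
  suc (k + l) * ((k + l) * c)      ≡⟨ lemma (suc (k + l)) (k + l) c ⟩
  (k + l) * (suc (k + l) * c)      ≡⟨ cong (λ z → (k + l) * (z * c)) (sym (+-suc k l)) ⟩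
  (k + l) * ((k + suc l) * c)      ∎)
  where
  open ≤-Reasoning
  e = exp≤ Λ (Σ₁ (suc l) (λ i → w (k + i))) N
  e₀ = exp≤ Λ (Σ₁ l (λ i → w (k + i))) N
  c = N ! * Λ ^ N
  lemma : ∀ a b c → a * (b * c) ≡ b * (a * c)
  lemma = solve-∀

-- As s is an integer, exceeding Λ means s/Λ ≥ 1 + 1/Λ, and the linear term of the series alone then
-- gains 1/Λ over the partial sum at 1.
exp≤-gap : ∀ Λ s N → suc Λ ≤ s → Λ ^ suc N * exp≤ 1 1 (suc N) + suc N ! * Λ ^ N ≤ exp≤ Λ s (suc N)
exp≤-gap Λ s zero    Λ<s = ≤-trans (≤-reflexive (lemma Λ)) (+-monoʳ-≤ (1 * (Λ * 1)) (≤-trans Λ<s (≤-reflexive (sym (*-identityʳ s)))))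
  where
  lemma : ∀ Λ → Λ * 1 * (1 * (1 * 1) + 1 * 1) + 1 * 1 * 1 ≡ 1 * (Λ * 1) + suc Λ
  lemma = solve-∀
exp≤-gap Λ s (suc N) Λ<s = begin
  Λ ^ suc M * (suc M * (1 * exp≤ 1 1 M) + 1 ^ suc M) + suc M * M ! * (Λ ^ M)
    ≡⟨ cong (λ z → Λ ^ suc M * (suc M * (1 * exp≤ 1 1 M) + z) + suc M * M ! * (Λ ^ M)) (^-zeroˡ (suc M)) ⟩
  Λ ^ suc M * (suc M * (1 * exp≤ 1 1 M) + 1) + suc M * M ! * (Λ ^ M)
    ≡⟨ lemma Λ (Λ ^ N) M (exp≤ 1 1 M) (M !) ⟩
  suc M * (Λ * (Λ ^ M * exp≤ 1 1 M + M ! * Λ ^ N)) + Λ ^ suc M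
    ≤⟨ +-mono-≤ (*-monoʳ-≤ (suc M) (*-monoʳ-≤ Λ (exp≤-gap Λ s N Λ<s))) (^-monoˡ-≤ (suc M) (<⇒≤ Λ<s)) ⟩
  suc M * (Λ * exp≤ Λ s M) + s ^ suc M ∎
  where
  open ≤-Reasoning
  M = suc N
  lemma : ∀ Λ p M e f → Λ * (Λ * p) * (suc M * (1 * e) + 1) + suc M * f * (Λ * p)
    ≡ suc M * (Λ * (Λ * p * e + f * p)) + Λ * (Λ * p)
  lemma = solve-∀

-- The approximations of e with denominators cleared

ℕtoℚ-+ : ∀ a b → ℕtoℚ a ℚ.+ ℕtoℚ b ≡ ℕtoℚ (a + b)
ℕtoℚ-+ a b = ℚₚ.toℚᵘ-injective (ℚᵘₚ.≃-trans (ℚₚ.toℚᵘ-homo-+ (ℕtoℚ a) (ℕtoℚ b))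
  (ℚᵘₚ.≃-trans (ℚᵘₚ.+-cong (ℚₚ.toℚᵘ-fromℚᵘ (mkℚᵘ (ℤ.+ a) 0)) (ℚₚ.toℚᵘ-fromℚᵘ (mkℚᵘ (ℤ.+ b) 0)))
  (ℚᵘₚ.≃-trans (*≡* (cong (ℤ._* ℤ.+ 1) (cong₂ ℤ._+_ (ℤₚ.*-identityʳ (ℤ.+ a)) (ℤₚ.*-identityʳ (ℤ.+ b)))))
    (ℚᵘₚ.≃-sym (ℚₚ.toℚᵘ-fromℚᵘ (mkℚᵘ (ℤ.+ (a + b)) 0))))))

ℕtoℚ-* : ∀ a b → ℕtoℚ a ℚ.* ℕtoℚ b ≡ ℕtoℚ (a * b)
ℕtoℚ-* a b = ℚₚ.toℚᵘ-injective (ℚᵘₚ.≃-trans (ℚₚ.toℚᵘ-homo-* (ℕtoℚ a) (ℕtoℚ b))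
  (ℚᵘₚ.≃-trans (ℚᵘₚ.*-cong (ℚₚ.toℚᵘ-fromℚᵘ (mkℚᵘ (ℤ.+ a) 0)) (ℚₚ.toℚᵘ-fromℚᵘ (mkℚᵘ (ℤ.+ b) 0)))
  (ℚᵘₚ.≃-trans (*≡* (cong (ℤ._* ℤ.+ 1) (sym (ℤₚ.pos-* a b))))
    (ℚᵘₚ.≃-sym (ℚₚ.toℚᵘ-fromℚᵘ (mkℚᵘ (ℤ.+ (a * b)) 0))))))

ℕtoℚ-cancel-≤ : ∀ a b → ℕtoℚ a ℚ.≤ ℕtoℚ b → a ≤ b
ℕtoℚ-cancel-≤ a b le with ℚᵘₚ.≤-respˡ-≃ (ℚₚ.toℚᵘ-fromℚᵘ (mkℚᵘ (ℤ.+ a) 0)) (ℚᵘₚ.≤-respʳ-≃ (ℚₚ.toℚᵘ-fromℚᵘ (mkℚᵘ (ℤ.+ b) 0)) (ℚₚ.toℚᵘ-mono-≤ le))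
... | *≤* p = ℤₚ.drop‿+≤+ (subst₂ ℤ._≤_ (ℤₚ.*-identityʳ (ℤ.+ a)) (ℤₚ.*-identityʳ (ℤ.+ b)) p)

reciprocal : ∀ j → (ℤ.+ 1 ℚ./ suc j) ℚ.* ℕtoℚ (suc j) ≡ 1ℚ
reciprocal j = ℚₚ.toℚᵘ-injective (ℚᵘₚ.≃-trans (ℚₚ.toℚᵘ-homo-* (ℤ.+ 1 ℚ./ suc j) (ℕtoℚ (suc j)))
  (ℚᵘₚ.≃-trans (ℚᵘₚ.*-cong (ℚₚ.toℚᵘ-fromℚᵘ (mkℚᵘ (ℤ.+ 1) j)) (ℚₚ.toℚᵘ-fromℚᵘ (mkℚᵘ (ℤ.+ suc j) 0)))
    (*≡* (trans (ℤₚ.*-identityʳ _) (trans (ℤₚ.*-identityˡ (ℤ.+ suc j)) (sym (trans (ℤₚ.*-identityˡ _) (cong (λ m → ℤ.+ suc m) (*-identityʳ j)))))))))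

module _ where
  open ≡-Reasoning

  invFact-! : ∀ N → invFact N ℚ.* ℕtoℚ (N !) ≡ 1ℚ
  invFact-! zero    = refl
  invFact-! (suc N) = begin
    invFact N ℚ.* u ℚ.* ℕtoℚ (suc N * N !)              ≡⟨ cong (invFact N ℚ.* u ℚ.*_) (sym (ℕtoℚ-* (suc N) (N !))) ⟩
    invFact N ℚ.* u ℚ.* (ℕtoℚ (suc N) ℚ.* ℕtoℚ (N !))   ≡⟨ sym (ℚₚ.*-assoc (invFact N ℚ.* u) (ℕtoℚ (suc N)) _) ⟩
    invFact N ℚ.* u ℚ.* ℕtoℚ (suc N) ℚ.* ℕtoℚ (N !)     ≡⟨ cong (ℚ._* ℕtoℚ (N !)) (ℚₚ.*-assoc (invFact N) u (ℕtoℚ (suc N))) ⟩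
    invFact N ℚ.* (u ℚ.* ℕtoℚ (suc N)) ℚ.* ℕtoℚ (N !)   ≡⟨ cong (λ z → invFact N ℚ.* z ℚ.* ℕtoℚ (N !)) (reciprocal N) ⟩
    invFact N ℚ.* 1ℚ ℚ.* ℕtoℚ (N !)                     ≡⟨ cong (ℚ._* ℕtoℚ (N !)) (ℚₚ.*-identityʳ (invFact N)) ⟩
    invFact N ℚ.* ℕtoℚ (N !)                            ≡⟨ invFact-! N ⟩
    1ℚ ∎
    where
    u = ℤ.+ 1 ℚ./ suc N

  eLower-! : ∀ N → eLower N ℚ.* ℕtoℚ (N !) ≡ ℕtoℚ (exp≤ 1 1 N)
  eLower-! zero    = refl
  eLower-! (suc N) = begin
    (eLower N ℚ.+ invFact (suc N)) ℚ.* ℕtoℚ (suc N !)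
      ≡⟨ ℚₚ.*-distribʳ-+ (ℕtoℚ (suc N !)) (eLower N) (invFact (suc N)) ⟩
    eLower N ℚ.* ℕtoℚ (suc N !) ℚ.+ invFact (suc N) ℚ.* ℕtoℚ (suc N !)
      ≡⟨ cong₂ ℚ._+_ (cong (λ z → eLower N ℚ.* ℕtoℚ z) (*-comm (suc N) (N !))) (invFact-! (suc N)) ⟩
    eLower N ℚ.* ℕtoℚ (N ! * suc N) ℚ.+ ℕtoℚ 1
      ≡⟨ cong (λ z → eLower N ℚ.* z ℚ.+ ℕtoℚ 1) (sym (ℕtoℚ-* (N !) (suc N))) ⟩
    eLower N ℚ.* (ℕtoℚ (N !) ℚ.* ℕtoℚ (suc N)) ℚ.+ ℕtoℚ 1
      ≡⟨ cong (ℚ._+ ℕtoℚ 1) (sym (ℚₚ.*-assoc (eLower N) (ℕtoℚ (N !)) (ℕtoℚ (suc N)))) ⟩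
    eLower N ℚ.* ℕtoℚ (N !) ℚ.* ℕtoℚ (suc N) ℚ.+ ℕtoℚ 1
      ≡⟨ cong (λ z → z ℚ.* ℕtoℚ (suc N) ℚ.+ ℕtoℚ 1) (eLower-! N) ⟩
    ℕtoℚ (exp≤ 1 1 N) ℚ.* ℕtoℚ (suc N) ℚ.+ ℕtoℚ 1
      ≡⟨ cong (ℚ._+ ℕtoℚ 1) (ℕtoℚ-* (exp≤ 1 1 N) (suc N)) ⟩
    ℕtoℚ (exp≤ 1 1 N * suc N) ℚ.+ ℕtoℚ 1
      ≡⟨ ℕtoℚ-+ (exp≤ 1 1 N * suc N) 1 ⟩
    ℕtoℚ (exp≤ 1 1 N * suc N + 1)
      ≡⟨ cong ℕtoℚ (cong₂ _+_ (trans (*-comm (exp≤ 1 1 N) (suc N)) (cong (suc N *_) (sym (*-identityˡ (exp≤ 1 1 N))))) (sym (^-zeroˡ (suc N)))) ⟩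
    ℕtoℚ (exp≤ 1 1 (suc N)) ∎

  -- One half of the correction 2/(N+1)! is the next term of the series, so `eUpper N` is
  -- `eLower (suc N)` plus 1/(N+1)!.
  eUpper-! : ∀ N → eUpper N ℚ.* ℕtoℚ (suc N !) ≡ ℕtoℚ (suc (exp≤ 1 1 (suc N)))
  eUpper-! N = begin
    (eLower N ℚ.+ ℕtoℚ 2 ℚ.* invFact (suc N)) ℚ.* ℕtoℚ (suc N !)
      ≡⟨ cong (λ z → (eLower N ℚ.+ z) ℚ.* ℕtoℚ (suc N !)) two ⟩
    (eLower N ℚ.+ (invFact (suc N) ℚ.+ invFact (suc N))) ℚ.* ℕtoℚ (suc N !)
      ≡⟨ cong (ℚ._* ℕtoℚ (suc N !)) (sym (ℚₚ.+-assoc (eLower N) (invFact (suc N)) (invFact (suc N)))) ⟩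
    (eLower (suc N) ℚ.+ invFact (suc N)) ℚ.* ℕtoℚ (suc N !)
      ≡⟨ ℚₚ.*-distribʳ-+ (ℕtoℚ (suc N !)) (eLower (suc N)) (invFact (suc N)) ⟩
    eLower (suc N) ℚ.* ℕtoℚ (suc N !) ℚ.+ invFact (suc N) ℚ.* ℕtoℚ (suc N !)
      ≡⟨ cong₂ ℚ._+_ (eLower-! (suc N)) (invFact-! (suc N)) ⟩
    ℕtoℚ (exp≤ 1 1 (suc N)) ℚ.+ ℕtoℚ 1
      ≡⟨ ℕtoℚ-+ (exp≤ 1 1 (suc N)) 1 ⟩
    ℕtoℚ (exp≤ 1 1 (suc N) + 1)
      ≡⟨ cong ℕtoℚ (+-comm (exp≤ 1 1 (suc N)) 1) ⟩
    ℕtoℚ (suc (exp≤ 1 1 (suc N))) ∎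
    where
    two : ℕtoℚ 2 ℚ.* invFact (suc N) ≡ invFact (suc N) ℚ.+ invFact (suc N)
    two = trans (cong (ℚ._* invFact (suc N)) (sym (ℕtoℚ-+ 1 1))) (trans (ℚₚ.*-distribʳ-+ (invFact (suc N)) 1ℚ 1ℚ)
      (cong₂ ℚ._+_ (ℚₚ.*-identityˡ (invFact (suc N))) (ℚₚ.*-identityˡ (invFact (suc N)))))

LeMulE⇒exp≤ : ∀ r k → LeMulE r k → ∀ N → r * suc N ! ≤ k * suc (exp≤ 1 1 (suc N))
LeMulE⇒exp≤ r k le N = ℕtoℚ-cancel-≤ _ _ (subst₂ ℚ._≤_ (ℕtoℚ-* r (suc N !))
  (trans (ℚₚ.*-assoc (ℕtoℚ k) (eUpper N) (ℕtoℚ (suc N !))) (trans (cong (ℕtoℚ k ℚ.*_) (eUpper-! N)) (ℕtoℚ-* k _)))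
  (ℚₚ.*-monoʳ-≤-nonNeg (ℕtoℚ (suc N !)) {{ℚₚ.normalize-nonNeg (suc N !) 1}} (le N)))

-- If ∑_{k < i ≤ k+l} 1/i exceeded 1 then (k + l)/k = ∏ i/(i-1) ≥ exp (∑ 1/i) would exceed e.
harmonic≤1 : ∀ Λ (w : ℕ → ℕ) k l → 1 ≤ k → 1 ≤ Λ → LeMulE (k + l) k →
  (∀ i → 1 ≤ i → i ≤ k + l → i * w i ≡ Λ) → Σ₁ l (λ i → w (k + i)) ≤ Λ
harmonic≤1 Λ w k l k≥1 Λ≥1 le w-inv with Σ₁ l (λ i → w (k + i)) ≤? Λ
... | yes p = p
... | no ¬p = contradiction (≤-trans (m≤m*n (suc Λ) (Λ !) {{Λ !≢0}}) small) (<⇒≱ ≤-refl)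
  where
  s = Σ₁ l (λ i → w (k + i))
  -- The truncation order. The upper approximation exceeds the partial sum of order M by 1/M!, which
  -- is smaller than the gap 1/Λ from `exp≤-gap`; this leads to the absurd M! ≤ Λ in `small`.
  M = suc Λ
  bound : k * (Λ ^ M * exp≤ 1 1 M + M ! * Λ ^ Λ) ≤ k * (Λ ^ M * suc (exp≤ 1 1 M))
  bound = begin
    k * (Λ ^ M * exp≤ 1 1 M + M ! * Λ ^ Λ)   ≤⟨ *-monoʳ-≤ k (exp≤-gap Λ s Λ (≰⇒> ¬p)) ⟩
    k * exp≤ Λ s M                           ≤⟨ exp≤-harmonic Λ w k k≥1 l M inv ⟩
    (k + l) * (M ! * Λ ^ M)                  ≡⟨ sym (*-assoc (k + l) (M !) (Λ ^ M)) ⟩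
    (k + l) * M ! * Λ ^ M                    ≤⟨ *-monoˡ-≤ (Λ ^ M) (LeMulE⇒exp≤ (k + l) k le Λ) ⟩
    k * suc (exp≤ 1 1 M) * Λ ^ M             ≡⟨ lemma k (suc (exp≤ 1 1 M)) (Λ ^ M) ⟩
    k * (Λ ^ M * suc (exp≤ 1 1 M))           ∎
    where
    open ≤-Reasoning
    lemma : ∀ a b c → a * b * c ≡ a * (c * b)
    lemma = solve-∀
    inv : ∀ i → 1 ≤ i → i ≤ l → (k + i) * w (k + i) ≡ Λ × 1 ≤ w (k + i)
    inv i i≥1 i≤l = eq , n≢0⇒n>0 (λ w≡0 → <⇒≢ Λ≥1 (trans (sym (trans (cong ((k + i) *_) w≡0) (*-zeroʳ (k + i)))) eq))
      where
      eq = w-inv (k + i) (≤-trans k≥1 (m≤m+n k i)) (+-monoʳ-≤ k i≤l)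
  small : M ! ≤ Λ
  small = *-cancelʳ-≤ (M !) Λ (Λ ^ Λ) {{m^n≢0 Λ Λ {{>-nonZero Λ≥1}}}} (+-cancelˡ-≤ (Λ ^ M * exp≤ 1 1 M) _ _
    (≤-trans (*-cancelˡ-≤ k {{>-nonZero k≥1}} bound) (≤-reflexive (trans (*-suc (Λ ^ M) _) (+-comm (Λ ^ M) _)))))

-- The inequality of arithmetic and geometric means

2ab≤a²+b² : ∀ a b → 2 * (a * b) ≤ a * a + b * b
2ab≤a²+b² a b with ≤-total a b
... | inj₁ a≤b = subst (λ z → 2 * (a * z) ≤ a * a + z * z) (m+[n∸m]≡n a≤b) (shifted a (b ∸ a))
  where
  shifted : ∀ a d → 2 * (a * (a + d)) ≤ a * a + (a + d) * (a + d)
  shifted a d = ≤-trans (m≤m+n _ (d * d)) (≤-reflexive (lemma a d))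
    where
    lemma : ∀ a d → 2 * (a * (a + d)) + d * d ≡ a * a + (a + d) * (a + d)
    lemma = solve-∀
... | inj₂ b≤a = subst (λ z → 2 * (z * b) ≤ z * z + b * b) (m+[n∸m]≡n b≤a) (shifted b (a ∸ b))
  where
  shifted : ∀ b d → 2 * ((b + d) * b) ≤ (b + d) * (b + d) + b * b
  shifted b d = ≤-trans (m≤m+n _ (d * d)) (≤-reflexive (lemma b d))
    where
    lemma : ∀ b d → 2 * ((b + d) * b) + d * d ≡ (b + d) * (b + d) + b * b
    lemma = solve-∀

-- The graph of x ↦ x^(j+1) lies above its tangent at a.
tangent : ∀ a b j → suc j * (a ^ j * b) ≤ b ^ suc j + j * a ^ suc j
tangent a b zero    = ≤-reflexive (lemma b)
  where
  lemma : ∀ b → 1 * (1 * b) ≡ b * 1 + 0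
  lemma = solve-∀
tangent a b (suc j) = ≤-by _ _ 0
  (+-mono-≤ (*-monoˡ-≤ b (tangent a b j)) (*-monoʳ-≤ (suc j * a ^ j) (2ab≤a²+b² a b)))
  (lemma a b j (a ^ j) (b ^ j))
  where
  lemma : ∀ a b j p q →
    suc (suc j) * (a * p * b) + ((b * q + j * (a * p)) * b + suc j * p * (a * a + b * b)) + 0
    ≡ b * (b * q) + suc j * (a * (a * p)) + (suc j * (p * b) * b + suc j * p * (2 * (a * b)))
  lemma = solve-∀

am-gm : ∀ ys → length ys ^ length ys * product ys ≤ sum ys ^ length ys
am-gm []               = ≤-refl
am-gm (y ∷ [])         = ≤-reflexive (lemma y)
  where
  lemma : ∀ y → 1 * 1 * (y * 1) ≡ (y + 0) * 1
  lemma = solve-∀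
am-gm (y ∷ ys@(_ ∷ _)) = *-cancelˡ-≤ (j ^ suc j) {{m^n≢0 j (suc j)}} (begin
  j ^ suc j * (suc j ^ suc j * (y * P))
    ≡⟨ lemma₁ j (j ^ j) (suc j ^ suc j) y P ⟩
  suc j ^ suc j * (j * y) * (j ^ j * P)
    ≤⟨ *-monoʳ-≤ (suc j ^ suc j * (j * y)) (am-gm ys) ⟩
  suc j ^ suc j * (j * y) * S ^ j
    -- The tangent at the mean S/j of the old numbers, evaluated at the mean (y + S)/(j + 1) of all
    -- numbers, both scaled by j (j + 1).
    ≤⟨ ≤-by _ _ 0 (tangent (suc j * S) (j * (y + S)) j) rearrange ⟩
  (j * (y + S)) ^ suc j
    ≡⟨ ^-distribʳ-* (suc j) j (y + S) ⟩
  j ^ suc j * (y + S) ^ suc j ∎)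
  where
  open ≤-Reasoning
  j = length ys
  P = product ys
  S = sum ys
  lemma₁ : ∀ j p q y P → j * p * (q * (y * P)) ≡ q * (j * y) * (p * P)
  lemma₁ = solve-∀
  lemma₂ : ∀ j y S a b B → suc j * a * (j * y) * b + (B + j * (suc j * S * (a * b))) + 0 ≡ B + suc j * (a * b * (j * (y + S)))
  lemma₂ = solve-∀
  rearrange : suc j ^ suc j * (j * y) * S ^ j + ((j * (y + S)) ^ suc j + j * (suc j * S) ^ suc j) + 0
    ≡ (j * (y + S)) ^ suc j + suc j * ((suc j * S) ^ j * (j * (y + S)))
  rearrange = trans (cong (λ z → suc j ^ suc j * (j * y) * S ^ j + ((j * (y + S)) ^ suc j + j * (suc j * S * z)) + 0) (^-distribʳ-* j (suc j) S))
    (trans (lemma₂ j y S (suc j ^ j) (S ^ j) ((j * (y + S)) ^ suc j))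
      (cong (λ z → (j * (y + S)) ^ suc j + suc j * (z * (j * (y + S)))) (sym (^-distribʳ-* j (suc j) S))))

-- Every value of `s` where `b` holds is at least the j-th root of K; comparison with the smallest
-- such value m keeps the argument within the natural numbers.
power-mean : {A : Set} (xs : List A) (b : A → Bool) (s : A → ℕ) (K j : ℕ) → 0 < ∑ xs (ind ∘ b) →
  (∀ x → x ∈ xs → b x ≡ true → K ≤ s x ^ j) →
  K * ∑ xs (ind ∘ b) ^ j ≤ ∑ xs (λ x → ind (b x) * s x) ^ j
power-mean xs b s K j pos h with smallest xs h
  where
  smallest : ∀ zs → (∀ x → x ∈ zs → b x ≡ true → K ≤ s x ^ j) →
    (∃ λ m → K ≤ m ^ j × (∀ x → x ∈ zs → b x ≡ true → m ≤ s x)) ⊎ (∀ x → x ∈ zs → b x ≡ false)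
  smallest []       h = inj₂ λ _ ()
  smallest (z ∷ zs) h with smallest zs (λ x p → h x (there p)) | b z in eq
  ... | inj₂ none           | false = inj₂ λ { x (here refl) → eq ; x (there p) → none x p }
  ... | inj₁ (m , K≤ , min) | false = inj₁ (m , K≤ , λ { x (here refl) t → ⊥-elim (true≢false t eq) ; x (there p) t → min x p t })
  ... | inj₂ none           | true  = inj₁ (s z , h z (here refl) eq , λ { x (here refl) t → ≤-refl ; x (there p) t → ⊥-elim (true≢false t (none x p)) })
  ... | inj₁ (m , K≤ , min) | true with ≤-total m (s z)
  ...   | inj₁ m≤ = inj₁ (m , K≤ , λ { x (here refl) t → m≤ ; x (there p) t → min x p t })
  ...   | inj₂ ≤m = inj₁ (s z , h z (here refl) eq , λ { x (here refl) t → ≤-refl ; x (there p) t → ≤-trans ≤m (min x p t) })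
... | inj₂ none with ∑-pos xs _ pos
...   | x , x∈ , p with () ← subst (λ c → 0 < ind c) (none x x∈) p
power-mean xs b s K j pos h | inj₁ (m , K≤ , min) = begin
  K * N ^ j            ≤⟨ *-monoˡ-≤ (N ^ j) K≤ ⟩
  m ^ j * N ^ j        ≡⟨ sym (^-distribʳ-* j m N) ⟩
  (m * N) ^ j          ≤⟨ ^-monoˡ-≤ j total ⟩
  ∑ xs (λ x → ind (b x) * s x) ^ j ∎
  where
  open ≤-Reasoning
  N = ∑ xs (ind ∘ b)
  total : m * N ≤ ∑ xs (λ x → ind (b x) * s x)
  total = ≤-trans (≤-reflexive (trans (*-comm m N) (sym (∑-*ʳ xs m (ind ∘ b))))) (∑-mono-∈ xs term)
    where
    term : ∀ x → x ∈ xs → ind (b x) * m ≤ ind (b x) * s x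
    term x x∈ with b x in eq
    ... | true  = *-monoʳ-≤ 1 (min x x∈ eq)
    ... | false = z≤n

-- Counting words by their branching numbers

∏₁ : ℕ → (ℕ → ℕ) → ℕ
∏₁ zero    c = 1
∏₁ (suc j) c = ∏₁ j c * c (suc j)

length-words : {A : Set} (as : List A) → ∀ j {e} → e ∈ words as j → length e ≡ j
length-words as zero    (here refl) = refl
length-words as (suc j) e∈ with Any.satisfied (∈-concatMap⁻ (λ x → map (x ∷_) (words as j)) {xs = as} e∈)
... | x , p with ∈-map⁻ (x ∷_) p
...   | e′ , e′∈ , refl = cong suc (length-words as j e′∈)

module Tree {A : Set} (as : List A) (complete : ∀ x → x ∈ as) (c : ℕ → ℕ) where

  #words : ℕ → (List A → Bool) → ℕ
  #words j b = ∑ (words as j) (ind ∘ b)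

  #words-suc : ∀ j b → #words (suc j) b ≡ ∑ as (λ x → #words j (λ e → b (x ∷ e)))
  #words-suc j b = ∑-words as j (ind ∘ b)

  -- L bounds the branching: after a prefix u at most L u letters can follow.
  Branching : ℕ → (List A → Bool) → (List A → ℕ) → Set
  Branching zero    b L = ⊤
  Branching (suc j) b L = ∑ as (λ x → ind ⌊ 0 <? #words j (λ e → b (x ∷ e)) ⌋) ≤ L []
    × (∀ x → Branching j (λ e → b (x ∷ e)) (λ e → L (x ∷ e)))

  -- Equivalently, the sum of c(i) L(u) over all words e satisfying b and all proper prefixes u of
  -- e, where i is the number of letters that follow u.
  weight : ℕ → (List A → Bool) → (List A → ℕ) → ℕ
  weight zero    b L = 0
  weight (suc j) b L = c (suc j) * (#words (suc j) b * L []) + ∑ as (λ x → weight j (λ e → b (x ∷ e)) (λ e → L (x ∷ e)))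

  #words-pos : ∀ j b e → length e ≡ j → b e ≡ true → 0 < #words j b
  #words-pos zero    b []      _  t = ≤-trans (≤-reflexive (cong ind (sym t))) (m≤m+n (ind (b [])) 0)
  #words-pos (suc j) b (x ∷ e) eq t = subst (0 <_) (sym (#words-suc j b))
    (≤-trans (#words-pos j (λ e → b (x ∷ e)) e (suc-injective eq) t) (∑-term (λ x → #words j (λ e → b (x ∷ e))) (complete x)))

  module _ (B Q : ℕ) (q : ℕ → ℕ) (q-inv : ∀ m → 0 < m → m ≤ B → m * q m ≡ Q) where

    -- The reciprocals (up to the factor Q) of the conditional probabilities of the
    -- letters of e; their product telescopes.
    factors : ℕ → (List A → Bool) → List A → List ℕ
    factors (suc j) b (x ∷ e) = c (suc j) * (#words (suc j) b * q (#words j (λ e → b (x ∷ e)))) ∷ factors j (λ e → b (x ∷ e)) e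
    factors _       _ _       = []

    #words-sub : ∀ j b x → #words (suc j) b ≤ B → #words j (λ e → b (x ∷ e)) ≤ B
    #words-sub j b x ≤B = ≤-trans (∑-term (λ x → #words j (λ e → b (x ∷ e))) (complete x)) (≤-trans (≤-reflexive (sym (#words-suc j b))) ≤B)

    length-factors : ∀ j b e → length e ≡ j → length (factors j b e) ≡ j
    length-factors zero    b []      _  = refl
    length-factors (suc j) b (x ∷ e) eq = cong suc (length-factors j _ e (suc-injective eq))

    product-factors : ∀ j b e → length e ≡ j → b e ≡ true → #words j b ≤ B →
      product (factors j b e) ≡ ∏₁ j c * (#words j b * Q ^ j)
    product-factors zero    b []      _  t ≤B = sym (trans (cong (λ z → 1 * ((ind z + 0) * 1)) t) refl)
    product-factors (suc j) b (x ∷ e) eq t ≤B = begin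
      C * (D * q D′) * product (factors j b′ e)
        ≡⟨ cong (C * (D * q D′) *_) (product-factors j b′ e (suc-injective eq) t (#words-sub j b x ≤B)) ⟩
      C * (D * q D′) * (∏₁ j c * (D′ * Q ^ j))
        ≡⟨ lemma C D (q D′) (∏₁ j c) D′ (Q ^ j) ⟩
      ∏₁ j c * C * (D * (D′ * q D′ * Q ^ j))
        ≡⟨ cong (λ z → ∏₁ j c * C * (D * (z * Q ^ j))) (q-inv D′ (#words-pos j b′ e (suc-injective eq) t) (#words-sub j b x ≤B)) ⟩
      ∏₁ j c * C * (D * (Q * Q ^ j)) ∎
      where
      open ≡-Reasoning
      b′ = λ e → b (x ∷ e)
      C = c (suc j)
      D = #words (suc j) b
      D′ = #words j b′
      lemma : ∀ C D q p D′ Q → C * (D * q) * (p * (D′ * Q)) ≡ p * C * (D * (D′ * q * Q))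
      lemma = solve-∀

    -- For a random letter, the mean of the reciprocal of its probability is the number of letters
    -- that can occur, which is at most the value of L at the prefix.
    sum-factors : ∀ j b L → Branching j b L → #words j b ≤ B →
      ∑ (words as j) (λ e → ind (b e) * sum (factors j b e)) ≤ Q * weight j b L
    sum-factors zero    b L _ _ = ≤-reflexive (trans (+-identityʳ (ind (b []) * 0)) (trans (*-zeroʳ (ind (b []))) (sym (*-zeroʳ Q))))
    sum-factors (suc j) b L (branch , br) ≤B = begin
      ∑ (words as (suc j)) (λ e → ind (b e) * sum (factors (suc j) b e))
        ≡⟨ ∑-words as j _ ⟩
      ∑ as (λ x → ∑ (words as j) (λ e → ind (b (x ∷ e)) * (Y x + sum (factors j (b′ x) e))))
        ≤⟨ ∑-mono as child ⟩
      ∑ as (λ x → C * D * Q * ind ⌊ 0 <? D′ x ⌋ + Q * weight j (b′ x) (λ e → L (x ∷ e)))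
        ≡⟨ ∑-+ as _ _ ⟩
      ∑ as (λ x → C * D * Q * ind ⌊ 0 <? D′ x ⌋) + ∑ as (λ x → Q * weight j (b′ x) (λ e → L (x ∷ e)))
        ≡⟨ cong₂ _+_ (∑-*ˡ as (C * D * Q) _) (∑-*ˡ as Q _) ⟩
      C * D * Q * ∑ as (λ x → ind ⌊ 0 <? D′ x ⌋) + Q * ∑ as (λ x → weight j (b′ x) (λ e → L (x ∷ e)))
        ≤⟨ +-monoˡ-≤ _ (*-monoʳ-≤ (C * D * Q) branch) ⟩
      C * D * Q * L [] + Q * ∑ as (λ x → weight j (b′ x) (λ e → L (x ∷ e)))
        ≡⟨ lemma C D Q (L []) _ ⟩
      Q * weight (suc j) b L ∎
      where
      open ≤-Reasoning
      C = c (suc j)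
      D = #words (suc j) b
      b′ : A → List A → Bool
      b′ x e = b (x ∷ e)
      D′ : A → ℕ
      D′ x = #words j (b′ x)
      Y : A → ℕ
      Y x = C * (D * q (D′ x))
      lemma : ∀ C D Q l w → C * D * Q * l + Q * w ≡ Q * (C * (D * l) + w)
      lemma = solve-∀
      cancel : ∀ x → Y x * D′ x ≤ C * D * Q * ind ⌊ 0 <? D′ x ⌋
      cancel x with 0 <? D′ x
      ... | yes pos = ≤-reflexive (trans (assoc C D (q (D′ x)) (D′ x)) (trans (cong (C * D *_) (q-inv (D′ x) pos (#words-sub j b x ≤B))) (sym (*-identityʳ _))))
        where
        assoc : ∀ C D q D′ → C * (D * q) * D′ ≡ C * D * (D′ * q)
        assoc = solve-∀
      ... | no ¬pos = ≤-trans (≤-reflexive (trans (cong (Y x *_) (n≤0⇒n≡0 (≮⇒≥ ¬pos))) (*-zeroʳ (Y x)))) z≤n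
      child : ∀ x → ∑ (words as j) (λ e → ind (b (x ∷ e)) * (Y x + sum (factors j (b′ x) e)))
        ≤ C * D * Q * ind ⌊ 0 <? D′ x ⌋ + Q * weight j (b′ x) (λ e → L (x ∷ e))
      child x = begin
        ∑ (words as j) (λ e → ind (b′ x e) * (Y x + sum (factors j (b′ x) e)))
          ≡⟨ ∑-cong (words as j) (λ e → trans (*-distribˡ-+ (ind (b′ x e)) (Y x) _) (cong (_+ ind (b′ x e) * sum (factors j (b′ x) e)) (*-comm (ind (b′ x e)) (Y x)))) ⟩
        ∑ (words as j) (λ e → Y x * ind (b′ x e) + ind (b′ x e) * sum (factors j (b′ x) e))
          ≡⟨ ∑-+ (words as j) _ _ ⟩
        ∑ (words as j) (λ e → Y x * ind (b′ x e)) + ∑ (words as j) (λ e → ind (b′ x e) * sum (factors j (b′ x) e))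
          ≤⟨ +-mono-≤ (≤-trans (≤-reflexive (∑-*ˡ (words as j) (Y x) (ind ∘ b′ x))) (cancel x)) (sum-factors j (b′ x) (λ e → L (x ∷ e)) (br x) (#words-sub j b x ≤B)) ⟩
        C * D * Q * ind ⌊ 0 <? D′ x ⌋ + Q * weight j (b′ x) (λ e → L (x ∷ e)) ∎

  -- The inequality of means is applied to the factors of each single word. Their product is the
  -- same for all words, so averaging over the words involves only the sums of the factors.
  #words-≤ : ∀ j b L → Branching j b L →
    j ^ j * ∏₁ j c * #words j b ^ suc j ≤ weight j b L ^ j
  #words-≤ j b L br with #words j b in eq
  ... | zero  = ≤-trans (≤-reflexive (*-zeroʳ (j ^ j * ∏₁ j c))) z≤n
  ... | suc m = *-cancelʳ-≤ _ _ (Q ^ j) {{m^n≢0 Q j {{suc m !≢0}}}} (begin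
    j ^ j * ∏₁ j c * suc m ^ suc j * Q ^ j
      ≡⟨ lemma (j ^ j) (∏₁ j c) (suc m) (suc m ^ j) (Q ^ j) ⟩
    j ^ j * (∏₁ j c * (suc m * Q ^ j)) * suc m ^ j
      ≡⟨ cong (λ z → j ^ j * (∏₁ j c * (z * Q ^ j)) * z ^ j) (sym eq) ⟩
    j ^ j * (∏₁ j c * (#words j b * Q ^ j)) * #words j b ^ j
      ≤⟨ power-mean (words as j) b (λ e → sum (factors (suc m) Q q q-inv j b e)) (j ^ j * (∏₁ j c * (#words j b * Q ^ j))) j (subst (0 <_) (sym eq) (s≤s z≤n)) pointwise ⟩
    ∑ (words as j) (λ e → ind (b e) * sum (factors (suc m) Q q q-inv j b e)) ^ j
      ≤⟨ ^-monoˡ-≤ j (sum-factors (suc m) Q q q-inv j b L br ≤B) ⟩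
    (Q * weight j b L) ^ j
      ≡⟨ trans (^-distribʳ-* j Q (weight j b L)) (*-comm (Q ^ j) _) ⟩
    weight j b L ^ j * Q ^ j ∎)
    where
    open ≤-Reasoning
    -- A common multiple of all possible counts, so that the reciprocals Q / i are integers. The
    -- value q 0 belongs to branches without words.
    Q = suc m !
    q : ℕ → ℕ
    q zero    = 0
    q (suc i) = Q / suc i
    q-inv : ∀ i → 0 < i → i ≤ suc m → i * q i ≡ Q
    q-inv (suc i) _ i≤m = m*[n/m]≡n (∣-trans (m∣m*n (i !)) (m≤n⇒m!∣n! i≤m))
    ≤B : #words j b ≤ suc m
    ≤B = ≤-reflexive eq
    lemma : ∀ a p d e Q → a * p * (d * e) * Q ≡ a * (p * (d * Q)) * e
    lemma = solve-∀
    pointwise : ∀ e → e ∈ words as j → b e ≡ true →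
      j ^ j * (∏₁ j c * (#words j b * Q ^ j)) ≤ sum (factors (suc m) Q q q-inv j b e) ^ j
    pointwise e e∈ t = subst₂ (λ i p → i ^ i * p ≤ sum (factors (suc m) Q q q-inv j b e) ^ i)
      (length-factors (suc m) Q q q-inv j b e (length-words as j e∈))
      (product-factors (suc m) Q q q-inv j b e (length-words as j e∈) t ≤B)
      (am-gm (factors (suc m) Q q q-inv j b e))

-- Embedding tents

-- Positions are natural numbers, so that in a concatenation they are shifted by plain addition.
data At {A : Set} : List A → ℕ → A → Set where
  here  : ∀ {v l} → At (v ∷ l) 0 v
  there : ∀ {v w l x} → At l x v → At (w ∷ l) (suc x) v

module _ {A : Set} where

  at-lookup : ∀ (l : List A) i → At l (toℕ i) (List.lookup l i)
  at-lookup (v ∷ l) zero    = here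
  at-lookup (v ∷ l) (suc i) = there (at-lookup l i)

  at-< : ∀ {l : List A} {x v} → At l x v → x < length l
  at-< here      = s≤s z≤n
  at-< (there p) = s≤s (at-< p)

  at-∈ : ∀ {l : List A} {x v} → At l x v → v ∈ l
  at-∈ here      = here refl
  at-∈ (there p) = there (at-∈ p)

  ∈-at : ∀ {l : List A} {v} → v ∈ l → ∃ λ x → At l x v
  ∈-at (here refl) = 0 , here
  ∈-at (there p)   with ∈-at p
  ... | x , q = suc x , there q

  at-++ˡ : ∀ {l m : List A} {x v} → At l x v → At (l ++ m) x v
  at-++ˡ here      = here
  at-++ˡ (there p) = there (at-++ˡ p)

  at-++ʳ : ∀ (l : List A) {m x v} → At m x v → At (l ++ m) (length l + x) v
  at-++ʳ []      p = p
  at-++ʳ (_ ∷ l) p = there (at-++ʳ l p)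

  at-++⁻ : ∀ (l : List A) {m x v} → At (l ++ m) x v → At l x v ⊎ ∃ λ y → x ≡ length l + y × At m y v
  at-++⁻ []      p     = inj₂ (_ , refl , p)
  at-++⁻ (_ ∷ l) here  = inj₁ here
  at-++⁻ (_ ∷ l) (there p) with at-++⁻ l p
  ... | inj₁ q            = inj₁ (there q)
  ... | inj₂ (y , eq , q) = inj₂ (y , cong suc eq , q)

  at-functional : ∀ {l : List A} {x v w} → At l x v → At l x w → v ≡ w
  at-functional here      here      = refl
  at-functional (there p) (there q) = at-functional p q

  at-injective : ∀ {l : List A} {x y v} → Unique l → At l x v → At l y v → x ≡ y
  at-injective _         here      here      = refl
  at-injective (v∉ ∷ _)  here      (there q) = contradiction refl (All.lookup v∉ (at-∈ q))
  at-injective (v∉ ∷ _)  (there p) here      = contradiction refl (All.lookup v∉ (at-∈ p))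
  at-injective (_ ∷ un)  (there p) (there q) = cong suc (at-injective un p q)

image⁺ : ∀ {m n} (f : Fin m → Fin n) (e : Subset m) i → i ∈ˢ e → f i ∈ˢ image f e
image⁺ f e i i∈ = true⇒∈ (trans (lookup∘tabulate _ (f i))
  (true-⌊⌋ (Finₚ.any? (λ k → (f k ≟ᶠ f i) ×-dec (lookup e k ≟ᵇ true))) (i , refl , ∈⇒true i∈)))

image⁻ : ∀ {m n} (f : Fin m → Fin n) (e : Subset m) {v} → v ∈ˢ image f e → ∃ λ i → f i ≡ v × i ∈ˢ e
image⁻ f e {v} v∈ with ⌊⌋-true (Finₚ.any? (λ k → (f k ≟ᶠ v) ×-dec (lookup e k ≟ᵇ true))) (trans (sym (lookup∘tabulate _ v)) (∈⇒true v∈))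
... | i , eq , t = i , eq , true⇒∈ t

-- Tent edges are tabulated from conditions R on positions. For an embedding listed by l, their
-- images are found by matching positions with the entries there.
image-tabulate : ∀ {m n} (l : List (Fin n)) (eq : m ≡ length l) (R : ℕ → Bool) (T : List (Fin n)) →
  (∀ {x v} → At l x v → R x ≡ true → v ∈ T) →
  (∀ {v} → v ∈ T → ∃ λ x → At l x v × R x ≡ true) →
  image (λ i → List.lookup l (subst Fin eq i)) (tabulate (λ i → R (toℕ i))) ≡ toSet T
image-tabulate l refl R T sound complete = ⊆-antisym fwd bwd
  where
  e = tabulate (λ i → R (toℕ i))
  fwd : image (List.lookup l) e ⊆ˢ toSet T
  fwd v∈ with image⁻ (List.lookup l) e v∈
  ... | i , refl , i∈ = ∈-toSet⁺ (sound (at-lookup l i) (trans (sym (lookup∘tabulate _ i)) (∈⇒true i∈)))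
  bwd : toSet T ⊆ˢ image (List.lookup l) e
  bwd v∈ with complete (∈-toSet⁻ {l = T} v∈)
  ... | x , at , t = subst (_∈ˢ image (List.lookup l) e)
    (at-functional (at-lookup l i) (subst (λ y → At l y _) (sym ix) at))
    (image⁺ (List.lookup l) e i (true⇒∈ (trans (lookup∘tabulate _ i) (trans (cong R ix) t))))
    where
    i = fromℕ< (at-< at)
    ix : toℕ i ≡ x
    ix = Finₚ.toℕ-fromℕ< (at-< at)

≤ᵇ-true : ∀ {a b} → (a ≤ᵇ b) ≡ true → a ≤ b
≤ᵇ-true {a} {b} = ⌊⌋-true (a ≤? b)

inRange⁻ : ∀ {a b v} → inRange a b v ≡ true → a ≤ v × v ≤ b
inRange⁻ {a} {b} {v} t = ≤ᵇ-true (proj₁ (∧-true {a ≤ᵇ v} t)) , ≤ᵇ-true (proj₂ (∧-true {a ≤ᵇ v} t))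

inRange⁺ : ∀ {a b v} → a ≤ v → v ≤ b → inRange a b v ≡ true
inRange⁺ {a} {b} {v} p q = ∧-intro (true-⌊⌋ (a ≤? v) p) (true-⌊⌋ (v ≤? b) q)

tent⁻ : ∀ r i e → tent r i e ≡ true → e ≡ tentEdge1 r i ⊎ e ≡ tentEdge2 r i ⊎ e ≡ tentEdge3 r i
tent⁻ r i e t = [ inj₁ ∘ ⌊⌋-true d₁ , inj₂ ∘ [ inj₁ ∘ ⌊⌋-true d₂ , inj₂ ∘ ⌊⌋-true d₃ ] ∘ ∨-true {⌊ d₂ ⌋} ] (∨-true {⌊ d₁ ⌋} t)
  where
  d₁ = ≡-dec _≟ᵇ_ e (tentEdge1 r i)
  d₂ = ≡-dec _≟ᵇ_ e (tentEdge2 r i)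
  d₃ = ≡-dec _≟ᵇ_ e (tentEdge3 r i)

-- The concatenation of A, B, P, Q and y lists the images of the vertices 1, ..., 2r - 1. With i =
-- |A| the edges of the tent become A ∪ B, A ∪ P ∪ y and B ∪ Q ∪ y, so y is the apex, and the
-- lengths q = i - 1 and p = r - i - 1 fix the boundaries of the blocks.
module Embed {n} (A B P Q : List (Fin n)) (y : Fin n) (p q : ℕ)
  (∣A∣ : length A ≡ suc q) (∣B∣ : length B ≡ suc p) (∣P∣ : length P ≡ p) (∣Q∣ : length Q ≡ q) where

  private
    i = suc q
    r = suc q + suc p
    l = A ++ B ++ P ++ Q ++ y ∷ []

  data Block (x : ℕ) (v : Fin n) : Set where
    inA : x < i → v ∈ A → Block x v
    inB : i ≤ x → x < r → v ∈ B → Block x v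
    inP : r ≤ x → x < r + p → v ∈ P → Block x v
    inQ : r + p ≤ x → x < r + p + q → v ∈ Q → Block x v
    iny : x ≡ r + p + q → v ≡ y → Block x v

  split : ∀ {k} (M : List (Fin n)) {N x v} → length M ≡ k → At (M ++ N) x v → (At M x v × x < k) ⊎ ∃ λ z → x ≡ k + z × At N z v
  split M refl at with at-++⁻ M at
  ... | inj₁ α = inj₁ (α , at-< α)
  ... | inj₂ β = inj₂ β

  block : ∀ {x v} → At l x v → Block x v
  block {v = v} at with split A ∣A∣ at
  ... | inj₁ (α , x<) = inA x< (at-∈ α)
  ... | inj₂ (x₁ , refl , at₁) with split B ∣B∣ at₁
  ...   | inj₁ (β , x<) = inB (m≤m+n i x₁) (+-monoʳ-< i x<) (at-∈ β)
  ...   | inj₂ (x₂ , refl , at₂) = subst (λ x → Block x v) (+-assoc i (suc p) x₂) (later at₂)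
    where
    later : ∀ {x₂ v} → At (P ++ Q ++ y ∷ []) x₂ v → Block (r + x₂) v
    later {x₂} {v} at₂ with split P ∣P∣ at₂
    ... | inj₁ (π , x<) = inP (m≤m+n r x₂) (+-monoʳ-< r x<) (at-∈ π)
    ... | inj₂ (x₃ , refl , at₃) with split Q ∣Q∣ at₃
    ...   | inj₁ (κ , x<) = subst (λ x → Block x v) (+-assoc r p x₃) (inQ (m≤m+n (r + p) x₃) (+-monoʳ-< (r + p) x<) (at-∈ κ))
    ...   | inj₂ (.0 , refl , here) = iny (trans (sym (+-assoc r p (q + 0))) (cong (λ z → r + p + z) (+-identityʳ q))) refl

  locateA : ∀ {v} → v ∈ A → ∃ λ x → At l x v × x < i
  locateA v∈ with ∈-at v∈
  ... | x , at = x , at-++ˡ at , subst (x <_) ∣A∣ (at-< at)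

  locateB : ∀ {v} → v ∈ B → ∃ λ x → At l x v × i ≤ x × x < r
  locateB {v} v∈ with ∈-at v∈
  ... | x , at = i + x , subst (λ a → At l (a + x) v) ∣A∣ (at-++ʳ A (at-++ˡ at)) , m≤m+n i x , +-monoʳ-< i (subst (x <_) ∣B∣ (at-< at))

  shiftAB : ∀ {x v} → At (P ++ Q ++ y ∷ []) x v → At l (r + x) v
  shiftAB {x} {v} at = subst (λ a → At l a v) (trans (cong₂ (λ a b → a + (b + x)) ∣A∣ ∣B∣) (sym (+-assoc i (suc p) x))) (at-++ʳ A (at-++ʳ B at))

  locateP : ∀ {v} → v ∈ P → ∃ λ x → At l x v × r ≤ x × x < r + p
  locateP v∈ with ∈-at v∈
  ... | x , at = r + x , shiftAB (at-++ˡ at) , m≤m+n r x , +-monoʳ-< r (subst (x <_) ∣P∣ (at-< at))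

  shiftABP : ∀ {x v} → At (Q ++ y ∷ []) x v → At l (r + p + x) v
  shiftABP {x} {v} at = subst (λ a → At l a v) (trans (cong (λ z → r + (z + x)) ∣P∣) (sym (+-assoc r p x))) (shiftAB (at-++ʳ P at))

  locateQ : ∀ {v} → v ∈ Q → ∃ λ x → At l x v × r + p ≤ x × x < r + p + q
  locateQ v∈ with ∈-at v∈
  ... | x , at = r + p + x , shiftABP (at-++ˡ at) , m≤m+n (r + p) x , +-monoʳ-< (r + p) (subst (x <_) ∣Q∣ (at-< at))

  locatey : At l (r + p + q) y
  locatey = subst (λ a → At l (r + p + a) y) (trans (+-identityʳ (length Q)) ∣Q∣) (shiftABP (at-++ʳ Q here))

  ∣l∣ : r + r ∸ 1 ≡ length l
  ∣l∣ = sym (begin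
    length l
      ≡⟨ trans (Listₚ.length-++ A) (cong₂ _+_ ∣A∣ (trans (Listₚ.length-++ B) (cong₂ _+_ ∣B∣ (trans (Listₚ.length-++ P)
           (cong₂ _+_ ∣P∣ (trans (Listₚ.length-++ Q) (cong (_+ 1) ∣Q∣))))))) ⟩
    suc q + (suc p + (p + (q + 1)))
      ≡⟨ lemma q p ⟩
    q + suc p + (suc q + suc p) ∎)
    where
    open ≡-Reasoning
    lemma : ∀ q p → suc q + (suc p + (p + (q + 1))) ≡ q + suc p + (suc q + suc p)
    lemma = solve-∀

  f : Fin (r + r ∸ 1) → Fin n
  f j = List.lookup l (subst Fin ∣l∣ j)

  f-injective : Unique l → ∀ {j k} → f j ≡ f k → j ≡ k
  f-injective un {j} {k} eq = subst-injective ∣l∣ (Finₚ.toℕ-injective (at-injective un (at-lookup l (subst Fin ∣l∣ j))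
    (subst (At l (toℕ (subst Fin ∣l∣ k))) (sym eq) (at-lookup l (subst Fin ∣l∣ k)))))
    where
    subst-injective : ∀ {m m′} (e : m ≡ m′) {j k : Fin m} → subst Fin e j ≡ subst Fin e k → j ≡ k
    subst-injective refl h = h

  2r-i-1 : r + r ∸ i ∸ 1 ≡ r + p
  2r-i-1 = trans (cong (λ z → z ∸ i ∸ 1) (lemma q p)) (cong (_∸ 1) (m+n∸m≡n i (suc (r + p))))
    where
    lemma : ∀ q p → suc q + suc p + (suc q + suc p) ≡ suc q + suc (suc q + suc p + p)
    lemma = solve-∀

  2r-i : r + r ∸ i ≡ suc (r + p)
  2r-i = trans (cong (_∸ i) (lemma q p)) (m+n∸m≡n i (suc (r + p)))
    where
    lemma : ∀ q p → suc q + suc p + (suc q + suc p) ≡ suc q + suc (suc q + suc p + p)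
    lemma = solve-∀

  2r-1 : r + r ∸ 1 ≡ suc (r + p + q)
  2r-1 = lemma q p
    where
    lemma : ∀ q p → q + suc p + (suc q + suc p) ≡ suc (suc q + suc p + p + q)
    lemma = solve-∀

  image₁ : image f (tentEdge1 r i) ≡ toSet (A ++ B)
  image₁ = image-tabulate l ∣l∣ (λ x → inRange 1 r (suc x)) (A ++ B) sound complete
    where
    sound : ∀ {x v} → At l x v → inRange 1 r (suc x) ≡ true → v ∈ A ++ B
    sound at t with block at | proj₂ (inRange⁻ {1} {r} t)
    ... | inA _ v∈   | _ = ∈-++⁺ˡ v∈
    ... | inB _ _ v∈ | _ = ∈-++⁺ʳ A v∈
    ... | inP r≤ _ _ | <r = contradiction <r (<⇒≱ (s≤s r≤))
    ... | inQ r≤ _ _ | <r = contradiction <r (<⇒≱ (s≤s (≤-trans (m≤m+n r p) r≤)))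
    ... | iny refl _ | <r = contradiction <r (<⇒≱ (s≤s (≤-trans (m≤m+n r p) (m≤m+n (r + p) q))))
    complete : ∀ {v} → v ∈ A ++ B → ∃ λ x → At l x v × inRange 1 r (suc x) ≡ true
    complete v∈ with ∈-++⁻ A v∈
    ... | inj₁ α with locateA α
    ...   | x , at , x<i = x , at , inRange⁺ {1} {r} (s≤s z≤n) (≤-trans x<i (m≤m+n i (suc p)))
    complete v∈ | inj₂ β with locateB β
    ...   | x , at , _ , x<r = x , at , inRange⁺ {1} {r} (s≤s z≤n) x<r

  R₂ R₃ : ℕ → Bool
  R₂ x = inRange 1 i (suc x) ∨ inRange (r + 1) (r + r ∸ i ∸ 1) (suc x) ∨ inRange (r + r ∸ 1) (r + r ∸ 1) (suc x)
  R₃ x = inRange (i + 1) r (suc x) ∨ inRange (r + r ∸ i) (r + r ∸ 1) (suc x)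

  R₂⁻ : ∀ x → R₂ x ≡ true → x < i ⊎ (r ≤ x × x < r + p) ⊎ x ≡ r + p + q
  R₂⁻ x t with ∨-true {inRange 1 i (suc x)} t
  ... | inj₁ t₁ = inj₁ (proj₂ (inRange⁻ {1} {i} t₁))
  ... | inj₂ t₂ with ∨-true {inRange (r + 1) (r + r ∸ i ∸ 1) (suc x)} t₂
  ...   | inj₁ t₃ = inj₂ (inj₁ (≤-pred (subst (_≤ suc x) (+-comm r 1) (proj₁ (inRange⁻ {r + 1} {r + r ∸ i ∸ 1} t₃))) ,
                                subst (x <_) 2r-i-1 (proj₂ (inRange⁻ {r + 1} {r + r ∸ i ∸ 1} t₃))))
  ...   | inj₂ t₄ = inj₂ (inj₂ (suc-injective (trans (≤-antisym (proj₂ (inRange⁻ {r + r ∸ 1} {r + r ∸ 1} t₄)) (proj₁ (inRange⁻ {r + r ∸ 1} {r + r ∸ 1} t₄))) 2r-1)))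

  R₃⁻ : ∀ x → R₃ x ≡ true → (i ≤ x × x < r) ⊎ r + p ≤ x
  R₃⁻ x t with ∨-true {inRange (i + 1) r (suc x)} t
  ... | inj₁ t₁ = inj₁ (≤-pred (subst (_≤ suc x) (+-comm i 1) (proj₁ (inRange⁻ {i + 1} {r} t₁))) , proj₂ (inRange⁻ {i + 1} {r} t₁))
  ... | inj₂ t₂ = inj₂ (≤-pred (subst (_≤ suc x) 2r-i (proj₁ (inRange⁻ {r + r ∸ i} {r + r ∸ 1} t₂))))

  image₂ : image f (tentEdge2 r i) ≡ toSet (A ++ P ++ y ∷ [])
  image₂ = image-tabulate l ∣l∣ R₂ (A ++ P ++ y ∷ []) sound complete
    where
    sound : ∀ {x v} → At l x v → R₂ x ≡ true → v ∈ A ++ P ++ y ∷ []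
    sound {x} at t with block at | R₂⁻ x t
    ... | inA _ v∈     | _ = ∈-++⁺ˡ v∈
    ... | inP _ _ v∈   | _ = ∈-++⁺ʳ A (∈-++⁺ˡ v∈)
    ... | iny _ refl   | _ = ∈-++⁺ʳ A (∈-++⁺ʳ P (here refl))
    ... | inB i≤ _ _   | inj₁ <i = contradiction <i (≤⇒≯ i≤)
    ... | inB _ <r _   | inj₂ (inj₁ (r≤ , _)) = contradiction <r (≤⇒≯ r≤)
    ... | inB _ <r _   | inj₂ (inj₂ refl) = contradiction <r (≤⇒≯ (≤-trans (m≤m+n r p) (m≤m+n (r + p) q)))
    ... | inQ ≤x _ _   | inj₁ <i = contradiction (≤-trans <i (≤-trans (m≤m+n i (suc p)) (m≤m+n r p))) (≤⇒≯ ≤x)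
    ... | inQ ≤x _ _   | inj₂ (inj₁ (_ , x<)) = contradiction x< (≤⇒≯ ≤x)
    ... | inQ _ x< _   | inj₂ (inj₂ refl) = contradiction x< (<-irrefl refl)
    complete : ∀ {v} → v ∈ A ++ P ++ y ∷ [] → ∃ λ x → At l x v × R₂ x ≡ true
    complete v∈ with ∈-++⁻ A v∈
    ... | inj₁ α with locateA α
    ...   | x , at , x<i = x , at , ∨-introˡ _ (inRange⁺ {1} {i} (s≤s z≤n) x<i)
    complete v∈ | inj₂ v∈′ with ∈-++⁻ P v∈′
    ... | inj₁ π with locateP π
    ...   | x , at , r≤x , x< = x , at , ∨-introʳ (inRange 1 i (suc x)) (∨-introˡ _
      (inRange⁺ {r + 1} {r + r ∸ i ∸ 1} (subst (_≤ suc x) (+-comm 1 r) (s≤s r≤x)) (subst (x <_) (sym 2r-i-1) x<)))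
    complete v∈ | inj₂ v∈′ | inj₂ (here refl) = r + p + q , locatey ,
      ∨-introʳ (inRange 1 i (suc (r + p + q))) (∨-introʳ (inRange (r + 1) (r + r ∸ i ∸ 1) (suc (r + p + q)))
        (inRange⁺ {r + r ∸ 1} {r + r ∸ 1} (≤-reflexive 2r-1) (≤-reflexive (sym 2r-1))))

  image₃ : image f (tentEdge3 r i) ≡ toSet (B ++ Q ++ y ∷ [])
  image₃ = image-tabulate l ∣l∣ R₃ (B ++ Q ++ y ∷ []) sound complete
    where
    sound : ∀ {x v} → At l x v → R₃ x ≡ true → v ∈ B ++ Q ++ y ∷ []
    sound {x} at t with block at | R₃⁻ x t
    ... | inB _ _ v∈   | _ = ∈-++⁺ˡ v∈
    ... | inQ _ _ v∈   | _ = ∈-++⁺ʳ B (∈-++⁺ˡ v∈)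
    ... | iny _ refl   | _ = ∈-++⁺ʳ B (∈-++⁺ʳ Q (here refl))
    ... | inA <i _     | inj₁ (i≤ , _) = contradiction <i (≤⇒≯ i≤)
    ... | inA <i _     | inj₂ ≤x = contradiction (≤-trans <i (≤-trans (m≤m+n i (suc p)) (m≤m+n r p))) (≤⇒≯ ≤x)
    ... | inP r≤ _ _   | inj₁ (_ , <r) = contradiction <r (≤⇒≯ r≤)
    ... | inP _ x< _   | inj₂ ≤x = contradiction x< (≤⇒≯ ≤x)
    complete : ∀ {v} → v ∈ B ++ Q ++ y ∷ [] → ∃ λ x → At l x v × R₃ x ≡ true
    complete v∈ with ∈-++⁻ B v∈
    ... | inj₁ β with locateB β
    ...   | x , at , i≤x , x<r = x , at , ∨-introˡ _ (inRange⁺ {i + 1} {r} (subst (_≤ suc x) (+-comm 1 i) (s≤s i≤x)) x<r)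
    complete v∈ | inj₂ v∈′ with ∈-++⁻ Q v∈′
    ... | inj₁ κ with locateQ κ
    ...   | x , at , ≤x , x< = x , at , ∨-introʳ (inRange (i + 1) r (suc x))
      (inRange⁺ {r + r ∸ i} {r + r ∸ 1} (subst (_≤ suc x) (sym 2r-i) (s≤s ≤x)) (subst (suc x ≤_) (sym 2r-1) (m≤n⇒m≤1+n x<)))
    complete v∈ | inj₂ v∈′ | inj₂ (here refl) = r + p + q , locatey , ∨-introʳ (inRange (i + 1) r (suc (r + p + q)))
      (inRange⁺ {r + r ∸ i} {r + r ∸ 1} (subst (_≤ suc (r + p + q)) (sym 2r-i) (s≤s (m≤m+n (r + p) q))) (≤-reflexive (sym 2r-1)))

  contains : ∀ (G : Subset n → Bool) → Unique l → G (toSet (A ++ B)) ≡ true → G (toSet (A ++ P ++ y ∷ [])) ≡ true →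
    G (toSet (B ++ Q ++ y ∷ [])) ≡ true → Contains (tent r i) G
  contains G un g₁ g₂ g₃ = f , f-injective un , edges
    where
    edges : ∀ e → tent r i e ≡ true → G (image f e) ≡ true
    edges e t = [ (λ eq → transfer eq image₁ g₁) , [ (λ eq → transfer eq image₂ g₂) , (λ eq → transfer eq image₃ g₃) ] ] (tent⁻ r i e t)
      where
      transfer : ∀ {E T} → e ≡ E → image f E ≡ T → G T ≡ true → G (image f e) ≡ true
      transfer refl refl g = g

-- Robust subsets

extend : ∀ {n} (S : Subset n) (l : List (Fin n)) → Unique l → (∀ {x} → x ∈ l → x ∈ˢ S) →
  ∃ λ P → Unique (l ++ P) × toSet (l ++ P) ≡ S × ∣ S ∣ ≡ length l + length P
extend S l un l⊆S = P , un′ , eq , trans (cong ∣_∣ (sym eq)) (trans (∣toSet∣-unique un′) (Listₚ.length-++ l))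
  where
  P? = λ x → ¬? (x ∈? toSet l)
  P = filter P? (elems S)
  P⁻ : ∀ {x} → x ∈ P → x ∈ˢ S × x ∉ l
  P⁻ x∈ with ∈-filter⁻ P? {xs = elems S} x∈
  ... | p , x∉ = ∈-elems⁻ p , λ q → x∉ (∈-toSet⁺ q)
  un′ : Unique (l ++ P)
  un′ = Uniqueₚ.++⁺ un (Uniqueₚ.filter⁺ P? (elems-unique S)) (λ { (p , q) → proj₂ (P⁻ q) p })
  eq : toSet (l ++ P) ≡ S
  eq = ⊆-antisym fwd bwd
    where
    fwd : toSet (l ++ P) ⊆ˢ S
    fwd x∈ with ∈-++⁻ l (∈-toSet⁻ {l = l ++ P} x∈)
    ... | inj₁ p = l⊆S p
    ... | inj₂ p = proj₁ (P⁻ p)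
    bwd : S ⊆ˢ toSet (l ++ P)
    bwd {x} x∈ with x ∈? toSet l
    ... | yes p = ∈-toSet⁺ (∈-++⁺ˡ (∈-toSet⁻ {l = l} p))
    ... | no ¬p = ∈-toSet⁺ (∈-++⁺ʳ l (∈-filter⁺ P? (∈-elems⁺ x∈) ¬p))

count-size : ∀ n j → ∑ (subsets n) (λ T → ind ⌊ ∣ T ∣ ≟ j ⌋) ≤ n ^ j
count-size n j = count-⊇ ⊥ j (λ T → ⌊ ∣ T ∣ ≟ j ⌋)
  (λ T t → ⊥⊆ , trans (⌊⌋-true (∣ T ∣ ≟ j) t) (sym (cong (_+ j) (∣⊥∣≡0 n))))

module Robust {n} (r : ℕ) (G : Subset n → Bool) (uni : ∀ S → G S ≡ true → ∣ S ∣ ≡ r) (C : ℕ) where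

  codeg : Subset n → ℕ
  codeg T = ∑ (subsets n) (λ S → ind (G S ∧ ⌊ T ⊆? S ⌋))

  above-point : ∀ T x → x ∉ˢ T → ∑ (subsets n) (λ S → ind (G S ∧ ⌊ x ◃ T ⊆? S ⌋)) * n ≤ n ^ (r ∸ ∣ T ∣)
  above-point T x x∉T with ∣ T ∣ <? r
  ... | yes T<r = ≤-trans (*-monoˡ-≤ n (count-⊇ (x ◃ T) (r ∸ suc ∣ T ∣) _ above))
      (≤-reflexive (trans (*-comm (n ^ (r ∸ suc ∣ T ∣)) n) (cong (n ^_) (sym (+-∸-assoc 1 T<r)))))
    where
    above : ∀ S → G S ∧ ⌊ x ◃ T ⊆? S ⌋ ≡ true → x ◃ T ⊆ˢ S × ∣ S ∣ ≡ ∣ x ◃ T ∣ + (r ∸ suc ∣ T ∣)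
    above S t = ⌊⌋-true (x ◃ T ⊆? S) (proj₂ (∧-true {G S} t)) ,
      trans (uni S (proj₁ (∧-true {G S} t))) (sym (trans (cong (_+ (r ∸ suc ∣ T ∣)) (∣◃∣ x∉T)) (m+[n∸m]≡n T<r)))
  ... | no T≮r = ≤-trans (≤-reflexive (cong (_* n) (∑-zero (subsets n) none))) z≤n
    where
    none : ∀ S → ind (G S ∧ ⌊ x ◃ T ⊆? S ⌋) ≡ 0
    none S with G S ∧ ⌊ x ◃ T ⊆? S ⌋ in eq
    ... | false = refl
    ... | true = contradiction (≤-trans (≤-reflexive (sym (∣◃∣ x∉T))) (≤-trans (p⊆q⇒∣p∣≤∣q∣ (⌊⌋-true (x ◃ T ⊆? S) (proj₂ (∧-true {G S} eq))))
      (≤-reflexive (uni S (proj₁ (∧-true {G S} eq)))))) T≮r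

  abstract
    -- More than C n^(r-|T|-1) edges contain T; the factor n on both sides avoids a negative
    -- exponent when |T| = r.
    robust : Subset n → Bool
    robust T = ⌊ C * n ^ (r ∸ ∣ T ∣) <? codeg T * n ⌋

    fragile? : ∀ S → Dec (∃ λ T → T ⊆ˢ S × robust T ≡ false)
    fragile? S = anySubset? (λ T → (T ⊆? S) ×-dec (robust T ≟ᵇ false))

    core : Subset n → Bool
    core S = G S ∧ not ⌊ fragile? S ⌋

    core⇒G : ∀ {S} → core S ≡ true → G S ≡ true
    core⇒G {S} c = proj₁ (∧-true {G S} c)

    core-robust : ∀ {S T} → core S ≡ true → T ⊆ˢ S → robust T ≡ true
    core-robust {S} {T} c T⊆S with robust T in eq
    ... | true  = refl
    ... | false = ⊥-elim (true≢false (true-⌊⌋ (fragile? S) (T , T⊆S , eq)) (not-true (proj₂ (∧-true {G S} c))))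

    -- At most |W| n^(r-|T|-1) edges contain T together with a vertex of W outside T, fewer than the
    -- edges that contain T.
    avoiding : ∀ T W → robust T ≡ true → ∣ W ∣ ≤ C → ∃ λ S → G S ≡ true × T ⊆ˢ S × (∀ x → x ∈ˢ W → x ∈ˢ S → x ∈ˢ T)
    avoiding T W rob W≤C with anySubset? (λ S → (G S ≟ᵇ true) ×-dec ((T ⊆? S) ×-dec Finₚ.all? (λ x → (x ∈? W) →-dec ((x ∈? S) →-dec (x ∈? T)))))
    ... | yes found = found
    ... | no none = contradiction few (<⇒≱ (⌊⌋-true (C * n ^ (r ∸ ∣ T ∣) <? codeg T * n) rob))
      where
      open ≤-Reasoning
      hit : ∀ S → ind (G S ∧ ⌊ T ⊆? S ⌋) ≤ ∑ (allFin n) (λ x → ind (lookup W x) * (ind (not (lookup T x)) * ind (G S ∧ ⌊ x ◃ T ⊆? S ⌋)))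
      hit S with G S in g | T ⊆? S
      ... | false | _       = z≤n
      ... | true  | no _    = z≤n
      ... | true  | yes T⊆S with Finₚ.any? (λ x → (x ∈? W) ×-dec ((x ∈? S) ×-dec ¬? (x ∈? T)))
      ...   | yes (x , x∈W , x∈S , x∉T) = ≤-trans (≤-reflexive one) (∑-term (λ x → ind (lookup W x) * (ind (not (lookup T x)) * ind ⌊ x ◃ T ⊆? S ⌋)) (∈-allFin x))
        where
        one : 1 ≡ ind (lookup W x) * (ind (not (lookup T x)) * ind ⌊ x ◃ T ⊆? S ⌋)
        one rewrite ∈⇒true x∈W | ∉⇒false x∉T | true-⌊⌋ (x ◃ T ⊆? S) (◃-⊆ x∈S T⊆S) = refl
      ...   | no ¬hit = ⊥-elim (none (S , g , T⊆S , λ x x∈W x∈S → decidable-stable (x ∈? T) (λ x∉T → ¬hit (x , x∈W , x∈S , x∉T))))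
      point : ∀ x → ∑ (subsets n) (λ S → ind (not (lookup T x)) * ind (G S ∧ ⌊ x ◃ T ⊆? S ⌋)) * n ≤ n ^ (r ∸ ∣ T ∣)
      point x with x ∈? T
      ... | yes x∈ rewrite ∈⇒true x∈ = ≤-trans (≤-reflexive (cong (_* n) (∑-zero (subsets n) (λ _ → refl)))) z≤n
      ... | no x∉ rewrite ∉⇒false x∉ = ≤-trans (≤-reflexive (cong (_* n) (∑-cong (subsets n) (λ S → *-identityˡ _)))) (above-point T x x∉)
      few : codeg T * n ≤ C * n ^ (r ∸ ∣ T ∣)
      few = begin
        codeg T * n
          ≤⟨ *-monoˡ-≤ n (∑-mono (subsets n) hit) ⟩
        ∑ (subsets n) (λ S → ∑ (allFin n) (λ x → ind (lookup W x) * (ind (not (lookup T x)) * ind (G S ∧ ⌊ x ◃ T ⊆? S ⌋)))) * n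
          ≡⟨ cong (_* n) (∑-swap (subsets n) (allFin n) _) ⟩
        ∑ (allFin n) (λ x → ∑ (subsets n) (λ S → ind (lookup W x) * (ind (not (lookup T x)) * ind (G S ∧ ⌊ x ◃ T ⊆? S ⌋)))) * n
          ≡⟨ cong (_* n) (∑-cong (allFin n) (λ x → ∑-*ˡ (subsets n) (ind (lookup W x)) _)) ⟩
        ∑ (allFin n) (λ x → ind (lookup W x) * ∑ (subsets n) (λ S → ind (not (lookup T x)) * ind (G S ∧ ⌊ x ◃ T ⊆? S ⌋))) * n
          ≡⟨ sym (∑-*ʳ (allFin n) n _) ⟩
        ∑ (allFin n) (λ x → ind (lookup W x) * ∑ (subsets n) (λ S → ind (not (lookup T x)) * ind (G S ∧ ⌊ x ◃ T ⊆? S ⌋)) * n)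
          ≤⟨ ∑-mono (allFin n) (λ x → ≤-trans (≤-reflexive (*-assoc (ind (lookup W x)) _ n)) (*-monoʳ-≤ (ind (lookup W x)) (point x))) ⟩
        ∑ (allFin n) (λ x → ind (lookup W x) * n ^ (r ∸ ∣ T ∣))
          ≡⟨ trans (∑-*ʳ (allFin n) _ (ind ∘ lookup W)) (cong (_* n ^ (r ∸ ∣ T ∣)) (∣∣-sum W)) ⟩
        ∣ W ∣ * n ^ (r ∸ ∣ T ∣)
          ≤⟨ *-monoˡ-≤ (n ^ (r ∸ ∣ T ∣)) W≤C ⟩
        C * n ^ (r ∸ ∣ T ∣) ∎

    lost : Subset n → Bool
    lost S = G S ∧ ⌊ fragile? S ⌋

    lost⇒G : ∀ {S} → lost S ≡ true → G S ≡ true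
    lost⇒G {S} t = proj₁ (∧-true {G S} t)

    G-split : ∀ S → ind (G S) ≡ ind (core S) + ind (lost S)
    G-split S with G S | ⌊ fragile? S ⌋
    ... | false | _     = refl
    ... | true  | true  = refl
    ... | true  | false = refl

    -- A lost edge contains a set T that is not robust, and each such T accounts for at most C
    -- n^(r-|T|-1) edges. Each of the r + 1 possible sizes of T thus contributes at most C n^(r-1)
    -- lost edges.
    count-lost : ∑ (subsets n) (ind ∘ lost) * n ≤ C * (suc r * n ^ r)
    count-lost = begin
      ∑ (subsets n) (ind ∘ lost) * n
        ≤⟨ *-monoˡ-≤ n (∑-mono (subsets n) witness) ⟩
      ∑ (subsets n) (λ S → ∑ (subsets n) (λ T → bad T * ind (G S ∧ ⌊ T ⊆? S ⌋))) * n
        ≡⟨ cong (_* n) (trans (∑-swap (subsets n) (subsets n) _) (∑-cong (subsets n) (λ T → ∑-*ˡ (subsets n) (bad T) _))) ⟩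
      ∑ (subsets n) (λ T → bad T * codeg T) * n
        ≡⟨ trans (sym (∑-*ʳ (subsets n) n _)) (∑-cong (subsets n) (λ T → *-assoc (bad T) (codeg T) n)) ⟩
      ∑ (subsets n) (λ T → bad T * (codeg T * n))
        ≤⟨ ∑-mono (subsets n) bound ⟩
      ∑ (subsets n) (λ T → C * ∑ (upTo (suc r)) (λ t → ind ⌊ ∣ T ∣ ≟ t ⌋ * n ^ (r ∸ t)))
        ≡⟨ ∑-*ˡ (subsets n) C _ ⟩
      C * ∑ (subsets n) (λ T → ∑ (upTo (suc r)) (λ t → ind ⌊ ∣ T ∣ ≟ t ⌋ * n ^ (r ∸ t)))
        ≡⟨ cong (C *_) (∑-swap (subsets n) (upTo (suc r)) _) ⟩
      C * ∑ (upTo (suc r)) (λ t → ∑ (subsets n) (λ T → ind ⌊ ∣ T ∣ ≟ t ⌋ * n ^ (r ∸ t)))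
        ≤⟨ *-monoʳ-≤ C (∑-mono-∈ (upTo (suc r)) level) ⟩
      C * ∑ (upTo (suc r)) (λ _ → n ^ r)
        ≡⟨ cong (C *_) (trans (∑-const (upTo (suc r)) (n ^ r)) (cong (_* n ^ r) (Listₚ.length-upTo (suc r)))) ⟩
      C * (suc r * n ^ r) ∎
      where
      open ≤-Reasoning
      bad : Subset n → ℕ
      bad T = ind (not (robust T) ∧ ⌊ ∣ T ∣ ≤? r ⌋)
      witness : ∀ S → ind (lost S) ≤ ∑ (subsets n) (λ T → bad T * ind (G S ∧ ⌊ T ⊆? S ⌋))
      witness S with G S in g | fragile? S
      ... | false | _    = z≤n
      ... | true  | no _ = z≤n
      ... | true  | yes (T , T⊆S , f) = ≤-trans (≤-reflexive one) (∑-term (λ T → bad T * ind ⌊ T ⊆? S ⌋) (∈-subsets T))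
        where
        one : 1 ≡ bad T * ind ⌊ T ⊆? S ⌋
        one rewrite f | true-⌊⌋ (T ⊆? S) T⊆S | true-⌊⌋ (∣ T ∣ ≤? r) (≤-trans (p⊆q⇒∣p∣≤∣q∣ T⊆S) (≤-reflexive (uni S g))) = refl
      bound : ∀ T → bad T * (codeg T * n) ≤ C * ∑ (upTo (suc r)) (λ t → ind ⌊ ∣ T ∣ ≟ t ⌋ * n ^ (r ∸ t))
      bound T with robust T in f | ∣ T ∣ ≤? r
      ... | true  | _       = z≤n
      ... | false | no _    = z≤n
      ... | false | yes T≤r = ≤-trans (≤-reflexive (*-identityˡ _)) (≤-trans
        (≮⇒≥ (λ lt → true≢false (true-⌊⌋ (C * n ^ (r ∸ ∣ T ∣) <? codeg T * n) lt) f))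
        (*-monoʳ-≤ C (≤-trans (≤-reflexive one) (∑-term (λ t → ind ⌊ ∣ T ∣ ≟ t ⌋ * n ^ (r ∸ t)) (∈-upTo⁺ (s≤s T≤r))))))
        where
        one : n ^ (r ∸ ∣ T ∣) ≡ ind ⌊ ∣ T ∣ ≟ ∣ T ∣ ⌋ * n ^ (r ∸ ∣ T ∣)
        one rewrite true-⌊⌋ (∣ T ∣ ≟ ∣ T ∣) refl = sym (*-identityˡ _)
      level : ∀ t → t ∈ upTo (suc r) → ∑ (subsets n) (λ T → ind ⌊ ∣ T ∣ ≟ t ⌋ * n ^ (r ∸ t)) ≤ n ^ r
      level t t∈ = begin
        ∑ (subsets n) (λ T → ind ⌊ ∣ T ∣ ≟ t ⌋ * n ^ (r ∸ t))  ≡⟨ ∑-*ʳ (subsets n) (n ^ (r ∸ t)) _ ⟩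
        ∑ (subsets n) (λ T → ind ⌊ ∣ T ∣ ≟ t ⌋) * n ^ (r ∸ t)  ≤⟨ *-monoˡ-≤ (n ^ (r ∸ t)) (count-size n t) ⟩
        n ^ t * n ^ (r ∸ t)                                    ≡⟨ sym (^-distribˡ-+-* n t (r ∸ t)) ⟩
        n ^ (t + (r ∸ t))                                      ≡⟨ cong (n ^_) (m+[n∸m]≡n (≤-pred (∈-upTo⁻ t∈))) ⟩
        n ^ r                                                  ∎

  core-size : ∀ {S} → core S ≡ true → ∣ S ∣ ≡ r
  core-size {S} c = uni S (core⇒G c)

  -- Edges of the core have robust subsets, so a homomorphic image of a tent in the
  -- core is opened up to a genuine tent of G.
  no-core-tent : ∀ {k} → FFree r k G → r + r ≤ C → (A B : List (Fin n)) (w : Fin n) {S₂ S₃ : Subset n} →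
    Unique (A ++ B) → core (toSet (A ++ B)) ≡ true → 1 ≤ length A → length A ≤ k → 1 ≤ length B →
    w ∉ A ++ B → core S₂ ≡ true → w ∈ˢ S₂ → (∀ {x} → x ∈ A → x ∈ˢ S₂) →
    core S₃ ≡ true → w ∈ˢ S₃ → (∀ {x} → x ∈ B → x ∈ˢ S₃) → Empty
  no-core-tent {k} free 2r≤C A B w {S₂} {S₃} un c₁ A≥1 A≤k B≥1 w∉ c₂ w∈S₂ A⊆S₂ c₃ w∈S₃ B⊆S₃
    with length A in ∣A∣ | length B in ∣B∣
  ... | suc q | suc p
    with avoiding (toSet (w ∷ A)) (toSet (A ++ B)) (core-robust c₂ (λ x∈ → lower w∈S₂ A⊆S₂ (∈-toSet⁻ {l = w ∷ A} x∈))) ∣AB∣≤C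
    where
    lower : ∀ {l S} → w ∈ˢ S → (∀ {x} → x ∈ l → x ∈ˢ S) → ∀ {x} → x ∈ w ∷ l → x ∈ˢ S
    lower w∈ l⊆ (here refl) = w∈
    lower w∈ l⊆ (there p)   = l⊆ p
    ∣AB∣≤C : ∣ toSet (A ++ B) ∣ ≤ C
    ∣AB∣≤C = ≤-trans (≤-reflexive (core-size c₁)) (≤-trans (m≤m+n r r) 2r≤C)
  ... | E₂ , g₂ , wA⊆E₂ , avoid₂
    with extend E₂ (w ∷ A) (All.tabulate (λ x∈ w≡x → w∉ (subst (_∈ A ++ B) (sym w≡x) (∈-++⁺ˡ x∈))) ∷ unˡ A un) (λ x∈ → wA⊆E₂ (∈-toSet⁺ x∈))
    where
    unˡ : ∀ (A : List (Fin n)) {B} → Unique (A ++ B) → Unique A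
    unˡ []      _        = []
    unˡ (a ∷ A) (p ∷ un) = All.tabulate (λ x∈ → All.lookup p (∈-++⁺ˡ x∈)) ∷ unˡ A un
  ... | P , unP , eqP , ∣P∣
    -- `E₃` must also miss the part P of the edge `E₂` just chosen. The set to be avoided has at
    -- most |A ∪ B| + |P| ≤ 2r elements, which is the origin of the bound r + r ≤ C.
    with avoiding (toSet (w ∷ B)) (toSet ((A ++ B) ++ P)) (core-robust c₃ (λ x∈ → lower w∈S₃ B⊆S₃ (∈-toSet⁻ {l = w ∷ B} x∈))) ∣ABP∣≤C
    where
    lower : ∀ {l S} → w ∈ˢ S → (∀ {x} → x ∈ l → x ∈ˢ S) → ∀ {x} → x ∈ w ∷ l → x ∈ˢ S
    lower w∈ l⊆ (here refl) = w∈
    lower w∈ l⊆ (there p)   = l⊆ p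
    ∣ABP∣≤C : ∣ toSet ((A ++ B) ++ P) ∣ ≤ C
    ∣ABP∣≤C = ≤-trans (∣toSet∣≤ ((A ++ B) ++ P)) (≤-trans (≤-reflexive (Listₚ.length-++ (A ++ B))) (≤-trans (+-mono-≤
      (≤-reflexive (trans (sym (∣toSet∣-unique un)) (core-size c₁)))
      (≤-trans (m≤n+m (length P) (length (w ∷ A))) (≤-reflexive (trans (sym ∣P∣) (uni E₂ g₂))))) 2r≤C))
  ... | E₃ , g₃ , wB⊆E₃ , avoid₃
    with extend E₃ (w ∷ B) (All.tabulate (λ x∈ w≡x → w∉ (subst (_∈ A ++ B) (sym w≡x) (∈-++⁺ʳ A x∈))) ∷ unʳ A un) (λ x∈ → wB⊆E₃ (∈-toSet⁺ x∈))
    where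
    unʳ : ∀ (A : List (Fin n)) {B} → Unique (A ++ B) → Unique B
    unʳ []      un       = un
    unʳ (a ∷ A) (_ ∷ un) = unʳ A un
  ... | Q , unQ , eqQ , ∣Q∣ = free (suc q) (s≤s z≤n) A≤k (subst (λ m → Contains (tent m (suc q)) G) (sym r≡)
      (Embed.contains A B P Q w p q ∣A∣ ∣B∣ ∣P∣′ ∣Q∣′ G un-all (core⇒G c₁)
        (trans (cong G (trans (toSet-≡ (rotate A P) (rotate⁻ A P)) eqP)) g₂)
        (trans (cong G (trans (toSet-≡ (rotate B Q) (rotate⁻ B Q)) eqQ)) g₃)))
    where
    r≡ : r ≡ suc q + suc p
    r≡ = trans (sym (core-size c₁)) (trans (∣toSet∣-unique un) (trans (Listₚ.length-++ A) (cong₂ _+_ ∣A∣ ∣B∣)))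
    ∣P∣′ : length P ≡ p
    ∣P∣′ = +-cancelˡ-≡ (suc (suc q)) _ _ (trans (cong (λ z → suc z + length P) (sym ∣A∣)) (trans (sym ∣P∣) (trans (uni E₂ g₂) (trans r≡ (+-suc (suc q) p)))))
    ∣Q∣′ : length Q ≡ q
    ∣Q∣′ = +-cancelˡ-≡ (suc (suc p)) _ _ (trans (cong (λ z → suc z + length Q) (sym ∣B∣)) (trans (sym ∣Q∣) (trans (uni E₃ g₃) (trans r≡ (cong suc (+-comm q (suc p)))))))
    rotate : ∀ X Y {x} → x ∈ X ++ Y ++ w ∷ [] → x ∈ (w ∷ X) ++ Y
    rotate X Y x∈ with ∈-++⁻ X x∈
    ... | inj₁ a = there (∈-++⁺ˡ a)
    ... | inj₂ b with ∈-++⁻ Y b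
    ...   | inj₁ c = there (∈-++⁺ʳ X c)
    ...   | inj₂ (here refl) = here refl
    rotate⁻ : ∀ X Y {x} → x ∈ (w ∷ X) ++ Y → x ∈ X ++ Y ++ w ∷ []
    rotate⁻ X Y (here refl) = ∈-++⁺ʳ X (∈-++⁺ʳ Y (here refl))
    rotate⁻ X Y (there x∈) with ∈-++⁻ X x∈
    ... | inj₁ a = ∈-++⁺ˡ a
    ... | inj₂ b = ∈-++⁺ʳ X (∈-++⁺ˡ b)
    drop : ∀ (l : List (Fin n)) {P} → Unique (l ++ P) → Unique P × (∀ {x} → x ∈ l → x ∉ P)
    drop []      un = un , λ ()
    drop (a ∷ l) (a∉ ∷ un) = proj₁ (drop l un) , λ { (here refl) q → All.lookup a∉ (∈-++⁺ʳ l q) refl ; (there p) q → proj₂ (drop l un) p q }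
    P-out : ∀ {x} → x ∈ P → x ∉ A ++ B
    P-out {x} x∈P x∈AB = proj₂ (drop (w ∷ A) unP)
      (∈-toSet⁻ {l = w ∷ A} (avoid₂ x (∈-toSet⁺ x∈AB) (subst (x ∈ˢ_) eqP (∈-toSet⁺ (∈-++⁺ʳ (w ∷ A) x∈P))))) x∈P
    Q-out : ∀ {x} → x ∈ Q → x ∉ (A ++ B) ++ P
    Q-out {x} x∈Q x∈ABP = proj₂ (drop (w ∷ B) unQ)
      (∈-toSet⁻ {l = w ∷ B} (avoid₃ x (∈-toSet⁺ x∈ABP) (subst (x ∈ˢ_) eqQ (∈-toSet⁺ (∈-++⁺ʳ (w ∷ B) x∈Q))))) x∈Q
    un-Qw : Unique (Q ++ w ∷ [])
    un-Qw = Uniqueₚ.++⁺ (proj₁ (drop (w ∷ B) unQ)) ([] ∷ []) λ { (p , here refl) → proj₂ (drop (w ∷ B) unQ) (here refl) p }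
    un-PQw : Unique (P ++ Q ++ w ∷ [])
    un-PQw = Uniqueₚ.++⁺ (proj₁ (drop (w ∷ A) unP)) un-Qw λ { (p , q) → [ (λ q → Q-out q (∈-++⁺ʳ (A ++ B) p)) , (λ { (here refl) → proj₂ (drop (w ∷ A) unP) (here refl) p }) ] (∈-++⁻ Q q) }
    un-all : Unique (A ++ B ++ P ++ Q ++ w ∷ [])
    un-all = subst Unique (Listₚ.++-assoc A B (P ++ Q ++ w ∷ [])) (Uniqueₚ.++⁺ un un-PQw λ { (p , q) → [ (λ q → P-out q p) ,
      (λ q → [ (λ q → Q-out q (∈-++⁺ˡ p)) , (λ { (here refl) → w∉ p }) ] (∈-++⁻ Q q)) ] (∈-++⁻ P q) })

-- The density bound and its stability

∑-delta : ∀ {n} (x : Fin n) (f : Fin n → ℕ) → ∑ (allFin n) (λ v → ind ⌊ v ≟ᶠ x ⌋ * f v) ≡ f x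
∑-delta {n} x f = ≤-antisym upper (≤-trans (≤-reflexive (sym (at-x x refl))) (∑-term (λ v → ind ⌊ v ≟ᶠ x ⌋ * f v) (∈-allFin x)))
  where
  at-x : ∀ v → v ≡ x → ind ⌊ v ≟ᶠ x ⌋ * f v ≡ f x
  at-x v refl rewrite true-⌊⌋ (x ≟ᶠ x) refl = *-identityˡ (f x)
  upper : ∑ (allFin n) (λ v → ind ⌊ v ≟ᶠ x ⌋ * f v) ≤ f x
  upper = begin
    ∑ (allFin n) (λ v → ind ⌊ v ≟ᶠ x ⌋ * f v)   ≤⟨ ∑-mono (allFin n) swap ⟩
    ∑ (allFin n) (λ v → ind ⌊ v ≟ᶠ x ⌋ * f x)   ≡⟨ ∑-*ʳ (allFin n) (f x) _ ⟩
    ∑ (allFin n) (λ v → ind ⌊ v ≟ᶠ x ⌋) * f x   ≤⟨ *-monoˡ-≤ (f x) (∑-ind≤1 (Uniqueₚ.allFin⁺ n) (λ v → ⌊ v ≟ᶠ x ⌋)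
                                                     (λ v w _ _ p q → trans (⌊⌋-true (v ≟ᶠ x) p) (sym (⌊⌋-true (w ≟ᶠ x) q)))) ⟩
    1 * f x                                     ≡⟨ *-identityˡ (f x) ⟩
    f x                                         ∎
    where
    open ≤-Reasoning
    swap : ∀ v → ind ⌊ v ≟ᶠ x ⌋ * f v ≤ ind ⌊ v ≟ᶠ x ⌋ * f x
    swap v with v ≟ᶠ x
    ... | yes refl = ≤-refl
    ... | no _     = z≤n

∑-filter : {A : Set} {P : A → Set} (P? : ∀ x → Dec (P x)) (xs : List A) (f : A → ℕ) →
  ∑ (filter P? xs) f ≡ ∑ xs (λ x → ind ⌊ P? x ⌋ * f x)
∑-filter P? []       f = refl
∑-filter P? (x ∷ xs) f with P? x
... | yes _ = cong₂ _+_ (sym (*-identityˡ (f x))) (∑-filter P? xs f)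
... | no _  = ∑-filter P? xs f

∑-elems : ∀ {n} (S : Subset n) (f : Fin n → ℕ) → ∑ (elems S) f ≡ ∑ (allFin n) (λ v → ind (lookup S v) * f v)
∑-elems {n} S f = trans (∑-filter (λ x → lookup S x ≟ᵇ true) (allFin n) f) (∑-cong (allFin n) (λ v → cong (λ z → ind z * f v) (same (lookup S v))))
  where
  same : ∀ b → ⌊ b ≟ᵇ true ⌋ ≡ b
  same true  = refl
  same false = refl

∑-unique : ∀ {n} (l : List (Fin n)) (f : Fin n → ℕ) → Unique l → ∑ l f ≡ ∑ (allFin n) (λ v → ind (lookup (toSet l) v) * f v)
∑-unique {n} []      f _         = sym (∑-zero (allFin n) (λ v → cong (λ z → ind z * f v) (lookup-replicate v false)))
∑-unique {n} (x ∷ l) f (x∉ ∷ un) = begin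
  f x + ∑ l f
    ≡⟨ cong₂ _+_ (sym (∑-delta x f)) (∑-unique l f un) ⟩
  ∑ (allFin n) (λ v → ind ⌊ v ≟ᶠ x ⌋ * f v) + ∑ (allFin n) (λ v → ind (lookup (toSet l) v) * f v)
    ≡⟨ sym (∑-+ (allFin n) _ _) ⟩
  ∑ (allFin n) (λ v → ind ⌊ v ≟ᶠ x ⌋ * f v + ind (lookup (toSet l) v) * f v)
    ≡⟨ ∑-cong (allFin n) merge ⟩
  ∑ (allFin n) (λ v → ind (lookup (x ◃ toSet l) v) * f v) ∎
  where
  open ≡-Reasoning
  x∉l : x ∉ˢ toSet l
  x∉l p = All.lookup x∉ (∈-toSet⁻ {l = l} p) refl
  merge : ∀ v → ind ⌊ v ≟ᶠ x ⌋ * f v + ind (lookup (toSet l) v) * f v ≡ ind (lookup (x ◃ toSet l) v) * f v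
  merge v with v ≟ᶠ x
  ... | yes refl rewrite ∈⇒true (∈-◃-here x (toSet l)) | ∉⇒false x∉l = +-identityʳ _
  ... | no v≢x = cong (λ z → ind z * f v) (sym (lookup∘update′ v≢x (toSet l) true))

unique-toSet : ∀ {n} (l : List (Fin n)) → length l ≤ ∣ toSet l ∣ → Unique l
unique-toSet []      _  = []
unique-toSet (x ∷ l) le with x ∈? toSet l
... | yes x∈ = contradiction le (<⇒≱ (s≤s (≤-trans (≤-reflexive (cong ∣_∣ (◃-idem x∈))) (∣toSet∣≤ l))))
... | no x∉  = All.tabulate (λ y∈ x≡y → x∉ (subst (_∈ˢ toSet l) (sym x≡y) (∈-toSet⁺ y∈)))
  ∷ unique-toSet l (≤-pred (≤-trans le (≤-reflexive (∣◃∣ x∉))))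

-- All positions in a word are equivalent: since insertions commute, the distinguished letter can be
-- moved to the front.
∑-words-position : ∀ {n} s (Φ : Subset n → Fin n → ℕ) →
  ∑ (words (allFin n) (suc s)) (λ e → ∑ e (Φ (toSet e)))
  ≡ suc s * ∑ (allFin n) (λ x → ∑ (words (allFin n) s) (λ u → Φ (x ◃ toSet u) x))
∑-words-position {n} zero Φ = trans (∑-words (allFin n) 0 (λ e → ∑ e (Φ (toSet e))))
  (trans (∑-cong (allFin n) (λ x → trans (+-identityʳ _) refl)) (sym (*-identityˡ _)))
∑-words-position {n} (suc s) Φ = begin
  ∑ (W (suc (suc s))) (λ e → ∑ e (Φ (toSet e)))
    ≡⟨ ∑-words V (suc s) _ ⟩
  ∑ V (λ y → ∑ (W (suc s)) (λ e → Φ (y ◃ toSet e) y + ∑ e (Φ (y ◃ toSet e))))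
    ≡⟨ trans (∑-cong V (λ y → ∑-+ (W (suc s)) _ _)) (∑-+ V _ _) ⟩
  X + ∑ V (λ y → ∑ (W (suc s)) (λ e → ∑ e (Φ (y ◃ toSet e))))
    ≡⟨ cong (X +_) (∑-cong V (λ y → ∑-words-position s (λ S → Φ (y ◃ S)))) ⟩
  X + ∑ V (λ y → suc s * ∑ V (λ x → ∑ (W s) (λ u → Φ (y ◃ x ◃ toSet u) x)))
    ≡⟨ cong (X +_) (trans (∑-*ˡ V (suc s) _) (cong (suc s *_) (∑-swap V V _))) ⟩
  X + suc s * ∑ V (λ x → ∑ V (λ y → ∑ (W s) (λ u → Φ (y ◃ x ◃ toSet u) x)))
    ≡⟨ cong (λ z → X + suc s * z) (∑-cong V (λ x → trans (∑-cong V (λ y → ∑-cong (W s) (λ u → cong (λ S → Φ S x) (◃-comm y x (toSet u))))) (sym (∑-words V s _)))) ⟩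
  X + suc s * X ∎
  where
  open ≡-Reasoning
  V = allFin n
  W = words V
  X = ∑ V (λ x → ∑ (W (suc s)) (λ u → Φ (x ◃ toSet u) x))

-- H contains no homomorphic image of a tent whose first edge is split as A ∪ B with |A| ≤ k.
CoreTentFree : ∀ {n} → ℕ → (Subset n → Bool) → Set
CoreTentFree {n} k H = (A B : List (Fin n)) (w : Fin n) {S₂ S₃ : Subset n} →
  Unique (A ++ B) → H (toSet (A ++ B)) ≡ true → 1 ≤ length A → length A ≤ k → 1 ≤ length B →
  w ∉ A ++ B → H S₂ ≡ true → w ∈ˢ S₂ → (∀ {x} → x ∈ A → x ∈ˢ S₂) →
  H S₃ ≡ true → w ∈ˢ S₃ → (∀ {x} → x ∈ B → x ∈ˢ S₃) → Empty

module Density {n} (r : ℕ) (H : Subset n → Bool) (H-size : ∀ {S} → H S ≡ true → ∣ S ∣ ≡ r) where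

  V = allFin n

  shadow? : ∀ T → Dec (∃ λ S → H S ≡ true × T ⊆ˢ S)
  shadow? T = anySubset? (λ S → (H S ≟ᵇ true) ×-dec (T ⊆? S))

  abstract
    link : Subset n → Fin n → Bool
    link T w = not (lookup T w) ∧ ⌊ shadow? (w ◃ T) ⌋

    link⁻ : ∀ {T w} → link T w ≡ true → w ∉ˢ T × ∃ λ S → H S ≡ true × w ◃ T ⊆ˢ S
    link⁻ {T} {w} t = false⇒∉ (not-true (proj₁ (∧-true {not (lookup T w)} t))) , ⌊⌋-true (shadow? (w ◃ T)) (proj₂ (∧-true {not (lookup T w)} t))

    link⁺ : ∀ {T w S} → w ∉ˢ T → H S ≡ true → w ◃ T ⊆ˢ S → link T w ≡ true
    link⁺ {T} {w} {S} w∉ h ⊆S = ∧-intro (not-false (∉⇒false w∉)) (true-⌊⌋ (shadow? (w ◃ T)) (S , h , ⊆S))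

  L : Subset n → ℕ
  L T = ∑ V (ind ∘ link T)

  L≤n : ∀ T → L T ≤ n
  L≤n T = ≤-trans (∑-mono V (λ w → ind≤1 (link T w))) (≤-reflexive (trans (∑-const V 1) (trans (*-identityʳ _) (Listₚ.length-tabulate id))))

  b : List (Fin n) → Bool
  b e = H (toSet e)

  N = ∑ (words V r) (ind ∘ b)

  -- This is N times the mean of L over the initial segments of length r - i of the ordered edges.
  X : ℕ → ℕ
  X i = ∑ (words V (r ∸ i)) (λ u → ∑ (words V i) (λ v → ind (b (u ++ v))) * L (toSet u))

  edge-unique : ∀ {l} → length l ≤ r → H (toSet l) ≡ true → Unique l
  edge-unique {l} l≤r h = unique-toSet l (≤-trans l≤r (≤-reflexive (sym (H-size h))))

  -- toSet with an accumulator, so that a prefix of a word is absorbed definitionally.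
  toSetˡ : Subset n → List (Fin n) → Subset n
  toSetˡ S []      = S
  toSetˡ S (x ∷ e) = toSetˡ (x ◃ S) e

  toSetˡ-◃ : ∀ x S e → toSetˡ (x ◃ S) e ≡ x ◃ toSetˡ S e
  toSetˡ-◃ x S []      = refl
  toSetˡ-◃ x S (y ∷ e) = trans (cong (λ T → toSetˡ T e) (◃-comm y x S)) (toSetˡ-◃ x (y ◃ S) e)

  toSetˡ≡toSet : ∀ e → toSetˡ ⊥ e ≡ toSet e
  toSetˡ≡toSet []      = refl
  toSetˡ≡toSet (x ∷ e) = trans (toSetˡ-◃ x ⊥ e) (cong (x ◃_) (toSetˡ≡toSet e))

  ⊆-toSetˡ : ∀ S e → S ⊆ˢ toSetˡ S e
  ⊆-toSetˡ S []      p = p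
  ⊆-toSetˡ S (x ∷ e) p = ⊆-toSetˡ (x ◃ S) e (∈-◃-there x p)

  ∣toSetˡ∣≤ : ∀ S e → ∣ toSetˡ S e ∣ ≤ ∣ S ∣ + length e
  ∣toSetˡ∣≤ S []      = m≤m+n _ 0
  ∣toSetˡ∣≤ S (x ∷ e) = ≤-trans (∣toSetˡ∣≤ (x ◃ S) e) (≤-trans (+-monoˡ-≤ (length e) (∣◃∣≤ x S)) (≤-reflexive (sym (+-suc ∣ S ∣ (length e)))))

  module _ (c : ℕ → ℕ) where
    open Tree V ∈-allFin c

    -- A letter through which the prefix can be completed to an edge is new, since otherwise the
    -- edge would have fewer than r vertices; hence it is counted by L.
    branching : ∀ j S → ∣ S ∣ + j ≤ r → Branching j (λ e → H (toSetˡ S e)) (λ e → L (toSetˡ S e))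
    branching zero    S _   = tt
    branching (suc j) S S≤r = ∑-mono V linked , λ x → branching j (x ◃ S) (≤-trans (+-monoˡ-≤ j (∣◃∣≤ x S)) (≤-trans (≤-reflexive (sym (+-suc ∣ S ∣ j))) S≤r))
      where
      linked : ∀ x → ind ⌊ 0 <? #words j (λ e → H (toSetˡ (x ◃ S) e)) ⌋ ≤ ind (link S x)
      linked x = ind-mono λ t → found (∑-words-pos V j (λ e → ind (H (toSetˡ (x ◃ S) e))) (⌊⌋-true (0 <? #words j (λ e → H (toSetˡ (x ◃ S) e))) t))
        where
        found : (∃ λ e → length e ≡ j × 0 < ind (H (toSetˡ (x ◃ S) e))) → link S x ≡ true
        found (e , refl , pos) with H (toSetˡ (x ◃ S) e) in h
        ... | true = link⁺ x∉ h (⊆-toSetˡ (x ◃ S) e)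
          where
          x∉ : x ∉ˢ S
          x∉ x∈ = <-irrefl refl (begin-strict
            ∣ S ∣ + length e            <⟨ ≤-reflexive (sym (+-suc ∣ S ∣ (length e))) ⟩
            ∣ S ∣ + suc (length e)      ≤⟨ S≤r ⟩
            r                           ≡⟨ sym (H-size h) ⟩
            ∣ toSetˡ (x ◃ S) e ∣        ≤⟨ ∣toSetˡ∣≤ (x ◃ S) e ⟩
            ∣ x ◃ S ∣ + length e        ≡⟨ cong (λ T → ∣ T ∣ + length e) (◃-idem x∈) ⟩
            ∣ S ∣ + length e            ∎)
            where open ≤-Reasoning

    -- Regrouping by the length of the prefix, after which the sums X i become visible.
    weight-sum : ∀ j b L → weight j b L ≡ Σ₁ j (λ i → c i * ∑ (words V (j ∸ i)) (λ u → #words i (λ v → b (u ++ v)) * L u))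
    weight-sum zero    b L = refl
    weight-sum (suc j) b L = trans (+-comm (c (suc j) * (#words (suc j) b * L [])) _) (cong₂ _+_ lower top)
      where
      open ≡-Reasoning
      top : c (suc j) * (#words (suc j) b * L []) ≡ c (suc j) * ∑ (words V (suc j ∸ suc j)) (λ u → #words (suc j) (λ v → b (u ++ v)) * L u)
      top = cong (c (suc j) *_) (trans (sym (+-identityʳ _)) (cong (λ m → ∑ (words V m) (λ u → #words (suc j) (λ v → b (u ++ v)) * L u)) (sym (n∸n≡0 j))))
      term : (j i : ℕ) → ℕ
      term j i = ∑ (words V j) (λ u → #words i (λ v → b (u ++ v)) * L u)
      lower : ∑ V (λ x → weight j (λ e → b (x ∷ e)) (λ e → L (x ∷ e))) ≡ Σ₁ j (λ i → c i * term (suc j ∸ i) i)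
      lower = begin
        ∑ V (λ x → weight j (λ e → b (x ∷ e)) (λ e → L (x ∷ e)))
          ≡⟨ ∑-cong V (λ x → weight-sum j (λ e → b (x ∷ e)) (λ e → L (x ∷ e))) ⟩
        ∑ V (λ x → Σ₁ j (λ i → c i * ∑ (words V (j ∸ i)) (λ u → #words i (λ v → b (x ∷ u ++ v)) * L (x ∷ u))))
          ≡⟨ sym (Σ₁-∑ V j _) ⟩
        Σ₁ j (λ i → ∑ V (λ x → c i * ∑ (words V (j ∸ i)) (λ u → #words i (λ v → b (x ∷ u ++ v)) * L (x ∷ u))))
          ≡⟨ Σ₁-cong j (λ i _ i≤j → trans (∑-*ˡ V (c i) _) (cong (c i *_) (trans (sym (∑-words V (j ∸ i) _)) (cong (λ m → term m i) (sym (+-∸-assoc 1 i≤j)))))) ⟩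
        Σ₁ j (λ i → c i * term (suc j ∸ i) i) ∎

    -- If c i = 1/i up to a common factor, the estimate ∑ X i / i ≤ n N turns this into N ≤ r!
    -- (n/r)^r.
    density : r ^ r * ∏₁ r c * N ^ suc r ≤ Σ₁ r (λ i → c i * X i) ^ r
    density = subst₂ (λ m z → r ^ r * ∏₁ r c * m ^ suc r ≤ z ^ r)
      (∑-cong (words V r) (λ e → cong (ind ∘ H) (toSetˡ≡toSet e)))
      (trans (weight-sum r _ _) (Σ₁-cong r (λ i _ _ → cong (c i *_) (∑-cong (words V (r ∸ i)) (λ u →
        cong₂ _*_ (∑-cong (words V i) (λ v → cong (ind ∘ H) (toSetˡ≡toSet (u ++ v)))) (cong L (toSetˡ≡toSet u)))))))
      (#words-≤ r (λ e → H (toSetˡ ⊥ e)) (λ e → L (toSetˡ ⊥ e)) (branching r ⊥ (≤-reflexive (cong (_+ r) (∣⊥∣≡0 n)))))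

  N≥ : r ! * ∑ (subsets n) (ind ∘ H) ≤ N
  N≥ = ≤-trans (*-monoʳ-≤ (r !) (∑-mono (subsets n) size)) (∑-subsets≤∑-words r (ind ∘ H))
    where
    size : ∀ S → ind (H S) ≤ ind ⌊ ∣ S ∣ ≟ r ⌋ * ind (H S)
    size S with H S in h
    ... | false = z≤n
    ... | true rewrite true-⌊⌋ (∣ S ∣ ≟ r) (H-size h) = ≤-refl

  X-top : X r ≤ n * N
  X-top = begin
    X r                                                              ≡⟨ cong (λ m → ∑ (words V m) (λ u → ∑ (words V r) (λ v → ind (b (u ++ v))) * L (toSet u))) (n∸n≡0 r) ⟩
    N * L ⊥ + 0                                                      ≡⟨ +-identityʳ _ ⟩
    N * L ⊥                                                          ≤⟨ *-monoʳ-≤ N (L≤n ⊥) ⟩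
    N * n                                                            ≡⟨ *-comm N n ⟩
    n * N                                                            ∎
    where open ≤-Reasoning

  X-split : ∀ i c j → r ∸ i ≡ c + j →
    X i ≡ ∑ (words V c) (λ u → ∑ (words V j) (λ p → ∑ (words V i) (λ v → ind (b ((u ++ p) ++ v)) * L (toSet (u ++ p)))))
  X-split i c j eq = trans (cong (λ m → ∑ (words V m) (λ u → ∑ (words V i) (λ v → ind (b (u ++ v))) * L (toSet u))) eq)
    (trans (∑-words-++ V c j _) (∑-cong (words V c) (λ u → ∑-cong (words V j) (λ p → sym (∑-*ʳ (words V i) (L (toSet (u ++ p))) _)))))

  swap-tails : ∀ (u q p : List (Fin n)) {x} → x ∈ (u ++ q) ++ p → x ∈ u ++ p ++ q
  swap-tails u q p x∈ with ∈-++⁻ (u ++ q) x∈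
  ... | inj₂ e = ∈-++⁺ʳ u (∈-++⁺ˡ e)
  ... | inj₁ e with ∈-++⁻ u e
  ...   | inj₁ f = ∈-++⁺ˡ f
  ...   | inj₂ f = ∈-++⁺ʳ u (∈-++⁺ʳ p f)

  swap-tails⁻ : ∀ (u q p : List (Fin n)) {x} → x ∈ u ++ p ++ q → x ∈ (u ++ q) ++ p
  swap-tails⁻ u q p x∈ with ∈-++⁻ u x∈
  ... | inj₁ e = ∈-++⁺ˡ (∈-++⁺ˡ e)
  ... | inj₂ e with ∈-++⁻ p e
  ...   | inj₁ f = ∈-++⁺ʳ (u ++ q) f
  ...   | inj₂ f = ∈-++⁺ˡ (∈-++⁺ʳ u f)

  module _ {k : ℕ} (tent-free : CoreTentFree k H) where

    -- A vertex counted by both terms on the left would be the apex of a tent image whose first edge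
    -- is split into p and u ∪ q.
    links-disjoint : ∀ u p q → length (u ++ p ++ q) ≤ r → 1 ≤ length p → length p ≤ k → 1 ≤ length q →
      b (u ++ p ++ q) ≡ true → L (toSet (u ++ q)) + L (toSet (u ++ p)) ≤ L (toSet u)
    links-disjoint u p q ≤r p≥1 p≤k q≥1 h = ≤-trans (≤-reflexive (sym (∑-+ V _ _))) (∑-mono V disjoint)
      where
      rearr : ∀ {x} → x ∈ u ++ p ++ q → x ∈ p ++ u ++ q
      rearr x∈ with ∈-++⁻ u x∈
      ... | inj₁ a = ∈-++⁺ʳ p (∈-++⁺ˡ a)
      ... | inj₂ a with ∈-++⁻ p a
      ...   | inj₁ c = ∈-++⁺ˡ c
      ...   | inj₂ c = ∈-++⁺ʳ p (∈-++⁺ʳ u c)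
      rearr⁻ : ∀ {x} → x ∈ p ++ u ++ q → x ∈ u ++ p ++ q
      rearr⁻ x∈ with ∈-++⁻ p x∈
      ... | inj₁ a = ∈-++⁺ʳ u (∈-++⁺ˡ a)
      ... | inj₂ a with ∈-++⁻ u a
      ...   | inj₁ c = ∈-++⁺ˡ c
      ...   | inj₂ c = ∈-++⁺ʳ u (∈-++⁺ʳ p c)
      h′ : H (toSet (p ++ u ++ q)) ≡ true
      h′ = trans (cong H (toSet-≡ rearr⁻ rearr)) h
      ∣∣-same : length (p ++ u ++ q) ≡ length (u ++ p ++ q)
      ∣∣-same = trans (Listₚ.length-++ p) (trans (cong (length p +_) (Listₚ.length-++ u)) (trans (lemma (length p) (length u) (length q))
        (sym (trans (Listₚ.length-++ u) (cong (length u +_) (Listₚ.length-++ p))))))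
        where
        lemma : ∀ a b c → a + (b + c) ≡ b + (a + c)
        lemma = solve-∀
      link-mono : ∀ z w → link (toSet (u ++ z)) w ≡ true → link (toSet u) w ≡ true
      link-mono z w t with link⁻ t
      ... | w∉ , S , hS , ⊆S = link⁺ (λ w∈ → w∉ (toSet-⊆ {l = u} ∈-++⁺ˡ w∈)) hS (λ x∈ → ⊆S (◃-mono w (toSet-⊆ {l = u} {m = u ++ z} ∈-++⁺ˡ) x∈))
      both : ∀ w → link (toSet (u ++ q)) w ≡ true → link (toSet (u ++ p)) w ≡ true → Empty
      both w t s with link⁻ t | link⁻ s
      ... | w∉q , S₃ , h₃ , ⊆S₃ | w∉p , S₂ , h₂ , ⊆S₂ = tent-free p (u ++ q) w
        (edge-unique (≤-trans (≤-reflexive ∣∣-same) ≤r) h′) h′ p≥1 p≤k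
        (≤-trans q≥1 (≤-trans (m≤n+m _ (length u)) (≤-reflexive (sym (Listₚ.length-++ u)))))
        (λ w∈ → [ (λ a → w∉p (∈-toSet⁺ (∈-++⁺ʳ u a))) , (λ a → w∉q (∈-toSet⁺ a)) ] (∈-++⁻ p w∈))
        h₂ (⊆S₂ (∈-◃-here w _)) (λ x∈ → ⊆S₂ (∈-◃-there w (∈-toSet⁺ (∈-++⁺ʳ u x∈))))
        h₃ (⊆S₃ (∈-◃-here w _)) (λ x∈ → ⊆S₃ (∈-◃-there w (∈-toSet⁺ x∈)))
      disjoint : ∀ w → ind (link (toSet (u ++ q)) w) + ind (link (toSet (u ++ p)) w) ≤ ind (link (toSet u) w)
      disjoint w with link (toSet (u ++ q)) w in t | link (toSet (u ++ p)) w in s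
      ... | false | false = z≤n
      ... | true  | true  = ⊥-elim (both w t s)
      ... | true  | false = ind-mono {true} (λ _ → link-mono q w t)
      ... | false | true  = ind-mono {true} (λ _ → link-mono p w s)

    X-superadditive : ∀ a d → 1 ≤ a → a ≤ k → 1 ≤ d → a + d ≤ r → X a + X d ≤ X (a + d)
    X-superadditive a d a≥1 a≤k d≥1 ≤r = begin
      X a + X d
        ≡⟨ cong₂ _+_ (trans (X-split a c d ca) (∑-cong (words V c) (λ u → ∑-swap (words V d) (words V a) _))) (X-split d c a cd) ⟩
      ∑ (words V c) (λ u → ∑ (words V a) (λ p → ∑ (words V d) (λ q → F u p q))) + ∑ (words V c) (λ u → ∑ (words V a) (λ p → ∑ (words V d) (λ q → F′ u p q)))
        ≡⟨ trans (sym (∑-+ (words V c) _ _)) (∑-cong (words V c) (λ u → trans (sym (∑-+ (words V a) _ _)) (∑-cong (words V a) (λ p → sym (∑-+ (words V d) _ _))))) ⟩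
      ∑ (words V c) (λ u → ∑ (words V a) (λ p → ∑ (words V d) (λ q → F u p q + F′ u p q)))
        ≤⟨ ∑-words-mono V c (λ u ∣u∣ → ∑-words-mono V a (λ p ∣p∣ → ∑-words-mono V d (λ q ∣q∣ → pointwise u p q ∣u∣ ∣p∣ ∣q∣))) ⟩
      ∑ (words V c) (λ u → ∑ (words V a) (λ p → ∑ (words V d) (λ q → ind (b (u ++ p ++ q)) * L (toSet u))))
        ≡⟨ ∑-cong (words V c) (λ u → trans (sym (∑-words-++ V a d (λ z → ind (b (u ++ z)) * L (toSet u)))) (∑-*ʳ (words V (a + d)) (L (toSet u)) _)) ⟩
      X (a + d) ∎
      where
      open ≤-Reasoning
      c = r ∸ (a + d)
      total : c + (a + d) ≡ r
      total = m∸n+n≡m ≤r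
      ca : r ∸ a ≡ c + d
      ca = trans (cong (_∸ a) (trans (sym total) (lemma c a d))) (m+n∸m≡n a (c + d))
        where
        lemma : ∀ c a d → c + (a + d) ≡ a + (c + d)
        lemma = solve-∀
      cd : r ∸ d ≡ c + a
      cd = trans (cong (_∸ d) (trans (sym total) (lemma c a d))) (m+n∸m≡n d (c + a))
        where
        lemma : ∀ c a d → c + (a + d) ≡ d + (c + a)
        lemma = solve-∀
      F F′ : List (Fin n) → List (Fin n) → List (Fin n) → ℕ
      F u p q = ind (b ((u ++ q) ++ p)) * L (toSet (u ++ q))
      F′ u p q = ind (b ((u ++ p) ++ q)) * L (toSet (u ++ p))
      pointwise : ∀ u p q → length u ≡ c → length p ≡ a → length q ≡ d → F u p q + F′ u p q ≤ ind (b (u ++ p ++ q)) * L (toSet u)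
      pointwise u p q ∣u∣ ∣p∣ ∣q∣ rewrite Listₚ.++-assoc u p q | toSet-≡ (swap-tails u q p) (λ x∈ → swap-tails⁻ u q p x∈) = go
        where
        go : ind (b (u ++ p ++ q)) * L (toSet (u ++ q)) + ind (b (u ++ p ++ q)) * L (toSet (u ++ p)) ≤ ind (b (u ++ p ++ q)) * L (toSet u)
        go with b (u ++ p ++ q) in h
        ... | false = z≤n
        ... | true = ≤-trans (≤-reflexive (cong₂ _+_ (*-identityˡ (L (toSet (u ++ q)))) (*-identityˡ (L (toSet (u ++ p)))))) (≤-trans
          (links-disjoint u p q (≤-reflexive (trans (Listₚ.length-++ u) (trans (cong₂ _+_ ∣u∣ (trans (Listₚ.length-++ p) (cong₂ _+_ ∣p∣ ∣q∣))) total)))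
            (subst (1 ≤_) (sym ∣p∣) a≥1) (subst (_≤ k) (sym ∣p∣) a≤k) (subst (1 ≤_) (sym ∣q∣) d≥1) h) (≤-reflexive (sym (*-identityˡ (L (toSet u))))))

-- Stability of the density bound

reciprocals : ℕ → ℕ → ℕ
reciprocals Λ zero    = 0
reciprocals Λ (suc i) = Λ / suc i

reciprocals-! : ∀ r i → 1 ≤ i → i ≤ r → i * reciprocals (r !) i ≡ r !
reciprocals-! r (suc i) _ i≤r = m*[n/m]≡n (∣-trans (m∣m*n (i !)) (m≤n⇒m!∣n! i≤r))

-- The weight of X 1 is raised by the factor 1 + 1/q.
tilt : ℕ → ℕ → ℕ
tilt q (suc zero) = suc q
tilt q _          = q

∏₁-tilt : ∀ q r j → suc j ≤ r →
  ∏₁ (suc j) (λ i → tilt q i * reciprocals (r !) i) * suc j ! ≡ suc q * (q ^ j * (r !) ^ suc j)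
∏₁-tilt q r zero    j<r = begin
  1 * (suc q * reciprocals (r !) 1) * 1   ≡⟨ lemma (suc q) (reciprocals (r !) 1) ⟩
  suc q * (1 * (1 * reciprocals (r !) 1 * 1)) ≡⟨ cong (λ z → suc q * (1 * (z * 1))) (reciprocals-! r 1 ≤-refl j<r) ⟩
  suc q * (1 * (r ! * 1))                 ∎
  where
  open ≡-Reasoning
  lemma : ∀ q w → 1 * (q * w) * 1 ≡ q * (1 * (1 * w * 1))
  lemma = solve-∀
∏₁-tilt q r (suc j) j<r = begin
  P * (q * w) * (suc (suc j) * suc j !)             ≡⟨ lemma P q w (suc (suc j)) (suc j !) ⟩
  P * suc j ! * (q * (suc (suc j) * w))             ≡⟨ cong₂ (λ a b → a * (q * b)) (∏₁-tilt q r j (<⇒≤ j<r)) (reciprocals-! r (suc (suc j)) (s≤s z≤n) j<r) ⟩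
  suc q * (q ^ j * (r !) ^ suc j) * (q * r !)         ≡⟨ lemma′ (suc q) (q ^ j) ((r !) ^ suc j) q (r !) ⟩
  suc q * (q * q ^ j * (r ! * (r !) ^ suc j))         ∎
  where
  open ≡-Reasoning
  P = ∏₁ (suc j) (λ i → tilt q i * reciprocals (r !) i)
  w = reciprocals (r !) (suc (suc j))
  lemma : ∀ P q w i f → P * (q * w) * (i * f) ≡ P * f * (q * (i * w))
  lemma = solve-∀
  lemma′ : ∀ a b c q f → a * (b * c) * (q * f) ≡ a * (q * b * (f * c))
  lemma′ = solve-∀

-- (a + b)^s (a − s b) ≤ a^(s+1)
bernoulli : ∀ a b s → a * (a + b) ^ s ≤ a ^ suc s + s * (b * (a + b) ^ s)
bernoulli a b zero    = ≤-reflexive (sym (+-identityʳ (a * 1)))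
bernoulli a b (suc s) = begin
  a * (a + b) ^ suc s
    ≤⟨ *-monoʳ-≤ a (power-increment a b s) ⟩
  a * (a ^ suc s + suc s * (b * (a + b) ^ s))
    ≤⟨ m≤m+n _ (suc s * (b * (b * (a + b) ^ s))) ⟩
  a * (a ^ suc s + suc s * (b * (a + b) ^ s)) + suc s * (b * (b * (a + b) ^ s))
    ≡⟨ lemma a b s (a ^ suc s) ((a + b) ^ s) ⟩
  a * a ^ suc s + suc s * (b * ((a + b) * (a + b) ^ s)) ∎
  where
  open ≤-Reasoning
  lemma : ∀ a b s p q → a * (p + suc s * (b * q)) + suc s * (b * (b * q)) ≡ a * p + suc s * (b * ((a + b) * q))
  lemma = solve-∀

module Stability {n} (s : ℕ) (H : Subset n → Bool) (H-size : ∀ {S} → H S ≡ true → ∣ S ∣ ≡ suc s)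
  {k} (tent-free : CoreTentFree k H) (l : ℕ) (r≡ : k + l ≡ suc s) (k≥1 : 1 ≤ k)
  (tail≤ : Σ₁ l (λ i → reciprocals (suc s !) (k + i)) ≤ suc s !) where

  private
    r = suc s
    Λ = r !
    w = reciprocals Λ
  open Density r H H-size public

  #H = ∑ (subsets n) (ind ∘ H)

  average : Σ₁ r (λ i → w i * X i) ≤ Λ * X r
  average = subst (λ m → Σ₁ m (λ i → w i * X i) ≤ Λ * X m) r≡
    (superadditive-average Λ w k l X (1≤n! r) k≥1
      (λ i i≥1 i≤ → reciprocals-! r i i≥1 (≤-trans i≤ (≤-reflexive r≡))) tail≤
      (λ a d a≥1 a≤k d≥1 ≤r → X-superadditive tent-free a d a≥1 a≤k d≥1 (≤-trans ≤r (≤-reflexive r≡))))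

  -- Only X 1 receives additional weight, so the excess over q times the inequality `average` is Λ X
  -- 1.
  tilted : ∀ q → Σ₁ r (λ i → tilt q i * w i * X i) ≤ Λ * (q * (n * N) + X 1)
  tilted q = begin
    Σ₁ r (λ i → tilt q i * w i * X i)
      ≡⟨ Σ₁-head s _ ⟩
    suc q * w 1 * X 1 + Σ₁ s (λ i → tilt q (suc i) * w (suc i) * X (suc i))
      ≡⟨ cong₂ _+_ (lemma q (w 1) (X 1)) (Σ₁-cong s rest) ⟩
    1 * w 1 * X 1 + q * (w 1 * X 1) + Σ₁ s (λ i → q * (w (suc i) * X (suc i)))
      ≡⟨ trans (+-assoc (1 * w 1 * X 1) _ _) (cong₂ (λ a b → a * X 1 + (q * (w 1 * X 1) + b)) (reciprocals-! r 1 ≤-refl (s≤s z≤n)) (Σ₁-*ˡ s q _)) ⟩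
    Λ * X 1 + (q * (w 1 * X 1) + q * Σ₁ s (λ i → w (suc i) * X (suc i)))
      ≡⟨ cong (λ z → Λ * X 1 + z) (trans (sym (*-distribˡ-+ q _ _)) (cong (q *_) (sym (Σ₁-head s _)))) ⟩
    Λ * X 1 + q * Σ₁ r (λ i → w i * X i)
      ≤⟨ +-monoʳ-≤ (Λ * X 1) (*-monoʳ-≤ q (≤-trans average (*-monoʳ-≤ Λ X-top))) ⟩
    Λ * X 1 + q * (Λ * (n * N))
      ≡⟨ lemma′ Λ (X 1) q (n * N) ⟩
    Λ * (q * (n * N) + X 1) ∎
    where
    open ≤-Reasoning
    rest : ∀ i → 1 ≤ i → i ≤ s → tilt q (suc i) * w (suc i) * X (suc i) ≡ q * (w (suc i) * X (suc i))
    rest (suc i) _ _ = *-assoc q (w (suc (suc i))) (X (suc (suc i)))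
    lemma : ∀ q w x → suc q * w * x ≡ 1 * w * x + q * (w * x)
    lemma = solve-∀
    lemma′ : ∀ Λ x q m → Λ * x + q * (Λ * m) ≡ Λ * (q * m + x)
    lemma′ = solve-∀

  -- X 1 concerns ordered edges without their last letter; by the symmetry of positions, every
  -- vertex of an edge is removed equally often.
  degree-X₁ : r * X 1 ≡ ∑ (words V r) (λ e → ind (b e) * ∑ e (λ v → L (toSet e ▹ v)))
  degree-X₁ = begin
    r * X 1
      ≡⟨ cong (r *_) (trans (∑-words-cong V s one) (∑-swap (words V s) V _)) ⟩
    r * ∑ V (λ x → ∑ (words V s) (λ u → ind (H (x ◃ toSet u)) * L ((x ◃ toSet u) ▹ x)))
      ≡⟨ sym (∑-words-position s (λ S v → ind (H S) * L (S ▹ v))) ⟩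
    ∑ (words V r) (λ e → ∑ e (λ v → ind (b e) * L (toSet e ▹ v)))
      ≡⟨ ∑-cong (words V r) (λ e → ∑-*ˡ e (ind (b e)) _) ⟩
    ∑ (words V r) (λ e → ind (b e) * ∑ e (λ v → L (toSet e ▹ v))) ∎
    where
    open ≡-Reasoning
    one : ∀ u → length u ≡ s → ∑ (words V 1) (λ v → ind (b (u ++ v))) * L (toSet u) ≡ ∑ V (λ x → ind (H (x ◃ toSet u)) * L ((x ◃ toSet u) ▹ x))
    one u ∣u∣ = trans (cong (_* L (toSet u)) (trans (∑-words V 0 (λ v → ind (b (u ++ v)))) (∑-cong V (λ x → trans (+-identityʳ _) (cong (ind ∘ H) (snoc x))))))
      (trans (sym (∑-*ʳ V (L (toSet u)) _)) (∑-cong V removed))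
      where
      snoc : ∀ x → toSet (u ++ x ∷ []) ≡ x ◃ toSet u
      snoc x = toSet-≡ {l = u ++ x ∷ []} {m = x ∷ u} fwd bwd
        where
        fwd : ∀ {y} → y ∈ u ++ x ∷ [] → y ∈ x ∷ u
        fwd y∈ with ∈-++⁻ u y∈
        ... | inj₁ a           = there a
        ... | inj₂ (here refl) = here refl
        bwd : ∀ {y} → y ∈ x ∷ u → y ∈ u ++ x ∷ []
        bwd (here refl) = ∈-++⁺ʳ u (here refl)
        bwd (there p)   = ∈-++⁺ˡ p
      removed : ∀ x → ind (H (x ◃ toSet u)) * L (toSet u) ≡ ind (H (x ◃ toSet u)) * L ((x ◃ toSet u) ▹ x)
      removed x with H (x ◃ toSet u) in h
      ... | false = refl
      ... | true with edge-unique {x ∷ u} (≤-reflexive (cong suc ∣u∣)) h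
      ...   | x∉ ∷ _ = cong (λ T → 1 * L T) (sym (◃-▹ (λ p → All.lookup x∉ (∈-toSet⁻ {l = u} p) refl)))

  -- The conclusion reads |H| ≤ (n/r)^r q³/(q³ + 1).
  few-edges : ∀ q′ → let q = suc q′ in
    (∀ S → H S ≡ true → q * ∑ (elems S) (λ v → L (S ▹ v)) ≤ q′ * n) →
    r ^ r * #H * suc (q * q * q) ≤ n ^ r * (q * q * q)
  few-edges q′ deficient with N in N≡
  ... | zero = ≤-trans (≤-reflexive (cong (_* suc (q * q * q)) (trans (cong (r ^ r *_) #H≡0) (*-zeroʳ (r ^ r))))) z≤n
    where
    q = suc q′
    #H≡0 : #H ≡ 0
    #H≡0 = n≤0⇒n≡0 (*-cancelˡ-≤ Λ {{r !≢0}} (≤-trans N≥ (≤-trans (≤-reflexive N≡) z≤n)))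
  ... | suc N₀ = *-cancelˡ-≤ (q ^ s * (q * r) ^ r) {{m*n≢0 (q ^ s) ((q * r) ^ r) {{m^n≢0 q s}} {{m^n≢0 (q * r) r}}}} (begin
      q ^ s * (q * r) ^ r * (r ^ r * #H * suc (q * q * q))
        ≡⟨ cong (λ z → q ^ s * (q * r) ^ r * (r ^ r * #H * z)) (cube q′) ⟩
      q ^ s * (q * r) ^ r * (r ^ r * #H * (suc q * e))
        ≡⟨ lemma₁ (q ^ s) ((q * r) ^ r) (r ^ r) #H (suc q) e ⟩
      e * (r ^ r * (suc q * q ^ s) * #H * (q * r) ^ r)
        ≤⟨ *-monoʳ-≤ e cleared ⟩
      e * (n ^ r * (a + q′) ^ r)
        ≡⟨ lemma₂ e (n ^ r) ((a + q′) ^ r) ⟩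
      n ^ r * (e * (a + q′) ^ r)
        ≤⟨ *-monoʳ-≤ (n ^ r) power ⟩
      n ^ r * (q * q * a ^ r)
        ≡⟨ cong (λ z → n ^ r * (q * q * z)) (trans (cong (_^ r) (*-assoc q q r)) (^-distribʳ-* r q (q * r))) ⟩
      n ^ r * (q * q * (q * q ^ s * (q * r) ^ r))
        ≡⟨ lemma₃ (n ^ r) q (q ^ s) ((q * r) ^ r) ⟩
      q ^ s * (q * r) ^ r * (n ^ r * (q * q * q)) ∎)
    where
    open ≤-Reasoning
    q = suc q′
    -- By `first`, q + X 1 / (n N) is at most (a + q′)/(q r). The inequality `bernoulli` bounds ((a
    -- + q′)/a)^r by q²/e with e = q² - q′ = q² - q + 1, and q³ + 1 = (q + 1) e.
    a = q * q * r
    e = q′ * q′ + q′ + 1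
    cube : ∀ q′ → suc (suc q′ * suc q′ * suc q′) ≡ suc (suc q′) * (q′ * q′ + q′ + 1)
    cube = solve-∀
    lemma₁ : ∀ a b c d f e → a * b * (c * d * (f * e)) ≡ e * (c * (f * a) * d * b)
    lemma₁ = solve-∀
    lemma₂ : ∀ a b c → a * (b * c) ≡ b * (a * c)
    lemma₂ = solve-∀
    lemma₃ : ∀ n q a b → n * (q * q * (q * a * b)) ≡ a * b * (n * (q * q * q))
    lemma₃ = solve-∀
    M = suc N₀
    first : q * (r * X 1) ≤ q′ * n * M
    first = begin
      q * (r * X 1)
        ≡⟨ trans (cong (q *_) degree-X₁) (sym (∑-*ˡ (words V r) q _)) ⟩
      ∑ (words V r) (λ e → q * (ind (b e) * ∑ e (λ v → L (toSet e ▹ v))))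
        ≤⟨ ∑-words-mono V r each ⟩
      ∑ (words V r) (λ e → q′ * n * ind (b e))
        ≡⟨ trans (∑-*ˡ (words V r) (q′ * n) _) (cong (q′ * n *_) N≡) ⟩
      q′ * n * M ∎
      where
      each : ∀ e → length e ≡ r → q * (ind (b e) * ∑ e (λ v → L (toSet e ▹ v))) ≤ q′ * n * ind (b e)
      each e ∣e∣ with b e in h
      ... | false = ≤-trans (≤-reflexive (*-zeroʳ q)) z≤n
      ... | true = ≤-trans (≤-reflexive (cong (q *_) (trans (*-identityˡ _)
          (trans (∑-unique e _ (edge-unique (≤-reflexive ∣e∣) h)) (sym (∑-elems (toSet e) _))))))
        (≤-trans (deficient (toSet e) h) (≤-reflexive (sym (*-identityʳ _))))
    main : r ^ r * (suc q * q ^ s) * #H * M ^ r ≤ (q * (n * M) + X 1) ^ r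
    main = *-cancelˡ-≤ (Λ * Λ ^ r) {{m*n≢0 Λ (Λ ^ r) {{r !≢0}} {{m^n≢0 Λ r {{r !≢0}}}}}} (begin
      Λ * Λ ^ r * (r ^ r * (suc q * q ^ s) * #H * M ^ r)
        ≡⟨ lemma₄ Λ (Λ ^ r) (r ^ r) (suc q) (q ^ s) #H (M ^ r) ⟩
      r ^ r * (suc q * (q ^ s * Λ ^ r)) * (Λ * #H * M ^ r)
        ≤⟨ *-monoʳ-≤ (r ^ r * (suc q * (q ^ s * Λ ^ r))) (*-monoˡ-≤ (M ^ r) (≤-trans N≥ (≤-reflexive N≡))) ⟩
      r ^ r * (suc q * (q ^ s * Λ ^ r)) * M ^ suc r
        ≡⟨ cong (λ z → r ^ r * z * M ^ suc r) (sym (∏₁-tilt q r s ≤-refl)) ⟩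
      r ^ r * (∏₁ r c * Λ) * M ^ suc r
        ≡⟨ lemma₅ (r ^ r) (∏₁ r c) Λ (M ^ suc r) ⟩
      Λ * (r ^ r * ∏₁ r c * M ^ suc r)
        ≤⟨ *-monoʳ-≤ Λ (subst (λ z → r ^ r * ∏₁ r c * z ^ suc r ≤ Σ₁ r (λ i → c i * X i) ^ r) N≡ (density c)) ⟩
      Λ * Σ₁ r (λ i → c i * X i) ^ r
        ≤⟨ *-monoʳ-≤ Λ (^-monoˡ-≤ r (subst (λ z → Σ₁ r (λ i → c i * X i) ≤ Λ * (q * (n * z) + X 1)) N≡ (tilted q))) ⟩
      Λ * (Λ * (q * (n * M) + X 1)) ^ r
        ≡⟨ trans (cong (Λ *_) (^-distribʳ-* r Λ (q * (n * M) + X 1))) (sym (*-assoc Λ (Λ ^ r) ((q * (n * M) + X 1) ^ r))) ⟩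
      Λ * Λ ^ r * (q * (n * M) + X 1) ^ r ∎)
      where
      c = λ i → tilt q i * w i
      lemma₄ : ∀ Λ p a b d g m → Λ * p * (a * (b * d) * g * m) ≡ a * (b * (d * p)) * (Λ * g * m)
      lemma₄ = solve-∀
      lemma₅ : ∀ a b c d → a * (b * c) * d ≡ c * (a * b * d)
      lemma₅ = solve-∀
    cleared : r ^ r * (suc q * q ^ s) * #H * (q * r) ^ r ≤ n ^ r * (a + q′) ^ r
    cleared = *-cancelʳ-≤ _ _ (M ^ r) {{m^n≢0 M r}} (begin
      r ^ r * (suc q * q ^ s) * #H * (q * r) ^ r * M ^ r
        ≡⟨ lemma₆ (r ^ r * (suc q * q ^ s) * #H) ((q * r) ^ r) (M ^ r) ⟩
      (q * r) ^ r * (r ^ r * (suc q * q ^ s) * #H * M ^ r)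
        ≤⟨ *-monoʳ-≤ ((q * r) ^ r) main ⟩
      (q * r) ^ r * (q * (n * M) + X 1) ^ r
        ≡⟨ sym (^-distribʳ-* r (q * r) (q * (n * M) + X 1)) ⟩
      (q * r * (q * (n * M) + X 1)) ^ r
        ≤⟨ ^-monoˡ-≤ r (≤-trans (≤-reflexive (lemma₇ q r n M (X 1))) (≤-trans (+-monoʳ-≤ (n * (q * q * r) * M) first) (≤-reflexive (lemma₈ n (q * q * r) M q′)))) ⟩
      (n * (a + q′) * M) ^ r
        ≡⟨ trans (^-distribʳ-* r (n * (a + q′)) M) (cong (_* M ^ r) (^-distribʳ-* r n (a + q′))) ⟩
      n ^ r * (a + q′) ^ r * M ^ r ∎)
      where
      lemma₆ : ∀ a b c → a * b * c ≡ b * (a * c)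
      lemma₆ = solve-∀
      lemma₇ : ∀ q r n M x → q * r * (q * (n * M) + x) ≡ n * (q * q * r) * M + q * (r * x)
      lemma₇ = solve-∀
      lemma₈ : ∀ n a M q → n * a * M + q * n * M ≡ n * (a + q) * M
      lemma₈ = solve-∀
    power : e * (a + q′) ^ r ≤ q * q * a ^ r
    power = *-cancelˡ-≤ r (≤-by (r * (e * p)) (r * (q * q * a ^ r)) 0 (bernoulli a q′ r) (lemma₉ q′ r p (a ^ r)))
      where
      p = (a + q′) ^ r
      lemma₉ : ∀ q′ r p t → r * ((q′ * q′ + q′ + 1) * p) + (suc q′ * suc q′ * r * t + r * (q′ * p)) + 0
        ≡ r * (suc q′ * suc q′ * t) + suc q′ * suc q′ * r * p
      lemma₉ = solve-∀

-- Rainbow sets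

module _ {C : Set} (_≟ᶜ_ : (p p′ : C) → Dec (p ≡ p′)) where

  remove : C → List C → List C
  remove p []      = []
  remove p (u ∷ l) with u ≟ᶜ p
  ... | yes _ = l
  ... | no _  = u ∷ remove p l

  remove-⊆ : ∀ p l {u} → u ∈ remove p l → u ∈ l
  remove-⊆ p (v ∷ l) u∈ with v ≟ᶜ p
  ... | yes _ = there u∈
  remove-⊆ p (v ∷ l) (here eq)  | no _ = here eq
  remove-⊆ p (v ∷ l) (there u∈) | no _ = there (remove-⊆ p l u∈)

  ∈-remove : ∀ p l {u} → u ∈ l → u ≢ p → u ∈ remove p l
  ∈-remove p (v ∷ l) u∈ u≢p with v ≟ᶜ p
  ∈-remove p (v ∷ l) (here refl) u≢p | yes v≡p = contradiction v≡p u≢p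
  ∈-remove p (v ∷ l) (there u∈)  u≢p | yes _   = u∈
  ∈-remove p (v ∷ l) (here refl) u≢p | no _    = here refl
  ∈-remove p (v ∷ l) (there u∈)  u≢p | no _    = there (∈-remove p l u∈ u≢p)

  ∑-remove : ∀ {p l} (f : C → ℕ) → p ∈ l → ∑ l f ≡ f p + ∑ (remove p l) f
  ∑-remove {p} {v ∷ l} f p∈ with v ≟ᶜ p
  ∑-remove {p} {v ∷ l} f p∈           | yes refl = refl
  ∑-remove {p} {v ∷ l} f (here refl)  | no v≢p   = contradiction refl v≢p
  ∑-remove {p} {v ∷ l} f (there p∈)   | no _     = trans (cong (f v +_) (∑-remove f p∈)) (lemma (f v) (f p) _)
    where
    lemma : ∀ a b c → a + (b + c) ≡ b + (a + c)
    lemma = solve-∀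

  length-remove : ∀ {p l} → p ∈ l → length l ≡ suc (length (remove p l))
  length-remove {p} {v ∷ l} p∈ with v ≟ᶜ p
  length-remove {p} {v ∷ l} p∈          | yes _  = refl
  length-remove {p} {v ∷ l} (here refl) | no v≢p = contradiction refl v≢p
  length-remove {p} {v ∷ l} (there p∈)  | no _   = cong suc (length-remove p∈)

-- The type of colours stays general: the classes around a core edge are coloured by
-- `Maybe (Fin n)`, those of complete multipartite hypergraphs by `Fin r`.
module Rainbow {C : Set} (_≟ᶜ_ : (p p′ : C) → Dec (p ≡ p′)) {n : ℕ} (col : Fin n → C) where

  open import Data.List.Membership.DecPropositional _≟ᶜ_ using () renaming (_∈?_ to _∈ᶜ?_)

  Coloured : List C → Subset n → Set
  Coloured l f = ∀ y → y ∈ˢ f → col y ∈ l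

  Injective-on : Subset n → Set
  Injective-on f = ∀ y → y ∈ˢ f → ∀ z → z ∈ˢ f → col y ≡ col z → y ≡ z

  IsRainbow : List C → Subset n → Set
  IsRainbow l f = Coloured l f × Injective-on f

  coloured? : ∀ l f → Dec (Coloured l f)
  coloured? l f = Finₚ.all? (λ y → (y ∈? f) →-dec (col y ∈ᶜ? l))

  rainbow? : ∀ l f → Dec (IsRainbow l f)
  rainbow? l f = coloured? l f ×-dec
    Finₚ.all? (λ y → (y ∈? f) →-dec Finₚ.all? (λ z → (z ∈? f) →-dec ((col y ≟ᶜ col z) →-dec (y ≟ᶠ z))))

  size : C → ℕ
  size p = ∑ (allFin n) (λ x → ind ⌊ col x ≟ᶜ p ⌋)

  rainbow-▹ : ∀ {p l f y} → IsRainbow (p ∷ l) f → y ∈ˢ f → col y ≡ p → IsRainbow l (f ▹ y)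
  rainbow-▹ {p} {l} {f} {y} (coloured , inj) y∈ refl =
    (λ z z∈ → [ (λ eq → contradiction (inj z (▹-⊆ f y z∈) y y∈ eq) (proj₂ (∈-▹⁻ z∈))) , id ] (Any.toSum (coloured z (▹-⊆ f y z∈)))) ,
    (λ z z∈ z′ z′∈ → inj z (▹-⊆ f y z∈) z′ (▹-⊆ f y z′∈))

  rainbow-avoid : ∀ {l f p} → IsRainbow l f → (∀ y → y ∈ˢ f → col y ≢ p) → IsRainbow (remove _≟ᶜ_ p l) f
  rainbow-avoid {l} {p = p} (coloured , inj) avoid = (λ y y∈ → ∈-remove _≟ᶜ_ p l (coloured y y∈) (avoid y y∈)) , inj

  rainbow-size : ∀ l f → IsRainbow l f → ∣ f ∣ ≤ length l
  rainbow-size [] f (coloured , _) = ≤-reflexive (trans (cong ∣_∣ (⊆-antisym {i = f} {⊥} (λ {y} y∈ → case coloured y y∈ of λ ()) ⊥⊆)) (∣⊥∣≡0 n))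
  rainbow-size (p ∷ l) f rb@(coloured , inj) with Finₚ.any? (λ y → (y ∈? f) ×-dec (col y ≟ᶜ p))
  ... | yes (y , y∈ , eq) = ≤-trans (≤-reflexive (∣▹∣ y∈)) (s≤s (rainbow-size l (f ▹ y) (rainbow-▹ rb y∈ eq)))
  ... | no none = m≤n⇒m≤1+n (rainbow-size l f ((λ y y∈ → Any.tail (λ eq → none (y , y∈ , eq)) (coloured y y∈)) , inj))

  all-hit : ∀ l f → Unique l → (∀ p → p ∈ l → ∃ λ y → y ∈ˢ f × col y ≡ p) → length l ≤ ∣ f ∣
  all-hit []      f _         _   = z≤n
  all-hit (p ∷ l) f (p∉ ∷ un) hit with hit p (here refl)
  ... | y , y∈ , refl = ≤-trans (s≤s (all-hit l (f ▹ y) un rest)) (≤-reflexive (sym (∣▹∣ y∈)))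
    where
    rest : ∀ p → p ∈ l → ∃ λ z → z ∈ˢ f ▹ y × col z ≡ p
    rest p p∈ with hit p (there p∈)
    ... | z , z∈ , refl = z , ∈-▹⁺ z∈ (λ { refl → All.lookup p∉ p∈ refl }) , refl

  missed-colour : ∀ l f → Unique l → ∣ f ∣ < length l → ∃ λ p → p ∈ l × (∀ y → y ∈ˢ f → col y ≢ p)
  missed-colour l f un f<l with Any.any? (λ p → ¬? (Finₚ.any? (λ y → (y ∈? f) ×-dec (col y ≟ᶜ p)))) l
  ... | yes found with find found
  ...   | p , p∈ , ¬hit = p , p∈ , λ y y∈ eq → ¬hit (y , y∈ , eq)
  missed-colour l f un f<l | no none = contradiction f<l (≤⇒≯ (all-hit l f un (λ p p∈ →
    decidable-stable (Finₚ.any? (λ y → (y ∈? f) ×-dec (col y ≟ᶜ p))) (λ ¬hit → none (lose p∈ ¬hit)))))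

  #rainbow : List C → ℕ
  #rainbow l = ∑ (subsets n) (λ f → ind ⌊ rainbow? l f ×-dec (∣ f ∣ ≟ length l) ⌋)

  #rainbow-≤ : ∀ l → #rainbow l ≤ product (map size l)
  #rainbow-≤ []      = ≤-trans (∑-mono (subsets n) empty) (count-size n 0)
    where
    empty : ∀ f → ind ⌊ rainbow? [] f ×-dec (∣ f ∣ ≟ 0) ⌋ ≤ ind ⌊ ∣ f ∣ ≟ 0 ⌋
    empty f = ind-mono (λ t → true-⌊⌋ (∣ f ∣ ≟ 0) (proj₂ (⌊⌋-true (rainbow? [] f ×-dec (∣ f ∣ ≟ 0)) t)))
  #rainbow-≤ (p ∷ l) = begin
    #rainbow (p ∷ l)
      ≤⟨ ∑-mono (subsets n) witness ⟩
    ∑ (subsets n) (λ f → ∑ (allFin n) (λ y → ind ⌊ col y ≟ᶜ p ⌋ * (ind (lookup f y) * R (f ▹ y))))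
      ≡⟨ trans (∑-swap (subsets n) (allFin n) _) (∑-cong (allFin n) (λ y → ∑-*ˡ (subsets n) (ind ⌊ col y ≟ᶜ p ⌋) _)) ⟩
    ∑ (allFin n) (λ y → ind ⌊ col y ≟ᶜ p ⌋ * ∑ (subsets n) (λ f → ind (lookup f y) * R (f ▹ y)))
      ≤⟨ ∑-mono (allFin n) (λ y → *-monoʳ-≤ (ind ⌊ col y ≟ᶜ p ⌋) (shift y)) ⟩
    ∑ (allFin n) (λ y → ind ⌊ col y ≟ᶜ p ⌋ * #rainbow l)
      ≡⟨ ∑-*ʳ (allFin n) (#rainbow l) _ ⟩
    size p * #rainbow l
      ≤⟨ *-monoʳ-≤ (size p) (#rainbow-≤ l) ⟩
    size p * product (map size l) ∎
    where
    open ≤-Reasoning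
    R : Subset n → ℕ
    R f = ind ⌊ rainbow? l f ×-dec (∣ f ∣ ≟ length l) ⌋
    shift : ∀ y → ∑ (subsets n) (λ f → ind (lookup f y) * R (f ▹ y)) ≤ #rainbow l
    shift y = ≤-trans (≤-reflexive (∑-∈-shift y (λ f → R (f ▹ y)))) (∑-mono (subsets n) drop)
      where
      drop : ∀ f → ind (not (lookup f y)) * R ((y ◃ f) ▹ y) ≤ R f
      drop f with y ∈? f
      ... | yes y∈ rewrite ∈⇒true y∈ = z≤n
      ... | no y∉ rewrite ∉⇒false y∉ | ◃-▹ y∉ = ≤-reflexive (*-identityˡ (R f))
    witness : ∀ f → ind ⌊ rainbow? (p ∷ l) f ×-dec (∣ f ∣ ≟ suc (length l)) ⌋ ≤ ∑ (allFin n) (λ y → ind ⌊ col y ≟ᶜ p ⌋ * (ind (lookup f y) * R (f ▹ y)))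
    witness f with rainbow? (p ∷ l) f ×-dec (∣ f ∣ ≟ suc (length l))
    ... | no _ = z≤n
    ... | yes (rb@(coloured , inj) , ∣f∣) with Finₚ.any? (λ y → (y ∈? f) ×-dec (col y ≟ᶜ p))
    ...   | no none = contradiction (rainbow-size l f ((λ y y∈ → Any.tail (λ eq → none (y , y∈ , eq)) (coloured y y∈)) , inj)) (<⇒≱ (≤-reflexive (sym ∣f∣)))
    ...   | yes (y , y∈ , eq) = ≤-trans (≤-reflexive one) (∑-term (λ y → ind ⌊ col y ≟ᶜ p ⌋ * (ind (lookup f y) * R (f ▹ y))) (∈-allFin y))
      where
      one : 1 ≡ ind ⌊ col y ≟ᶜ p ⌋ * (ind (lookup f y) * R (f ▹ y))
      one rewrite true-⌊⌋ (col y ≟ᶜ p) eq | ∈⇒true y∈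
        | true-⌊⌋ (rainbow? l (f ▹ y) ×-dec (∣ f ▹ y ∣ ≟ length l)) (rainbow-▹ rb y∈ eq , suc-injective (trans (sym (∣▹∣ y∈)) ∣f∣)) = refl

  sizes-≤ : ∀ {l} → Unique l → ∑ l size ≤ n
  sizes-≤ {l} un = begin
    ∑ l size
      ≡⟨ ∑-swap l (allFin n) _ ⟩
    ∑ (allFin n) (λ x → ∑ l (λ p → ind ⌊ col x ≟ᶜ p ⌋))
      ≤⟨ ∑-mono (allFin n) (λ x → ∑-ind≤1 un (λ p → ⌊ col x ≟ᶜ p ⌋) (λ p p′ _ _ t t′ → trans (sym (⌊⌋-true (col x ≟ᶜ p) t)) (⌊⌋-true (col x ≟ᶜ p′) t′))) ⟩
    ∑ (allFin n) (λ _ → 1)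
      ≡⟨ trans (∑-const (allFin n) 1) (trans (*-identityʳ _) (Listₚ.length-tabulate id)) ⟩
    n ∎
    where open ≤-Reasoning

-- From an almost complete colouring to a proper one

-- For θ = t/q ≤ 1 the assumption says θ^(1/(s+1)) A ≤ B, and θ ≤ θ^(1/(s+1)).
cancel-power : ∀ s t q A B → t ≤ q → t * A ^ suc s ≤ q * B ^ suc s → t * A ≤ q * B
cancel-power s t zero    A B t≤q h rewrite n≤0⇒n≡0 t≤q = z≤n
cancel-power s t q@(suc _) A B t≤q h with t * A ≤? q * B
... | yes p = p
... | no ¬p = contradiction h (<⇒≱ (begin-strict
  q * (B * B ^ s)    ≡⟨ sym (*-assoc q B (B ^ s)) ⟩
  q * B * B ^ s      ≤⟨ *-monoʳ-≤ (q * B) (^-monoˡ-≤ s (<⇒≤ B<A)) ⟩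
  q * B * A ^ s      <⟨ *-monoˡ-< (A ^ s) {{m^n≢0 A s {{>-nonZero (≤-trans (s≤s z≤n) B<A)}}}} (≰⇒> ¬p) ⟩
  t * A * A ^ s      ≡⟨ *-assoc t A (A ^ s) ⟩
  t * (A * A ^ s)    ∎))
  where
  open ≤-Reasoning
  B<A : B < A
  B<A = *-cancelˡ-< q B A (≤-trans (≰⇒> ¬p) (*-monoˡ-≤ A t≤q))

-- In the following lemmas t = q − κ and t₂ = q − κ₂, with κ₂ = s² κ.
part-bound : ∀ s n q κ t R P a b → q ≡ κ + t → R ≡ suc (suc s) ^ suc s → a + b ≤ n → suc s ^ suc s * P ≤ b ^ suc s →
  t * n ^ suc s ≤ R * q * P → q * suc (suc s) * a ≤ (q + κ * suc s) * n
part-bound s n q κ t R P a b refl refl ab≤n amgm dense = ≤-by _ _ 0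
    (+-mono-≤ (cancel-power s t (κ + t) (suc s * n) (suc (suc s) * b) (m≤n+m t κ) powered) (*-monoʳ-≤ ((κ + t) * suc (suc s)) ab≤n))
    (lemma s n κ t a b)
  where
  lemma : ∀ s n κ t a b → (κ + t) * suc (suc s) * a + ((κ + t) * (suc (suc s) * b) + (κ + t) * suc (suc s) * n) + 0
    ≡ (κ + t + κ * suc s) * n + (t * (suc s * n) + (κ + t) * suc (suc s) * (a + b))
  lemma = solve-∀
  -- Through `cancel-power` this bounds the total size b of the other classes from below by (t/q)
  -- (s+1) n/(s+2), and therefore a from above.
  powered : t * (suc s * n) ^ suc s ≤ (κ + t) * (suc (suc s) * b) ^ suc s
  powered = begin
    t * (suc s * n) ^ suc s
      ≡⟨ trans (cong (t *_) (^-distribʳ-* (suc s) (suc s) n)) (lemma₁ t (suc s ^ suc s) (n ^ suc s)) ⟩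
    suc s ^ suc s * (t * n ^ suc s)
      ≤⟨ *-monoʳ-≤ (suc s ^ suc s) dense ⟩
    suc s ^ suc s * (suc (suc s) ^ suc s * (κ + t) * P)
      ≡⟨ lemma₂ (suc s ^ suc s) (suc (suc s) ^ suc s) (κ + t) P ⟩
    (κ + t) * (suc (suc s) ^ suc s * (suc s ^ suc s * P))
      ≤⟨ *-monoʳ-≤ (κ + t) (*-monoʳ-≤ (suc (suc s) ^ suc s) amgm) ⟩
    (κ + t) * (suc (suc s) ^ suc s * b ^ suc s)
      ≡⟨ cong ((κ + t) *_) (sym (^-distribʳ-* (suc s) (suc (suc s)) b)) ⟩
    (κ + t) * (suc (suc s) * b) ^ suc s ∎
    where
    open ≤-Reasoning
    lemma₁ : ∀ a b c → a * (b * c) ≡ b * (a * c)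
    lemma₁ = solve-∀
    lemma₂ : ∀ a b c d → a * (b * c * d) ≡ c * (b * (a * d))
    lemma₂ = solve-∀

product-bound : {C : Set} (a : C → ℕ) (c M : ℕ) (l : List C) → (∀ {p} → p ∈ l → c * a p ≤ M) →
  c ^ length l * product (map a l) ≤ M ^ length l
product-bound a c M []      h = ≤-refl
product-bound a c M (p ∷ l) h = ≤-trans (≤-reflexive (lemma c (c ^ length l) (a p) (product (map a l))))
  (*-mono-≤ (h (here refl)) (product-bound a c M l (h ∘ there)))
  where
  lemma : ∀ c d x y → c * d * (x * y) ≡ c * x * (d * y)
  lemma = solve-∀

-- When s classes have at most (1 + κ s/q) n/r vertices each, the product of their sizes is at most
-- (1 + κ s/q)^s (n/r)^s, and `bernoulli` bounds the first factor by q/(q - s²κ) = q/t₂.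
transversal-bound : ∀ s n q κ t₂ r R P → 1 ≤ q → q ≡ s * (κ * s) + t₂ → R ≡ r ^ s → (q * r) ^ s * P ≤ ((q + κ * s) * n) ^ s →
  t₂ * (R * P) ≤ q * n ^ s
transversal-bound s n q κ t₂ r R P q≥1 q≡ refl h = *-cancelˡ-≤ (q ^ s) {{m^n≢0 q s {{>-nonZero q≥1}}}} (begin
  q ^ s * (t₂ * (r ^ s * P))
    ≡⟨ lemma₁ (q ^ s) t₂ (r ^ s) P ⟩
  t₂ * (q ^ s * r ^ s * P)
    ≤⟨ *-monoʳ-≤ t₂ (≤-trans (≤-reflexive (cong (_* P) (sym (^-distribʳ-* s q r)))) (≤-trans h (≤-reflexive (^-distribʳ-* s (q + κ * s) n)))) ⟩
  t₂ * ((q + κ * s) ^ s * n ^ s)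
    ≡⟨ sym (*-assoc t₂ _ (n ^ s)) ⟩
  t₂ * (q + κ * s) ^ s * n ^ s
    ≤⟨ *-monoˡ-≤ (n ^ s) power ⟩
  q * q ^ s * n ^ s
    ≡⟨ lemma₂ q (q ^ s) (n ^ s) ⟩
  q ^ s * (q * n ^ s) ∎)
  where
  open ≤-Reasoning
  lemma₁ : ∀ a b c d → a * (b * (c * d)) ≡ b * (a * c * d)
  lemma₁ = solve-∀
  lemma₂ : ∀ a b c → a * b * c ≡ b * (a * c)
  lemma₂ = solve-∀
  p = (q + κ * s) ^ s
  power : t₂ * p ≤ q * q ^ s
  power = ≤-by (t₂ * p) (q * q ^ s) 0 (bernoulli q (κ * s) s)
    (trans (lemma₃ t₂ p (q * q ^ s) s κ) (cong (λ z → q * q ^ s + z * p) (sym q≡)))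
    where
    lemma₃ : ∀ t p a s κ → t * p + (a + s * (κ * s * p)) + 0 ≡ a + (s * (κ * s) + t) * p
    lemma₃ = solve-∀

-- Up to relative errors κ/q and κ₂/q one has d ≥ P/r and d′ ≥ P, so d + d′ exceeds P by a constant
-- proportion. The value of q gives (r + 1) t t₂ ≥ r q² + q, and the surplus q pays for r Y as soon
-- as n > R q r².
overlap-bound : ∀ r n Y R q κ κ₂ t t₂ P d d′ → 1 ≤ Y → q ≡ κ + t → q ≡ κ₂ + t₂ → q ≡ suc (suc r * (κ + κ₂)) →
  t * (n * Y) ≤ R * q * (r * d) → t * (n * Y) ≤ R * q * d′ → t₂ * (R * P) ≤ q * (n * Y) → R * q * (r * r) < n →
  P + r * Y < d + d′
overlap-bound r n Y R q κ κ₂ t t₂ P d d′ Y≥1 q≡t q≡t₂ q≡ hd hd′ hP n> with d + d′ ≤? P + r * Y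
... | no ¬p = ≰⇒> ¬p
... | yes small = contradiction n≤ (<⇒≱ n>)
  where
  open ≤-Reasoning
  A = n * Y
  both : suc r * (t * t₂) * A ≤ q * (q * r * A + R * q * (r * r) * Y)
  both = begin
    suc r * (t * t₂) * A
      ≡⟨ lemma₁ r t t₂ A ⟩
    t₂ * (t * A) + r * t₂ * (t * A)
      ≤⟨ +-mono-≤ (*-monoʳ-≤ t₂ hd) (*-monoʳ-≤ (r * t₂) hd′) ⟩
    t₂ * (R * q * (r * d)) + r * t₂ * (R * q * d′)
      ≡⟨ lemma₂ t₂ R q r d d′ ⟩
    R * q * r * t₂ * (d + d′)
      ≤⟨ *-monoʳ-≤ (R * q * r * t₂) small ⟩
    R * q * r * t₂ * (P + r * Y)
      ≡⟨ lemma₃ R q r t₂ P Y ⟩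
    q * r * (t₂ * (R * P)) + t₂ * (R * q * (r * r) * Y)
      ≤⟨ +-mono-≤ (*-monoʳ-≤ (q * r) hP) (*-monoˡ-≤ (R * q * (r * r) * Y) (≤-trans (m≤n+m t₂ κ₂) (≤-reflexive (sym q≡t₂)))) ⟩
    q * r * (q * A) + q * (R * q * (r * r) * Y)
      ≡⟨ lemma₄ q r A (R * q * (r * r) * Y) ⟩
    q * (q * r * A + R * q * (r * r) * Y) ∎
    where
    lemma₁ : ∀ r t t₂ A → suc r * (t * t₂) * A ≡ t₂ * (t * A) + r * t₂ * (t * A)
    lemma₁ = solve-∀
    lemma₂ : ∀ t₂ R q r d d′ → t₂ * (R * q * (r * d)) + r * t₂ * (R * q * d′) ≡ R * q * r * t₂ * (d + d′)
    lemma₂ = solve-∀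
    lemma₃ : ∀ R q r t₂ P Y → R * q * r * t₂ * (P + r * Y) ≡ q * r * (t₂ * (R * P)) + t₂ * (R * q * (r * r) * Y)
    lemma₃ = solve-∀
    lemma₄ : ∀ q r A B → q * r * (q * A) + q * B ≡ q * (q * r * A + B)
    lemma₄ = solve-∀
  square : q * q ≤ t * t₂ + (κ + κ₂) * q
  square = ≤-trans (m≤m+n (q * q) (κ * κ₂)) (≤-reflexive (begin-equality
    q * q + κ * κ₂
      ≡⟨ cong₂ (λ a b → a * b + κ * κ₂) q≡t q≡t₂ ⟩
    (κ + t) * (κ₂ + t₂) + κ * κ₂
      ≡⟨ lemma κ t κ₂ t₂ ⟩
    t * t₂ + (κ * (κ₂ + t₂) + κ₂ * (κ + t))
      ≡⟨ cong₂ (λ a b → t * t₂ + (κ * a + κ₂ * b)) (sym q≡t₂) (sym q≡t) ⟩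
    t * t₂ + (κ * q + κ₂ * q)
      ≡⟨ cong (λ z → t * t₂ + z) (sym (*-distribʳ-+ q κ κ₂)) ⟩
    t * t₂ + (κ + κ₂) * q ∎))
    where
    lemma : ∀ κ t κ₂ t₂ → (κ + t) * (κ₂ + t₂) + κ * κ₂ ≡ t * t₂ + (κ * (κ₂ + t₂) + κ₂ * (κ + t))
    lemma = solve-∀
  m = suc r * (κ + κ₂)
  reduced : q * A ≤ q * (R * q * (r * r) * Y)
  reduced = ≤-by _ _ 0 (+-mono-≤ both (*-monoʳ-≤ (suc r * A) square)) (begin-equality
    q * A + (q * (q * r * A + E) + suc r * A * (t * t₂ + (κ + κ₂) * q)) + 0
      ≡⟨ lemma q A r E (t * t₂) (κ + κ₂) ⟩
    q * E + (suc r * (t * t₂) * A + q * A * (q * r + suc m))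
      ≡⟨ cong (λ z → q * E + (suc r * (t * t₂) * A + q * A * (q * r + z))) (sym q≡) ⟩
    q * E + (suc r * (t * t₂) * A + q * A * (q * r + q))
      ≡⟨ lemma′ q A r E (t * t₂) ⟩
    q * E + (suc r * (t * t₂) * A + suc r * A * (q * q)) ∎)
    where
    E = R * q * (r * r) * Y
    lemma : ∀ q A r E u κ → q * A + (q * (q * r * A + E) + suc r * A * (u + κ * q)) + 0
      ≡ q * E + (suc r * u * A + q * A * (q * r + suc (suc r * κ)))
    lemma = solve-∀
    lemma′ : ∀ q A r E u → q * E + (suc r * u * A + q * A * (q * r + q)) ≡ q * E + (suc r * u * A + suc r * A * (q * q))
    lemma′ = solve-∀
  n≤ : n ≤ R * q * (r * r)
  n≤ = *-cancelʳ-≤ _ _ Y {{>-nonZero Y≥1}} (*-cancelˡ-≤ q {{>-nonZero (subst (1 ≤_) (sym q≡) (s≤s z≤n))}} reduced)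

pigeonhole : {C : Set} (g : C → ℕ) (l : List C) → 1 ≤ length l → ∃ λ p → p ∈ l × ∑ l g ≤ length l * g p
pigeonhole g (p ∷ [])        _ = p , here refl , ≤-refl
pigeonhole g (p ∷ l@(_ ∷ _)) _ with pigeonhole g l (s≤s z≤n)
... | p′ , p′∈ , le with ≤-total (g p) (g p′)
...   | inj₁ p≤ = p′ , there p′∈ , +-mono-≤ p≤ le
...   | inj₂ ≤p = p , here refl , +-monoʳ-≤ (g p) (≤-trans le (*-monoʳ-≤ (length l) ≤p))

module Cleanup {C : Set} (_≟ᶜ_ : (p p′ : C) → Dec (p ≡ p′)) {n : ℕ} (s′ : ℕ) (G : Subset n → Bool)
  (uni : ∀ S → G S ≡ true → ∣ S ∣ ≡ suc (suc s′)) {k} (free : FFree (suc (suc s′)) k G) (k≥1 : 1 ≤ k)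
  (R : ℕ) (R≡ : R ≡ suc (suc s′) ^ suc s′)
  (col : Fin n → C) (ls : List C) (un : Unique ls) (∣ls∣ : length ls ≡ suc (suc s′)) where

  private
    s r : ℕ
    s = suc s′
    r = suc s
  open Rainbow _≟ᶜ_ col public

  adjacent : Fin n → Subset n → Bool
  adjacent z f = not (lookup f z) ∧ G (z ◃ f)

  adjacent⁻ : ∀ {z f} → adjacent z f ≡ true → z ∉ˢ f × G (z ◃ f) ≡ true
  adjacent⁻ {z} {f} t = false⇒∉ (not-true (proj₁ (∧-true {not (lookup f z)} t))) , proj₂ (∧-true {not (lookup f z)} t)

  adjacent-size : ∀ {z f} → adjacent z f ≡ true → ∣ f ∣ ≡ s
  adjacent-size t with adjacent⁻ t
  ... | z∉ , g = suc-injective (trans (sym (∣◃∣ z∉)) (uni _ g))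

  D : Fin n → ℕ
  D z = ∑ (subsets n) (λ f → ind (⌊ coloured? ls f ⌋ ∧ adjacent z f))

  -- Counts the links f of z for which z ∪ f would be a transversal of the classes if z had the
  -- colour p.
  d : C → Fin n → ℕ
  d p z = ∑ (subsets n) (λ f → ind (⌊ rainbow? (remove _≟ᶜ_ p ls) f ⌋ ∧ adjacent z f))

  NotCovered : Fin n → Fin n → Set
  NotCovered z z′ = ∀ S → G S ≡ true → z ∈ˢ S → z′ ∈ˢ S → Empty

  length-rest : ∀ {p} → p ∈ ls → length (remove _≟ᶜ_ p ls) ≡ s
  length-rest p∈ = suc-injective (trans (sym (length-remove _≟ᶜ_ p∈)) ∣ls∣)

  -- z ∪ f, z′ ∪ f and an edge through z, z′ disjoint from f form a tent with i = 1.
  common-link-meets : ∀ {z z′ S f} → z ≢ z′ → G S ≡ true → z ∈ˢ S → z′ ∈ˢ S → adjacent z f ≡ true → adjacent z′ f ≡ true →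
    ∃ λ x → x ∈ˢ S × x ∈ˢ f
  common-link-meets {z} {z′} {S} {f} z≢z′ gS z∈S z′∈S a a′ with Finₚ.any? (λ x → (x ∈? S) ×-dec (x ∈? f))
  ... | yes found = found
  ... | no none with extend S (z′ ∷ z ∷ []) ((≢-sym z≢z′ ∷ []) ∷ [] ∷ []) (λ { (here refl) → z′∈S ; (there (here refl)) → z∈S })
    where
    ≢-sym : ∀ {x y : Fin n} → x ≢ y → y ≢ x
    ≢-sym x≢y refl = x≢y refl
  ...   | P , (z′∉ ∷ z∉ ∷ unP) , eqP , ∣P∣ = ⊥-elim (free 1 ≤-refl k≥1
      (Embed.contains (z ∷ []) (elems f) P [] z′ s′ 0 refl (trans (length-elems f) (adjacent-size a)) ∣P∣′ refl G unique
        (trans (cong (λ T → G (z ◃ T)) (toSet-elems f)) (proj₂ (adjacent⁻ a)))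
        (trans (cong G (trans (toSet-≡ {l = z ∷ P ++ z′ ∷ []} {m = z′ ∷ z ∷ P} fwd bwd) eqP)) gS)
        (trans (cong G (trans (toSet-≡ {l = elems f ++ z′ ∷ []} {m = z′ ∷ elems f} fwd′ bwd′) (cong (z′ ◃_) (toSet-elems f)))) (proj₂ (adjacent⁻ a′)))))
    where
    ∣P∣′ : length P ≡ s′
    ∣P∣′ = suc-injective (suc-injective (trans (sym ∣P∣) (uni S gS)))
    P⊆S : ∀ {x} → x ∈ P → x ∈ˢ S
    P⊆S x∈ = subst (_ ∈ˢ_) eqP (∈-toSet⁺ {l = z′ ∷ z ∷ P} (there (there x∈)))
    fwd : ∀ {x} → x ∈ z ∷ P ++ z′ ∷ [] → x ∈ z′ ∷ z ∷ P
    fwd (here refl) = there (here refl)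
    fwd (there x∈) with ∈-++⁻ P x∈
    ... | inj₁ p           = there (there p)
    ... | inj₂ (here refl) = here refl
    bwd : ∀ {x} → x ∈ z′ ∷ z ∷ P → x ∈ z ∷ P ++ z′ ∷ []
    bwd (here refl)         = there (∈-++⁺ʳ P (here refl))
    bwd (there (here refl)) = here refl
    bwd (there (there p))   = there (∈-++⁺ˡ p)
    fwd′ : ∀ {x} → x ∈ elems f ++ z′ ∷ [] → x ∈ z′ ∷ elems f
    fwd′ x∈ with ∈-++⁻ (elems f) x∈
    ... | inj₁ p           = there p
    ... | inj₂ (here refl) = here refl
    bwd′ : ∀ {x} → x ∈ z′ ∷ elems f → x ∈ elems f ++ z′ ∷ []
    bwd′ (here refl) = ∈-++⁺ʳ (elems f) (here refl)
    bwd′ (there p)   = ∈-++⁺ˡ p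
    un-Pz′ : Unique (P ++ z′ ∷ [])
    un-Pz′ = Uniqueₚ.++⁺ unP ([] ∷ []) λ { (p , here refl) → All.lookup z′∉ (there p) refl }
    un-fPz′ : Unique (elems f ++ P ++ z′ ∷ [])
    un-fPz′ = Uniqueₚ.++⁺ (elems-unique f) un-Pz′ disjoint
      where
      disjoint : ∀ {x} → ¬ (x ∈ elems f × x ∈ P ++ z′ ∷ [])
      disjoint {x} (p , q) with ∈-++⁻ P q
      ... | inj₁ q′          = none (x , P⊆S q′ , ∈-elems⁻ p)
      ... | inj₂ (here refl) = proj₁ (adjacent⁻ a′) (∈-elems⁻ p)
    unique : Unique (z ∷ elems f ++ P ++ z′ ∷ [])
    unique = All.tabulate fresh ∷ un-fPz′
      where
      fresh : ∀ {x} → x ∈ elems f ++ P ++ z′ ∷ [] → z ≢ x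
      fresh x∈ refl with ∈-++⁻ (elems f) x∈
      ... | inj₁ p = proj₁ (adjacent⁻ a) (∈-elems⁻ p)
      ... | inj₂ p with ∈-++⁻ P p
      ...   | inj₁ p′          = All.lookup z∉ p′ refl
      ...   | inj₂ (here refl) = z≢z′ refl

  -- By inclusion and exclusion z and z′ have more than r n^s′ common links of the kind counted by
  -- `d p`. An edge through z and z′ would meet all of them, but its r vertices lie in at most r
  -- n^s′ sets of size s.
  uncovered : ∀ {z z′ p} → z ≢ z′ → p ∈ ls → #rainbow (remove _≟ᶜ_ p ls) + r * n ^ s′ < d p z + d p z′ → NotCovered z z′
  uncovered {z} {z′} {p} z≢z′ p∈ many S gS z∈ z′∈ = contradiction few (<⇒≱ many)
    where
    open ≤-Reasoning
    l = remove _≟ᶜ_ p ls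
    meet : Fin n → Subset n → Bool
    meet x f = lookup f x ∧ ⌊ ∣ f ∣ ≟ s ⌋
    pointwise : ∀ f → ind (⌊ rainbow? l f ⌋ ∧ adjacent z f) + ind (⌊ rainbow? l f ⌋ ∧ adjacent z′ f)
      ≤ ind ⌊ rainbow? l f ×-dec (∣ f ∣ ≟ length l) ⌋ + ∑ (allFin n) (λ x → ind (lookup S x) * ind (meet x f))
    pointwise f with rainbow? l f
    ... | no _ = z≤n
    ... | yes rb with adjacent z f in a | adjacent z′ f in a′
    ...   | false | false = z≤n
    ...   | true  | false = ≤-trans (≤-reflexive (cong ind (sym (true-⌊⌋ (yes rb ×-dec (∣ f ∣ ≟ length l)) (rb , trans (adjacent-size a) (sym (length-rest p∈))))))) (m≤m+n _ _)
    ...   | false | true  = ≤-trans (≤-reflexive (cong ind (sym (true-⌊⌋ (yes rb ×-dec (∣ f ∣ ≟ length l)) (rb , trans (adjacent-size a′) (sym (length-rest p∈))))))) (m≤m+n _ _)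
    ...   | true  | true  = +-mono-≤ (≤-reflexive (cong ind (sym (true-⌊⌋ (yes rb ×-dec (∣ f ∣ ≟ length l)) (rb , trans (adjacent-size a) (sym (length-rest p∈)))))))
        (hit (common-link-meets z≢z′ gS z∈ z′∈ a a′))
      where
      hit : (∃ λ x → x ∈ˢ S × x ∈ˢ f) → 1 ≤ ∑ (allFin n) (λ x → ind (lookup S x) * ind (meet x f))
      hit (x , x∈S , x∈f) = ≤-trans (≤-reflexive one) (∑-term (λ x → ind (lookup S x) * ind (meet x f)) (∈-allFin x))
        where
        one : 1 ≡ ind (lookup S x) * ind (meet x f)
        one rewrite ∈⇒true x∈S | ∈⇒true x∈f | true-⌊⌋ (∣ f ∣ ≟ s) (adjacent-size a) = refl
    through : ∀ x → ∑ (subsets n) (ind ∘ meet x) ≤ n ^ s′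
    through x = count-⊇ (x ◃ ⊥) s′ (meet x) (λ f t → ◃-⊆ (true⇒∈ (proj₁ (∧-true {lookup f x} t))) ⊥⊆ ,
      trans (⌊⌋-true (∣ f ∣ ≟ s) (proj₂ (∧-true {lookup f x} t))) (cong (_+ s′) (sym (trans (∣◃∣ {x = x} ∉⊥) (cong suc (∣⊥∣≡0 n))))))
    few : d p z + d p z′ ≤ #rainbow l + r * n ^ s′
    few = begin
      d p z + d p z′
        ≡⟨ sym (∑-+ (subsets n) _ _) ⟩
      ∑ (subsets n) (λ f → ind (⌊ rainbow? l f ⌋ ∧ adjacent z f) + ind (⌊ rainbow? l f ⌋ ∧ adjacent z′ f))
        ≤⟨ ∑-mono (subsets n) pointwise ⟩
      ∑ (subsets n) (λ f → ind ⌊ rainbow? l f ×-dec (∣ f ∣ ≟ length l) ⌋ + ∑ (allFin n) (λ x → ind (lookup S x) * ind (meet x f)))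
        ≡⟨ trans (∑-+ (subsets n) _ _) (cong (#rainbow l +_) (trans (∑-swap (subsets n) (allFin n) _) (∑-cong (allFin n) (λ x → ∑-*ˡ (subsets n) (ind (lookup S x)) _)))) ⟩
      #rainbow l + ∑ (allFin n) (λ x → ind (lookup S x) * ∑ (subsets n) (ind ∘ meet x))
        ≤⟨ +-monoʳ-≤ (#rainbow l) (∑-mono (allFin n) (λ x → *-monoʳ-≤ (ind (lookup S x)) (through x))) ⟩
      #rainbow l + ∑ (allFin n) (λ x → ind (lookup S x) * n ^ s′)
        ≡⟨ cong (#rainbow l +_) (trans (∑-*ʳ (allFin n) (n ^ s′) _) (cong (_* n ^ s′) (trans (∣∣-sum S) (uni S gS)))) ⟩
      #rainbow l + r * n ^ s′ ∎

  module _ (q κ κ₂ t t₂ : ℕ) (κ₂≡ : κ₂ ≡ s * (κ * s)) (q≡t : q ≡ κ + t) (q≡t₂ : q ≡ κ₂ + t₂) (q≡ : q ≡ suc (suc r * (κ + κ₂)))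
    (n-large : R * q * (r * r) < n) (t≥1 : 1 ≤ t)
    (class-degree : ∀ x → col x ∈ ls → t * n ^ s ≤ R * q * d (col x) x)
    (coloured-degree : ∀ z → t * n ^ s ≤ R * q * D z) where

    private
      n≥1 : 1 ≤ n
      n≥1 = ≤-trans (s≤s z≤n) n-large

    positive : ∀ m → t * n ^ s ≤ R * q * m → 0 < m
    positive zero    h = contradiction (≤-trans h (≤-reflexive (*-zeroʳ (R * q)))) (<⇒≱ (*-mono-≤ t≥1 (>-nonZero⁻¹ (n ^ s) {{m^n≢0 n s {{>-nonZero n≥1}}}})))
    positive (suc m) _ = s≤s z≤n

    module _ (z₀ : Fin n) where

      some-class : ∃ λ y → col y ∈ ls
      some-class with ∑-pos (subsets n) _ (positive (D z₀) (coloured-degree z₀))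
      ... | f , _ , pos with ⌊ coloured? ls f ⌋ in c | adjacent z₀ f in a
      ...   | true | true with elems f in ef
      ...     | y ∷ _ = y , ⌊⌋-true (coloured? ls f) c y (∈-elems⁻ (subst (y ∈_) (sym ef) (here refl)))
      ...     | []    with () ← trans (sym (adjacent-size a)) (trans (sym (length-elems f)) (cong length ef))

      -- A link counted by `d` is a full transversal of the other classes, so one coloured vertex
      -- leads to vertices of all colours. In `size-bound` a vertex of the class is the source of
      -- the degree condition.
      class-inhabited : ∀ p → p ∈ ls → ∃ λ x → col x ≡ p
      class-inhabited p p∈ with some-class
      ... | y , y∈ with p ≟ᶜ col y
      ...   | yes eq = y , sym eq
      ...   | no p≢ with ∑-pos (subsets n) _ (positive (d (col y) y) (class-degree y y∈))
      ...     | f , _ , pos with rainbow? (remove _≟ᶜ_ (col y) ls) f | adjacent y f in a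
      ...       | yes rb | true with Finₚ.any? (λ x → (x ∈? f) ×-dec (col x ≟ᶜ p))
      ...         | yes (x , _ , eq) = x , eq
      ...         | no none = contradiction (rainbow-size _ f (rainbow-avoid rb (λ x x∈ eq → none (x , x∈ , eq))))
                      (<⇒≱ (≤-reflexive (trans (sym (length-remove _≟ᶜ_ (∈-remove _≟ᶜ_ (col y) ls p∈ p≢))) (trans (length-rest y∈) (sym (adjacent-size a))))))

      d≤#rainbow : ∀ p x → p ∈ ls → d p x ≤ #rainbow (remove _≟ᶜ_ p ls)
      d≤#rainbow p x p∈ = ∑-mono (subsets n) step
        where
        l = remove _≟ᶜ_ p ls
        step : ∀ f → ind (⌊ rainbow? l f ⌋ ∧ adjacent x f) ≤ ind ⌊ rainbow? l f ×-dec (∣ f ∣ ≟ length l) ⌋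
        step f with rainbow? l f
        ... | no _   = z≤n
        ... | yes rb = ind-mono (λ a → true-⌊⌋ (yes rb ×-dec (∣ f ∣ ≟ length l)) (rb , trans (adjacent-size a) (sym (length-rest p∈))))

      size-bound : ∀ p → p ∈ ls → q * r * size p ≤ (q + κ * s) * n
      size-bound p p∈ with class-inhabited p p∈
      ... | x , refl = part-bound s′ n q κ t R P (size p) b q≡t R≡ (≤-trans (≤-reflexive (sym (∑-remove _≟ᶜ_ size p∈))) (sizes-≤ un)) amgm
        (≤-trans (class-degree x p∈) (*-monoʳ-≤ (R * q) (≤-trans (d≤#rainbow p x p∈) (#rainbow-≤ l))))
        where
        l = remove _≟ᶜ_ p ls
        P = product (map size l)
        b = ∑ l size
        amgm : s ^ s * P ≤ b ^ s
        amgm = subst (λ m → m ^ m * P ≤ b ^ m) (trans (Listₚ.length-map size l) (length-rest p∈)) (am-gm (map size l))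

      #rainbow-bound : ∀ p → p ∈ ls → t₂ * (R * #rainbow (remove _≟ᶜ_ p ls)) ≤ q * n ^ s
      #rainbow-bound p p∈ = transversal-bound s n q κ t₂ r R _ (subst (1 ≤_) (sym q≡) (s≤s z≤n)) (trans q≡t₂ (cong (_+ t₂) κ₂≡)) R≡
        (≤-trans (*-monoʳ-≤ ((q * r) ^ s) (#rainbow-≤ l))
          (subst (λ m → (q * r) ^ m * product (map size l) ≤ ((q + κ * s) * n) ^ m) (length-rest p∈)
            (product-bound size (q * r) ((q + κ * s) * n) l (λ u∈ → size-bound _ (remove-⊆ _≟ᶜ_ p ls u∈)))))
        where
        l = remove _≟ᶜ_ p ls

    -- The degree of z may be smaller by the factor r: `choice` supplies only this much before the
    -- coloured links of z are known to avoid its class.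
    heavy : ∀ {z z′ p} → z ≢ z′ → p ∈ ls → t * n ^ s ≤ R * q * (r * d p z) → t * n ^ s ≤ R * q * d p z′ → NotCovered z z′
    heavy {z} {z′} {p} z≢z′ p∈ h h′ = uncovered z≢z′ p∈ (overlap-bound r n (n ^ s′) R q κ κ₂ t t₂ _ (d p z) (d p z′)
      (>-nonZero⁻¹ (n ^ s′) {{m^n≢0 n s′ {{>-nonZero n≥1}}}}) q≡t q≡t₂ q≡ h h′ (#rainbow-bound z p p∈) n-large)

    weaken : ∀ m → R * q * m ≤ R * q * (r * m)
    weaken m = *-monoʳ-≤ (R * q) (m≤n*m m r)

    class-independent : ∀ {x x′} → x ≢ x′ → col x ∈ ls → col x ≡ col x′ → NotCovered x x′
    class-independent {x} {x′} x≢ x∈ eq = heavy x≢ x∈ (≤-trans (class-degree x x∈) (weaken (d (col x) x)))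
      (subst (λ p → t * n ^ s ≤ R * q * d p x′) (sym eq) (class-degree x′ (subst (_∈ ls) eq x∈)))

    link-rainbow : ∀ {z f} → Coloured ls f → adjacent z f ≡ true → IsRainbow ls f
    link-rainbow {z} {f} c a = c , inj
      where
      inj : Injective-on f
      inj y y∈ y′ y′∈ eq = decidable-stable (y ≟ᶠ y′) (λ y≢ →
        class-independent y≢ (c y y∈) eq (z ◃ f) (proj₂ (adjacent⁻ a)) (∈-◃-there z y∈) (∈-◃-there z y′∈))

    -- A coloured link has r - 1 vertices and so misses one of the r colours; p is a colour for
    -- which `d p z` is largest.
    choice : ∀ z → ∃ λ p → p ∈ ls × D z ≤ r * d p z
    choice z with pigeonhole (λ p → d p z) ls (subst (1 ≤_) (sym ∣ls∣) (s≤s z≤n))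
    ... | p , p∈ , le = p , p∈ , ≤-trans split (≤-trans le (≤-reflexive (cong (_* d p z) ∣ls∣)))
      where
      split : D z ≤ ∑ ls (λ p → d p z)
      split = ≤-trans (∑-mono (subsets n) step) (≤-reflexive (∑-swap (subsets n) ls _))
        where
        step : ∀ f → ind (⌊ coloured? ls f ⌋ ∧ adjacent z f) ≤ ∑ ls (λ p → ind (⌊ rainbow? (remove _≟ᶜ_ p ls) f ⌋ ∧ adjacent z f))
        step f with coloured? ls f
        ... | no _ = z≤n
        ... | yes c with adjacent z f in a
        ...   | false = z≤n
        ...   | true with missed-colour ls f un (≤-reflexive (trans (cong suc (adjacent-size a)) (sym ∣ls∣)))
        ...     | p′ , p′∈ , avoid = ∑-ind≥1 ls (λ p → ⌊ rainbow? (remove _≟ᶜ_ p ls) f ⌋ ∧ true) p′∈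
                    (∧-intro (true-⌊⌋ (rainbow? (remove _≟ᶜ_ p′ ls) f) (rainbow-avoid (link-rainbow c a) avoid)) refl)

    newcol : Fin n → C
    newcol z = proj₁ (choice z)

    newcol∈ : ∀ z → newcol z ∈ ls
    newcol∈ z = proj₁ (proj₂ (choice z))

    newcol-degree : ∀ z → t * n ^ s ≤ R * q * (r * d (newcol z) z)
    newcol-degree z = ≤-trans (coloured-degree z) (*-monoʳ-≤ (R * q) (proj₂ (proj₂ (choice z))))

    -- A coloured link of z that contains a vertex y of colour `newcol z` would put z and y into a
    -- common edge, which `heavy` excludes. This regains the factor r lost in `choice`.
    D≤d : ∀ z → D z ≤ d (newcol z) z
    D≤d z = ∑-mono (subsets n) step
      where
      p = newcol z
      step : ∀ f → ind (⌊ coloured? ls f ⌋ ∧ adjacent z f) ≤ ind (⌊ rainbow? (remove _≟ᶜ_ p ls) f ⌋ ∧ adjacent z f)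
      step f with coloured? ls f
      ... | no _ = z≤n
      ... | yes c with adjacent z f in a
      ...   | false = z≤n
      ...   | true = ≤-reflexive (cong ind (sym (∧-intro (true-⌊⌋ (rainbow? (remove _≟ᶜ_ p ls) f) (rainbow-avoid (link-rainbow c a) avoid)) refl)))
        where
        avoid : ∀ y → y ∈ˢ f → col y ≢ p
        avoid y y∈ eq = heavy {z} {y} {p} (λ { refl → proj₁ (adjacent⁻ a) y∈ }) (newcol∈ z) (newcol-degree z)
          (subst (λ p → t * n ^ s ≤ R * q * d p y) eq (class-degree y (c y y∈)))
          (z ◃ f) (proj₂ (adjacent⁻ a)) (∈-◃-here z f) (∈-◃-there z y∈)

    newcol-proper : ∀ {z z′} → z ≢ z′ → newcol z ≡ newcol z′ → NotCovered z z′
    newcol-proper {z} {z′} z≢ eq = heavy z≢ (newcol∈ z) (newcol-degree z)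
      (subst (λ p → t * n ^ s ≤ R * q * d p z′) (sym eq) (≤-trans (coloured-degree z′) (*-monoʳ-≤ (R * q) (D≤d z′))))

-- Large minimum degree forces r-partiteness

degree : ∀ {n} → (Subset n → Bool) → Fin n → ℕ
degree {n} G x = ∑ (subsets n) (λ S → ind (lookup S x) * ind (G S))

degree-sum : ∀ {n} r (G : Subset n → Bool) → (∀ S → G S ≡ true → ∣ S ∣ ≡ r) → ∑ (allFin n) (degree G) ≡ r * ∑ (subsets n) (ind ∘ G)
degree-sum {n} r G uni = trans (∑-swap (allFin n) (subsets n) _) (trans (∑-cong (subsets n) each) (∑-*ˡ (subsets n) r (ind ∘ G)))
  where
  each : ∀ S → ∑ (allFin n) (λ x → ind (lookup S x) * ind (G S)) ≡ r * ind (G S)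
  each S with G S in g
  ... | false = trans (∑-zero (allFin n) (λ x → *-zeroʳ (ind (lookup S x)))) (sym (*-zeroʳ r))
  ... | true  = trans (∑-*ʳ (allFin n) 1 _) (cong (_* 1) (trans (∣∣-sum S) (uni S g)))

degree-link : ∀ {n} (G : Subset n → Bool) x → degree G x ≡ ∑ (subsets n) (λ f → ind (not (lookup f x) ∧ G (x ◃ f)))
degree-link {n} G x = trans (∑-∈-shift x (ind ∘ G)) (∑-cong (subsets n) (λ f → sym (ind-∧ (not (lookup f x)) (G (x ◃ f)))))

power-shift : ∀ n b a j → n ≡ a + b → n ^ suc j ≤ a ^ suc j + suc j * (b * n ^ j)
power-shift n b a j refl = power-increment a b j

module Constants (s′ : ℕ) where

  private
    s r : ℕ
    s = suc s′
    r = suc s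

  abstract
    R C κ κ₂ q′ q t t₂ K lossy B threshold : ℕ
    R  = r ^ s
    C  = r + r
    -- In units of n^s / q, `degree-estimate` loses at most 2R for links with uncoloured vertices, R
    -- for lost edges and 1 for terms of lower order.
    κ  = suc (3 * R)
    κ₂ = s * (κ * s)
    -- Chosen for `overlap-bound`, where (r + 1)(κ + κ₂) must be q - 1.
    q′ = suc r * (κ + κ₂)
    q  = suc q′
    t  = q ∸ κ
    t₂ = q ∸ κ₂
    K  = r ^ r
    -- The coefficient of n^s in `core-large`: the first summand stems from the lost edges, the
    -- second from replacing n by a multiple of r.
    lossy = K * (C * suc r) + r * r
    B  = q * (r * (C * suc r))
    -- The sum of the lower bounds on n that are extracted below as `big₁` to `big₅`.
    threshold = r + (R * q * (r * r) + (lossy * suc (q * q * q) + (q * (s * r) + q * B)))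

    R≡ : R ≡ r ^ s
    R≡ = refl

    K≡ : K ≡ r ^ r
    K≡ = refl

    C≡ : C ≡ r + r
    C≡ = refl

    κ≡ : κ ≡ suc (3 * R)
    κ≡ = refl

    κ₂≡ : κ₂ ≡ s * (κ * s)
    κ₂≡ = refl

    q≡suc-q′ : q ≡ suc q′
    q≡suc-q′ = refl

    q≡ : q ≡ suc (suc r * (κ + κ₂))
    q≡ = refl

    lossy≡ : lossy ≡ K * (C * suc r) + r * r
    lossy≡ = refl

    B≡ : B ≡ q * (r * (C * suc r))
    B≡ = refl

    threshold≡ : threshold ≡ r + (R * q * (r * r) + (lossy * suc (q * q * q) + (q * (s * r) + q * B)))
    threshold≡ = refl

    q≡κ+t : q ≡ κ + t
    q≡κ+t = sym (m+[n∸m]≡n (≤-trans (m≤m+n κ κ₂) (≤-trans (m≤n*m (κ + κ₂) (suc r)) (n≤1+n q′))))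

    q≡κ₂+t₂ : q ≡ κ₂ + t₂
    q≡κ₂+t₂ = sym (m+[n∸m]≡n (≤-trans (m≤n+m κ₂ κ) (≤-trans (m≤n*m (κ + κ₂) (suc r)) (n≤1+n q′))))

    t≥1 : 1 ≤ t
    t≥1 = m<n⇒0<n∸m (s≤s (≤-trans (m≤m+n κ κ₂) (m≤n*m (κ + κ₂) (suc r))))

  q≥1 : 1 ≤ q
  q≥1 = subst (1 ≤_) (sym q≡suc-q′) (s≤s z≤n)

module MinDegree {n : ℕ} (s′ k l : ℕ) (G : Subset n → Bool) (uni : ∀ S → G S ≡ true → ∣ S ∣ ≡ suc (suc s′))
  (free : FFree (suc (suc s′)) k G) (r≡ : k + l ≡ suc (suc s′)) (k≥1 : 1 ≤ k)
  (tail≤ : Σ₁ l (λ i → reciprocals (suc (suc s′) !) (k + i)) ≤ suc (suc s′) !) where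

  open Constants s′ public

  private
    s r : ℕ
    s = suc s′
    r = suc s

  open Robust r G uni C

  module _ (large : threshold < n) (m : ℕ) (n≤ : n ≤ r * suc m) (edges : m ^ r ≤ ∑ (subsets n) (ind ∘ G))
    (min-degree : ∀ z → m ^ s ≤ degree G z) where

    private
      large′ : r + (R * q * (r * r) + (lossy * suc (q * q * q) + (q * (s * r) + q * B))) < n
      large′ = subst (_< n) threshold≡ large
      big₁ : r ≤ n
      big₁ = ≤-trans (m≤m+n r _) (<⇒≤ large′)
      rest₁ : R * q * (r * r) + (lossy * suc (q * q * q) + (q * (s * r) + q * B)) < n
      rest₁ = ≤-trans (s≤s (m≤n+m _ r)) large′
      big₂ : R * q * (r * r) < n
      big₂ = ≤-trans (s≤s (m≤m+n (R * q * (r * r)) _)) rest₁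
      rest₂ : lossy * suc (q * q * q) + (q * (s * r) + q * B) < n
      rest₂ = ≤-trans (s≤s (m≤n+m _ (R * q * (r * r)))) rest₁
      big₃ : lossy * suc (q * q * q) < n
      big₃ = ≤-trans (s≤s (m≤m+n (lossy * suc (q * q * q)) _)) rest₂
      rest₃ : q * (s * r) + q * B < n
      rest₃ = ≤-trans (s≤s (m≤n+m _ (lossy * suc (q * q * q)))) rest₂
      big₄ : q * (s * r) ≤ n
      big₄ = ≤-trans (m≤m+n (q * (s * r)) _) (<⇒≤ rest₃)
      big₅ : q * B ≤ n
      big₅ = ≤-trans (m≤n+m (q * B) (q * (s * r))) (<⇒≤ rest₃)
      n≥1 : 1 ≤ n
      n≥1 = ≤-trans (s≤s z≤n) large
      Y : ℕ
      Y = n ^ s′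

    #lost : ℕ
    #lost = ∑ (subsets n) (ind ∘ lost)

    #lost-≤ : #lost ≤ C * suc r * n ^ s
    #lost-≤ = *-cancelʳ-≤ _ _ n {{>-nonZero n≥1}} (≤-trans count-lost (≤-reflexive (lemma C (suc r) n (n ^ s))))
      where
      lemma : ∀ a b n p → a * (b * (n * p)) ≡ a * b * p * n
      lemma = solve-∀

    n∸r≤rm : n ∸ r ≤ r * m
    n∸r≤rm = ≤-trans (∸-monoˡ-≤ r (≤-trans n≤ (≤-reflexive (*-suc r m)))) (≤-reflexive (m+n∸m≡n r (r * m)))

    power-≤ : ∀ j → n ^ suc j ≤ r ^ suc j * m ^ suc j + suc j * (r * n ^ j)
    power-≤ j = ≤-trans (power-shift n r (n ∸ r) j (sym (m∸n+n≡m big₁))) (+-monoˡ-≤ _ (≤-trans (^-monoˡ-≤ (suc j) n∸r≤rm) (≤-reflexive (^-distribʳ-* (suc j) r m))))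

    #core : ℕ
    #core = ∑ (subsets n) (ind ∘ core)

    core-large : n ^ r ≤ K * #core + lossy * n ^ s
    core-large = begin
      n ^ r
        ≤⟨ power-≤ s ⟩
      r ^ r * m ^ r + r * (r * n ^ s)
        ≡⟨ cong (λ z → z * m ^ r + r * (r * n ^ s)) (sym K≡) ⟩
      K * m ^ r + r * (r * n ^ s)
        ≤⟨ +-monoˡ-≤ _ (*-monoʳ-≤ K (≤-trans edges (≤-trans (≤-reflexive (trans (∑-cong (subsets n) G-split) (∑-+ (subsets n) _ _))) (+-monoʳ-≤ #core #lost-≤)))) ⟩
      K * (#core + C * suc r * n ^ s) + r * (r * n ^ s)
        ≡⟨ lemma K #core (C * suc r) (n ^ s) r ⟩
      K * #core + (K * (C * suc r) + r * r) * n ^ s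
        ≡⟨ cong (λ z → K * #core + z * n ^ s) (sym lossy≡) ⟩
      K * #core + lossy * n ^ s ∎
      where
      open ≤-Reasoning
      lemma : ∀ a c b p r → a * (c + b * p) + r * (r * p) ≡ a * c + (a * b + r * r) * p
      lemma = solve-∀

    open Stability s core core-size (no-core-tent free (≤-reflexive (sym C≡))) l r≡ k≥1 tail≤

    -- Otherwise `few-edges` makes the core fall short of (n/r)^r by the proportion 1/(q³ + 1),
    -- which exceeds the error `lossy * n ^ s` of `core-large` once n is greater than lossy (q³ +
    -- 1).
    good-edge : ∃ λ E → core E ≡ true × q′ * n < q * ∑ (elems E) (λ v → L (E ▹ v))
    good-edge with anySubset? (λ E → (core E ≟ᵇ true) ×-dec (q′ * n <? q * ∑ (elems E) (λ v → L (E ▹ v))))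
    ... | yes found = found
    ... | no none = contradiction n≤small (<⇒≱ big₃)
      where
      few : K * #core * suc (q * q * q) ≤ n ^ r * (q * q * q)
      few = subst₂ (λ K q → K * #core * suc (q * q * q) ≤ n ^ r * (q * q * q)) (sym K≡) (sym q≡suc-q′)
        (few-edges q′ (λ S c → subst (λ q → q * ∑ (elems S) (λ v → L (S ▹ v)) ≤ q′ * n) q≡suc-q′ (≮⇒≥ (λ lt → none (S , c , lt)))))
      n≤small : n ≤ lossy * suc (q * q * q)
      n≤small = *-cancelʳ-≤ n (lossy * suc (q * q * q)) (n ^ s) {{m^n≢0 n s {{>-nonZero n≥1}}}}
        (≤-by (n * n ^ s) (lossy * suc (q * q * q) * n ^ s) 0 (+-mono-≤ few (*-monoʳ-≤ (suc (q * q * q)) core-large))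
          (lemma (n * n ^ s) (q * q * q) (K * #core) lossy (n ^ s)))
        where
        lemma : ∀ A c x y p → A + (A * c + suc c * (x + y * p)) + 0 ≡ y * suc c * p + (x * suc c + suc c * A)
        lemma = solve-∀

    module FromEdge (E : Subset n) (coreE : core E ≡ true) (rich : q′ * n < q * ∑ (elems E) (λ v → L (E ▹ v))) where

      ∣E▹∣ : ∀ {v} → v ∈ˢ E → ∣ E ▹ v ∣ ≡ s
      ∣E▹∣ v∈ = suc-injective (trans (sym (∣▹∣ v∈)) (core-size coreE))

      tent-from : ∀ x T w {S₂ S₃} → x ∉ˢ T → ∣ T ∣ ≡ s → core (x ◃ T) ≡ true → w ∉ˢ x ◃ T →
        core S₂ ≡ true → w ∈ˢ S₂ → x ∈ˢ S₂ → core S₃ ≡ true → w ∈ˢ S₃ → T ⊆ˢ S₃ → Empty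
      tent-from x T w x∉ ∣T∣ c w∉ c₂ w∈S₂ x∈S₂ c₃ w∈S₃ T⊆S₃ = no-core-tent free (≤-reflexive (sym C≡)) (x ∷ []) (elems T) w
        (All.tabulate (λ y∈ x≡y → x∉ (∈-elems⁻ (subst (_∈ elems T) (sym x≡y) y∈))) ∷ elems-unique T)
        (trans (cong (λ S → core (x ◃ S)) (toSet-elems T)) c) ≤-refl k≥1 (subst (1 ≤_) (sym (trans (length-elems T) ∣T∣)) (s≤s z≤n))
        (λ w∈ → w∉ (subst (λ S → w ∈ˢ x ◃ S) (toSet-elems T) (∈-toSet⁺ w∈)))
        c₂ w∈S₂ (λ { (here refl) → x∈S₂ }) c₃ w∈S₃ (λ y∈ → T⊆S₃ (∈-elems⁻ y∈))

      Extension : Fin n → Subset n → Set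
      Extension x T = x ∉ˢ T × ∃ λ S → core S ≡ true × x ◃ T ⊆ˢ S

      -- If v and v′ were distinct, x would be the apex of a tent image over E split into v′ and E -
      -- v′: the extension of E - v contains v′, the other one E - v′.
      links-disjoint-at-E : ∀ {v v′ x} → v ∈ˢ E → v′ ∈ˢ E → link (E ▹ v) x ≡ true → link (E ▹ v′) x ≡ true → v ≡ v′
      links-disjoint-at-E {v} {v′} {x} v∈ v′∈ a a′ = decidable-stable (v ≟ᶠ v′) (absurd (link⁻ {E ▹ v} a) (link⁻ {E ▹ v′} a′))
        where
        absurd : Extension x (E ▹ v) → Extension x (E ▹ v′) → ¬ v ≢ v′
        absurd (x∉ , S , c , ⊆S) (x∉′ , S′ , c′ , ⊆S′) v≢ =
          tent-from v′ (E ▹ v′) x (∉-▹-here v′ E) (∣E▹∣ v′∈) (trans (cong core (▹-◃ v′∈)) coreE) (x∉E (x ≟ᶠ v))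
            c (⊆S (∈-◃-here x _)) (⊆S (∈-◃-there x (∈-▹⁺ v′∈ (λ eq → v≢ (sym eq))))) c′ (⊆S′ (∈-◃-here x _)) (λ p → ⊆S′ (∈-◃-there x p))
          where
          x∉E : Dec (x ≡ v) → x ∉ˢ v′ ◃ (E ▹ v′)
          x∉E (yes refl) x∈ = x∉′ (∈-▹⁺ (subst (x ∈ˢ_) (▹-◃ v′∈) x∈) v≢)
          x∉E (no x≢v)   x∈ = x∉ (∈-▹⁺ (subst (x ∈ˢ_) (▹-◃ v′∈) x∈) x≢v)

      -- The set x ∪ (E - v) is itself a core edge, split into x and E - v. A vertex y ≠ x would be
      -- an apex over x by the edge S and over E - v by its own extension.
      link-independent : ∀ {v x y S} → v ∈ˢ E → link (E ▹ v) x ≡ true → link (E ▹ v) y ≡ true → core S ≡ true → x ∈ˢ S → y ∈ˢ S → x ≡ y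
      link-independent {v} {x} {y} {S} v∈ a a′ c x∈ y∈ = decidable-stable (x ≟ᶠ y) (absurd (link⁻ {E ▹ v} a) (link⁻ {E ▹ v} a′))
        where
        absurd : Extension x (E ▹ v) → Extension y (E ▹ v) → ¬ x ≢ y
        absurd (x∉ , S₁ , c₁ , ⊆S₁) (y∉ , S₃ , c₃ , ⊆S₃) x≢ = tent-from x (E ▹ v) y x∉ (∣E▹∣ v∈)
          (trans (cong core (⊆∣≡∣⇒≡ ⊆S₁ (≤-reflexive (trans (core-size c₁) (sym (trans (∣◃∣ x∉) (cong suc (∣E▹∣ v∈)))))))) c₁)
          (λ y∈′ → [ (λ y≡x → x≢ (sym y≡x)) , y∉ ] (∈-◃⁻ y∈′))
          c y∈ x∈ c₃ (⊆S₃ (∈-◃-here y _)) (λ p → ⊆S₃ (∈-◃-there y p))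

      -- Vertices in so many lost edges that their degree in the core may be far below their degree
      -- in G.
      bad : Fin n → Bool
      bad x = ⌊ n ^ s <? q * degree lost x ⌋

      linked? : ∀ x → Dec (∃ λ v → v ∈ˢ E × link (E ▹ v) x ≡ true)
      linked? x = Finₚ.any? (λ v → (v ∈? E) ×-dec (link (E ▹ v) x ≟ᵇ true))

      class? : ∀ x → Dec (bad x ≡ false × ∃ λ v → v ∈ˢ E × link (E ▹ v) x ≡ true)
      class? x = (bad x ≟ᵇ false) ×-dec linked? x

      ls : List (Maybe (Fin n))
      ls = map just (elems E)

      ls-unique : Unique ls
      ls-unique = Uniqueₚ.map⁺ just-injective (elems-unique E)

      ∣ls∣ : length ls ≡ r
      ∣ls∣ = trans (Listₚ.length-map just (elems E)) (trans (length-elems E) (core-size coreE))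

      abstract
        -- The class of v consists of the vertices extending E - v that are not bad; `nothing` lies
        -- outside `ls` and marks all remaining vertices.
        col : Fin n → Maybe (Fin n)
        col x with class? x
        ... | yes (_ , v , _) = just v
        ... | no _            = nothing

        col⁻ : ∀ x → col x ∈ ls → ∃ λ v → col x ≡ just v × v ∈ˢ E × link (E ▹ v) x ≡ true × bad x ≡ false
        col⁻ x x∈ with class? x
        ... | yes (b , v , v∈ , a) = v , refl , v∈ , a , b
        ... | no _ with ∈-map⁻ just x∈
        ...   | _ , _ , ()

        col⁺ : ∀ x → bad x ≡ false → (∃ λ v → v ∈ˢ E × link (E ▹ v) x ≡ true) → col x ∈ ls
        col⁺ x b lk with class? x
        ... | yes (_ , v , v∈ , _) = ∈-map⁺ just (∈-elems⁺ v∈)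
        ... | no ¬c                = contradiction (b , lk) ¬c

      open Cleanup (Maybeₚ.≡-dec _≟ᶠ_) s′ G uni free k≥1 R R≡ col ls ls-unique ∣ls∣

      -- The edge x ∪ f belongs to the core, where `link-independent` forbids two vertices of one
      -- class in an edge.
      core-link-rainbow : ∀ {x f} → (x∈ : col x ∈ ls) → core (x ◃ f) ≡ true → x ∉ˢ f → Coloured ls f →
        IsRainbow (remove (Maybeₚ.≡-dec _≟ᶠ_) (col x) ls) f
      core-link-rainbow {x} {f} x∈ c x∉ coloured = rainbow-avoid (coloured , inj) avoid
        where
        same : ∀ {y z} → col y ∈ ls → col y ≡ col z → y ∈ˢ x ◃ f → z ∈ˢ x ◃ f → y ≡ z
        same {y} {z} y∈ls eq y∈ z∈ with col⁻ y y∈ls | col⁻ z (subst (_∈ ls) eq y∈ls)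
        ... | v , ey , v∈ , a , _ | v′ , ez , _ , a′ , _ = link-independent v∈ a
          (subst (λ u → link (E ▹ u) z ≡ true) (sym (just-injective (trans (sym ey) (trans eq ez)))) a′) c y∈ z∈
        inj : Injective-on f
        inj y y∈ z z∈ eq = same (coloured y y∈) eq (∈-◃-there x y∈) (∈-◃-there x z∈)
        avoid : ∀ y → y ∈ˢ f → col y ≢ col x
        avoid y y∈ eq = x∉ (subst (_∈ˢ f) (same (coloured y y∈) eq (∈-◃-there x y∈) (∈-◃-here x f)) y∈)

      coloured : Fin n → Bool
      coloured y = ⌊ Any.any? (Maybeₚ.≡-dec _≟ᶠ_ (col y)) ls ⌋

      Z : ℕ
      Z = ∑ V (ind ∘ not ∘ coloured)

      -- Such a link contains one of the Z uncoloured vertices, and each vertex lies in at most n^s′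
      -- sets of size s.
      uncoloured-links : ∀ z → ∑ (subsets n) (λ f → ind (not ⌊ coloured? ls f ⌋ ∧ adjacent z f)) ≤ Z * Y
      uncoloured-links z = begin
        ∑ (subsets n) (λ f → ind (not ⌊ coloured? ls f ⌋ ∧ adjacent z f))
          ≤⟨ ∑-mono (subsets n) hit ⟩
        ∑ (subsets n) (λ f → ∑ V (λ y → ind (not (coloured y)) * ind (lookup f y ∧ ⌊ ∣ f ∣ ≟ s ⌋)))
          ≡⟨ trans (∑-swap (subsets n) V _) (∑-cong V (λ y → ∑-*ˡ (subsets n) (ind (not (coloured y))) _)) ⟩
        ∑ V (λ y → ind (not (coloured y)) * ∑ (subsets n) (λ f → ind (lookup f y ∧ ⌊ ∣ f ∣ ≟ s ⌋)))
          ≤⟨ ∑-mono V (λ y → *-monoʳ-≤ (ind (not (coloured y))) (through y)) ⟩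
        ∑ V (λ y → ind (not (coloured y)) * Y)
          ≡⟨ ∑-*ʳ V Y _ ⟩
        Z * Y ∎
        where
        open ≤-Reasoning
        through : ∀ x → ∑ (subsets n) (λ f → ind (lookup f x ∧ ⌊ ∣ f ∣ ≟ s ⌋)) ≤ Y
        through x = count-⊇ (x ◃ ⊥) s′ (λ f → lookup f x ∧ ⌊ ∣ f ∣ ≟ s ⌋) (λ f t → ◃-⊆ (true⇒∈ (proj₁ (∧-true {lookup f x} t))) ⊥⊆ ,
          trans (⌊⌋-true (∣ f ∣ ≟ s) (proj₂ (∧-true {lookup f x} t))) (cong (_+ s′) (sym (trans (∣◃∣ {x = x} ∉⊥) (cong suc (∣⊥∣≡0 n))))))
        hit : ∀ f → ind (not ⌊ coloured? ls f ⌋ ∧ adjacent z f) ≤ ∑ V (λ y → ind (not (coloured y)) * ind (lookup f y ∧ ⌊ ∣ f ∣ ≟ s ⌋))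
        hit f with coloured? ls f
        ... | yes _ = z≤n
        ... | no ¬c with adjacent z f in a
        ...   | false = z≤n
        ...   | true with Finₚ.any? (λ y → (y ∈? f) ×-dec (coloured y ≟ᵇ false))
        ...     | yes (y , y∈ , u) = ≤-trans (≤-reflexive one) (∑-term (λ y → ind (not (coloured y)) * ind (lookup f y ∧ ⌊ ∣ f ∣ ≟ s ⌋)) (∈-allFin y))
          where
          one : 1 ≡ ind (not (coloured y)) * ind (lookup f y ∧ ⌊ ∣ f ∣ ≟ s ⌋)
          one rewrite u | ∈⇒true y∈ | true-⌊⌋ (∣ f ∣ ≟ s) (adjacent-size a) = refl
        ...     | no none = ⊥-elim (¬c (λ y y∈ → decidable-stable (Any.any? (Maybeₚ.≡-dec _≟ᶠ_ (col y)) ls)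
                    (λ ¬p → none (y , y∈ , ¬true (λ t → ¬p (⌊⌋-true (Any.any? (Maybeₚ.≡-dec _≟ᶠ_ (col y)) ls) t))))))

      -- Double counting: a bad vertex lies in more than n^s / q lost edges, there are at most C (r
      -- + 1) n^s of these, and each has r vertices.
      bad-count : ∑ V (ind ∘ bad) ≤ B
      bad-count = *-cancelʳ-≤ _ B (n ^ s) {{m^n≢0 n s {{>-nonZero n≥1}}}} (begin
        ∑ V (ind ∘ bad) * n ^ s                ≡⟨ sym (∑-*ʳ V (n ^ s) _) ⟩
        ∑ V (λ x → ind (bad x) * n ^ s)        ≤⟨ ∑-mono V each ⟩
        ∑ V (λ x → q * degree lost x)          ≡⟨ trans (∑-*ˡ V q _) (cong (q *_) (degree-sum r lost (λ S t → uni S (lost⇒G t)))) ⟩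
        q * (r * #lost)                        ≤⟨ *-monoʳ-≤ q (*-monoʳ-≤ r #lost-≤) ⟩
        q * (r * (C * suc r * n ^ s))          ≡⟨ trans (lemma q r (C * suc r) (n ^ s)) (cong (_* n ^ s) (sym B≡)) ⟩
        B * n ^ s                              ∎)
        where
        open ≤-Reasoning
        lemma : ∀ q r c p → q * (r * (c * p)) ≡ q * (r * c) * p
        lemma = solve-∀
        each : ∀ x → ind (bad x) * n ^ s ≤ q * degree lost x
        each x with n ^ s <? q * degree lost x
        ... | no _   = z≤n
        ... | yes lt = ≤-trans (≤-reflexive (*-identityˡ _)) (<⇒≤ lt)

      -- The sets of vertices extending E - v for v in E are disjoint and, by the choice of E,
      -- contain more than (1 - 1/q) n vertices altogether.
      unlinked : q * ∑ V (λ x → ind (not ⌊ linked? x ⌋)) ≤ n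
      unlinked = <⇒≤ (+-cancelʳ-< (q′ * n) _ n (begin-strict
        q * U + q′ * n                                        <⟨ +-monoʳ-< (q * U) rich ⟩
        q * U + q * ∑ (elems E) (λ v → L (E ▹ v))             ≡⟨ sym (*-distribˡ-+ q U _) ⟩
        q * (U + ∑ (elems E) (λ v → L (E ▹ v)))               ≡⟨ cong (λ z → q * (U + z)) (∑-swap (elems E) V _) ⟩
        q * (U + ∑ V (λ x → ∑ (elems E) (λ v → ind (link (E ▹ v) x))))  ≡⟨ cong (q *_) (sym (∑-+ V _ _)) ⟩
        q * ∑ V (λ x → ind (not ⌊ linked? x ⌋) + ∑ (elems E) (λ v → ind (link (E ▹ v) x)))  ≤⟨ *-monoʳ-≤ q (∑-mono V each) ⟩
        q * ∑ V (λ _ → 1)                                     ≡⟨ cong₂ _*_ q≡suc-q′ (trans (∑-const V 1) (trans (*-identityʳ _) (Listₚ.length-tabulate id))) ⟩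
        suc q′ * n                                            ∎))
        where
        open ≤-Reasoning
        U : ℕ
        U = ∑ V (λ x → ind (not ⌊ linked? x ⌋))
        each : ∀ x → ind (not ⌊ linked? x ⌋) + ∑ (elems E) (λ v → ind (link (E ▹ v) x)) ≤ 1
        each x with linked? x
        ... | yes _ = ∑-ind≤1 (elems-unique E) (λ v → link (E ▹ v) x) (λ v v′ v∈ v′∈ a a′ → links-disjoint-at-E (∈-elems⁻ v∈) (∈-elems⁻ v′∈) a a′)
        ... | no ¬l = s≤s (≤-trans (∑-mono-∈ (elems E) {g = λ _ → 0} (λ v v∈ → none v v∈)) (≤-reflexive (∑-zero (elems E) (λ _ → refl))))
          where
          none : ∀ v → v ∈ elems E → ind (link (E ▹ v) x) ≤ 0
          none v v∈ with link (E ▹ v) x in a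
          ... | false = z≤n
          ... | true  = ⊥-elim (¬l (v , ∈-elems⁻ v∈ , a))

      Z-≤ : q * Z ≤ 2 * n
      Z-≤ = begin
        q * Z                                                         ≤⟨ *-monoʳ-≤ q (∑-mono V each) ⟩
        q * ∑ V (λ x → ind (not ⌊ linked? x ⌋) + ind (bad x))         ≡⟨ trans (cong (q *_) (∑-+ V _ _)) (*-distribˡ-+ q _ _) ⟩
        q * ∑ V (λ x → ind (not ⌊ linked? x ⌋)) + q * ∑ V (ind ∘ bad) ≤⟨ +-mono-≤ unlinked (≤-trans (*-monoʳ-≤ q bad-count) big₅) ⟩
        n + n                                                         ≡⟨ cong (n +_) (sym (+-identityʳ n)) ⟩
        2 * n                                                         ∎
        where
        open ≤-Reasoning
        each : ∀ x → ind (not (coloured x)) ≤ ind (not ⌊ linked? x ⌋) + ind (bad x)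
        each x = ind-partition split
          where
          split : not (coloured x) ≡ true → not ⌊ linked? x ⌋ ≡ true ⊎ bad x ≡ true
          split u with ⌊ linked? x ⌋ ≟ᵇ true | bad x ≟ᵇ true
          ... | no ¬l | _      = inj₁ (not-false (¬true ¬l))
          ... | yes _ | yes b  = inj₂ b
          ... | yes t | no ¬b  = ⊥-elim (true≢false (true-⌊⌋ (Any.any? (Maybeₚ.≡-dec _≟ᶠ_ (col x)) ls) (col⁺ x (¬true ¬b) (⌊⌋-true (linked? x) t))) (not-true u))

      -- From n^s ≤ R m^s + s r Y and the minimum degree m^s: the terms R Z Y, R w and s r Y are at
      -- most 2R, R and 1 times n^s / q, together κ n^s / q, and t = q - κ.
      degree-estimate : ∀ z u w → degree G z ≤ u + Z * Y + w → q * w ≤ n ^ s → t * n ^ s ≤ R * q * u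
      degree-estimate z u w deg qw = ≤-by (t * n ^ s) (R * q * u) 0
        (+-mono-≤ (*-monoʳ-≤ q (≤-trans (≤-trans (power-≤ s′) (≤-reflexive (cong (λ z → z * m ^ s + s * (r * Y)) (sym R≡)))) (+-monoˡ-≤ (s * (r * Y)) (*-monoʳ-≤ R (≤-trans (min-degree z) deg)))))
          (+-mono-≤ (*-monoʳ-≤ (R * Y) Z-≤) (+-mono-≤ (*-monoʳ-≤ R qw) (*-monoˡ-≤ Y big₄))))
        (trans (lemma t n Y q R u Z w s r) (cong (λ z → R * q * u + (z * (n * Y) + (R * Y * (q * Z) + (R * (q * w) + q * (s * r) * Y))))
          (trans (cong (_+ t) (sym κ≡)) (sym q≡κ+t))))
        where
        lemma : ∀ t n Y q R u Z w s r →
          t * (n * Y) + (q * (R * (u + Z * Y + w) + s * (r * Y)) + (R * Y * (2 * n) + (R * (n * Y) + n * Y))) + 0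
          ≡ R * q * u + ((suc (3 * R) + t) * (n * Y) + (R * Y * (q * Z) + (R * (q * w) + q * (s * r) * Y)))
        lemma = solve-∀

      coloured-degree : ∀ z → t * n ^ s ≤ R * q * D z
      -- All edges of G through z are counted here, including the lost ones; hence w = 0, and z may
      -- be a bad vertex.
      coloured-degree z = degree-estimate z (D z) 0 (≤-trans (≤-reflexive (degree-link G z)) (begin
          ∑ (subsets n) (λ f → ind (adjacent z f))
            ≤⟨ ∑-mono (subsets n) split ⟩
          ∑ (subsets n) (λ f → ind (⌊ coloured? ls f ⌋ ∧ adjacent z f) + ind (not ⌊ coloured? ls f ⌋ ∧ adjacent z f))
            ≡⟨ ∑-+ (subsets n) _ _ ⟩
          D z + ∑ (subsets n) (λ f → ind (not ⌊ coloured? ls f ⌋ ∧ adjacent z f))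
            ≤⟨ +-monoʳ-≤ (D z) (uncoloured-links z) ⟩
          D z + Z * Y
            ≡⟨ sym (+-identityʳ _) ⟩
          D z + Z * Y + 0 ∎)) (≤-trans (≤-reflexive (*-zeroʳ q)) z≤n)
        where
        open ≤-Reasoning
        split : ∀ f → ind (adjacent z f) ≤ ind (⌊ coloured? ls f ⌋ ∧ adjacent z f) + ind (not ⌊ coloured? ls f ⌋ ∧ adjacent z f)
        split f with ⌊ coloured? ls f ⌋
        ... | true  = m≤m+n _ 0
        ... | false = ≤-refl

      class-degree : ∀ x → col x ∈ ls → t * n ^ s ≤ R * q * d (col x) x
      class-degree x x∈ with col⁻ x x∈
      ... | v , _ , _ , _ , b = degree-estimate x (d (col x) x) (degree lost x) (begin
          degree G x
            ≡⟨ trans (∑-cong (subsets n) (λ S → trans (cong (ind (lookup S x) *_) (G-split S)) (*-distribˡ-+ (ind (lookup S x)) _ _))) (∑-+ (subsets n) _ _) ⟩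
          degree core x + degree lost x
            ≤⟨ +-monoˡ-≤ (degree lost x) (≤-trans (≤-reflexive (degree-link core x)) (≤-trans (∑-mono (subsets n) split)
                 (≤-trans (≤-reflexive (∑-+ (subsets n) _ _)) (+-monoʳ-≤ (d (col x) x) (uncoloured-links x))))) ⟩
          d (col x) x + Z * Y + degree lost x ∎) (≮⇒≥ (λ lt → true≢false (true-⌊⌋ (n ^ s <? q * degree lost x) lt) b))
        where
        open ≤-Reasoning
        split : ∀ f → ind (not (lookup f x) ∧ core (x ◃ f)) ≤ ind (⌊ rainbow? (remove (Maybeₚ.≡-dec _≟ᶠ_) (col x) ls) f ⌋ ∧ adjacent x f) + ind (not ⌊ coloured? ls f ⌋ ∧ adjacent x f)
        split f = ind-partition go
          where
          go : not (lookup f x) ∧ core (x ◃ f) ≡ true → ⌊ rainbow? (remove (Maybeₚ.≡-dec _≟ᶠ_) (col x) ls) f ⌋ ∧ adjacent x f ≡ true ⊎ not ⌊ coloured? ls f ⌋ ∧ adjacent x f ≡ true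
          go t with ∧-true {not (lookup f x)} t | coloured? ls f
          ... | x∉ , c | no _  = inj₂ (∧-intro x∉ (core⇒G c))
          ... | x∉ , c | yes co = inj₁ (∧-intro (true-⌊⌋ (rainbow? (remove (Maybeₚ.≡-dec _≟ᶠ_) (col x) ls) f) (core-link-rainbow x∈ c (false⇒∉ (not-true x∉)) co)) (∧-intro x∉ (core⇒G c)))

      colouring-from : ∃ λ (c : Fin n → Fin r) → ∀ {z z′} → z ≢ z′ → c z ≡ c z′ → NotCovered z z′
      colouring-from = (λ z → subst Fin ∣ls∣ (Any.index (nc∈ z))) , λ z≢ eq →
        newcol-proper q κ κ₂ t t₂ κ₂≡ q≡κ+t q≡κ₂+t₂ q≡ big₂ t≥1 class-degree coloured-degree z≢ (same _ _ (subst-injective ∣ls∣ eq))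
        where
        nc : Fin n → Maybe (Fin n)
        nc = newcol q κ κ₂ t t₂ κ₂≡ q≡κ+t q≡κ₂+t₂ q≡ big₂ t≥1 class-degree coloured-degree
        nc∈ : ∀ z → nc z ∈ ls
        nc∈ = newcol∈ q κ κ₂ t t₂ κ₂≡ q≡κ+t q≡κ₂+t₂ q≡ big₂ t≥1 class-degree coloured-degree
        subst-injective : ∀ {m m′} (e : m ≡ m′) {i j : Fin m} → subst Fin e i ≡ subst Fin e j → i ≡ j
        subst-injective refl h = h
        same : ∀ z z′ → Any.index (nc∈ z) ≡ Any.index (nc∈ z′) → nc z ≡ nc z′
        same z z′ eq = trans (Anyₚ.lookup-index (nc∈ z)) (trans (cong (List.lookup ls) eq) (sym (Anyₚ.lookup-index (nc∈ z′))))

    proper-colouring : ∃ λ (c : Fin n → Fin r) → ∀ {z z′} → z ≢ z′ → c z ≡ c z′ → ∀ S → G S ≡ true → z ∈ˢ S → z′ ∈ˢ S → Empty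
    proper-colouring = FromEdge.colouring-from (proj₁ good-edge) (proj₁ (proj₂ good-edge)) (proj₂ (proj₂ good-edge))

-- Complete multipartite hypergraphs

∑-punchIn : ∀ {n} (w : Fin (suc n)) (h : Fin (suc n) → ℕ) →
  ∑ (allFin (suc n)) h ≡ h w + ∑ (allFin n) (h ∘ punchIn w)
∑-punchIn {n} zero          h = ∑-allFin n h
∑-punchIn {suc n} (suc w) h = begin
  ∑ (allFin (suc (suc n))) h
    ≡⟨ ∑-allFin (suc n) h ⟩
  h zero + ∑ (allFin (suc n)) (h ∘ suc)
    ≡⟨ cong (h zero +_) (∑-punchIn w (h ∘ suc)) ⟩
  h zero + (h (suc w) + ∑ (allFin n) (h ∘ suc ∘ punchIn w))
    ≡⟨ lemma (h zero) (h (suc w)) _ ⟩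
  h (suc w) + (h zero + ∑ (allFin n) (h ∘ suc ∘ punchIn w))
    ≡⟨ cong (h (suc w) +_) (sym (∑-allFin n (h ∘ punchIn (suc w)))) ⟩
  h (suc w) + ∑ (allFin (suc n)) (h ∘ punchIn (suc w)) ∎
  where
  open ≡-Reasoning
  lemma : ∀ a b c → a + (b + c) ≡ b + (a + c)
  lemma = solve-∀

module _ {A : Set} (_≟ᴬ_ : (a b : A) → Dec (a ≡ b)) where

  fibre : ∀ {n} → (Fin n → A) → A → ℕ
  fibre {n} f a = ∑ (allFin n) (λ v → ind ⌊ f v ≟ᴬ a ⌋)

  -- The first point is matched with some w where g takes the value `f zero`; such w exists because
  -- this fibre of g has the same positive size as that of f. Removing both points keeps the fibre
  -- sizes equal.
  match-fibres : ∀ {n} (f g : Fin n → A) → (∀ a → fibre f a ≡ fibre g a) → Σ (Permutation′ n) λ π → ∀ v → g (π ⟨$⟩ʳ v) ≡ f v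
  match-fibres {zero}  f g same = permutation id id (λ ()) (λ ()) , λ ()
  match-fibres {suc n} f g same with ∑-pos (allFin (suc n)) _ (subst (0 <_) (same (f zero)) here-counts)
    where
    here-counts : 0 < fibre f (f zero)
    here-counts = ∑-ind≥1 (allFin (suc n)) (λ v → ⌊ f v ≟ᴬ f zero ⌋) (∈-allFin zero) (true-⌊⌋ (f zero ≟ᴬ f zero) refl)
  ... | w , _ , pos with g w ≟ᴬ f zero
  ...   | yes gw≡ = Perm.insert zero w π , matches
    where
    rec : Σ (Permutation′ n) λ π → ∀ v → g (punchIn w (π ⟨$⟩ʳ v)) ≡ f (suc v)
    rec = match-fibres (f ∘ suc) (g ∘ punchIn w) (λ a → +-cancelˡ-≡ (ind ⌊ f zero ≟ᴬ a ⌋) _ _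
      (trans (sym (∑-allFin n (λ v → ind ⌊ f v ≟ᴬ a ⌋))) (trans (same a) (trans (∑-punchIn w (λ v → ind ⌊ g v ≟ᴬ a ⌋))
        (cong (λ b → ind ⌊ b ≟ᴬ a ⌋ + fibre (g ∘ punchIn w) a) gw≡)))))
    π = proj₁ rec
    matches : ∀ v → g (Perm.insert zero w π ⟨$⟩ʳ v) ≡ f v
    matches zero    = gw≡
    matches (suc v) = trans (cong g (Perm.insert-punchIn zero w π v)) (proj₂ rec v)

∑-ind≥2 : ∀ {n} (P : Fin n → Bool) {y z} → y ≢ z → P y ≡ true → P z ≡ true → 2 ≤ ∑ (allFin n) (ind ∘ P)
∑-ind≥2 {n} P {y} {z} y≢z Py Pz = begin
  2                                             ≡⟨ sym (trans (∣◃∣ y∉) (cong suc (trans (∣◃∣ {x = z} ∉⊥) (cong suc (∣⊥∣≡0 n))))) ⟩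
  ∣ y ◃ z ◃ ⊥ ∣                                 ≤⟨ p⊆q⇒∣p∣≤∣q∣ (◃-⊆ (in-tab Py) (◃-⊆ (in-tab Pz) ⊥⊆)) ⟩
  ∣ tabulate P ∣                                ≡⟨ sym (∣∣-sum (tabulate P)) ⟩
  ∑ (allFin n) (ind ∘ lookup (tabulate P))      ≡⟨ ∑-cong (allFin n) (λ v → cong ind (lookup∘tabulate P v)) ⟩
  ∑ (allFin n) (ind ∘ P)                        ∎
  where
  open ≤-Reasoning
  in-tab : ∀ {v} → P v ≡ true → v ∈ˢ tabulate P
  in-tab {v} p = true⇒∈ (trans (lookup∘tabulate P v) p)
  y∉ : y ∉ˢ z ◃ ⊥
  y∉ p with ∈-◃⁻ p
  ... | inj₁ y≡z = y≢z y≡z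
  ... | inj₂ q   = ∉⊥ q

module _ {C : Set} (_≟ᶜ_ : (p p′ : C) → Dec (p ≡ p′)) {n : ℕ} (col : Fin n → C) where
  open Rainbow _≟ᶜ_ col

  -- Adjoining a vertex of colour p to a rainbow set for l is injective, since the vertex of colour
  -- p can be recognised in the result.
  #rainbow-≥ : ∀ l → Unique l → product (map size l) ≤ #rainbow l
  #rainbow-≥ []      _         = ≤-trans (≤-reflexive one) (∑-term (λ f → ind ⌊ rainbow? [] f ×-dec (∣ f ∣ ≟ 0) ⌋) (∈-subsets ⊥))
    where
    one : 1 ≡ ind ⌊ rainbow? [] ⊥ ×-dec (∣ ⊥ {n} ∣ ≟ 0) ⌋
    one = cong ind (sym (true-⌊⌋ (rainbow? [] ⊥ ×-dec (∣ ⊥ {n} ∣ ≟ 0)) (((λ y y∈ → contradiction y∈ ∉⊥) , (λ y y∈ → contradiction y∈ ∉⊥)) , ∣⊥∣≡0 n)))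
  #rainbow-≥ (p ∷ l) (p∉ ∷ un) = begin
    size p * product (map size l)
      ≤⟨ *-monoʳ-≤ (size p) (#rainbow-≥ l un) ⟩
    size p * #rainbow l
      ≡⟨ sym (∑-*ʳ (allFin n) (#rainbow l) _) ⟩
    ∑ (allFin n) (λ y → ind ⌊ col y ≟ᶜ p ⌋ * #rainbow l)
      ≤⟨ ∑-mono (allFin n) shift ⟩
    ∑ (allFin n) (λ y → ∑ (subsets n) (λ f → ind ⌊ col y ≟ᶜ p ⌋ * (ind (lookup f y) * R (f ▹ y))))
      ≡⟨ ∑-swap (allFin n) (subsets n) _ ⟩
    ∑ (subsets n) (λ f → ∑ (allFin n) (λ y → ind ⌊ col y ≟ᶜ p ⌋ * (ind (lookup f y) * R (f ▹ y))))
      ≤⟨ ∑-mono (subsets n) collect ⟩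
    #rainbow (p ∷ l) ∎
    where
    open ≤-Reasoning
    Rᵇ : Subset n → Bool
    Rᵇ f = ⌊ rainbow? l f ×-dec (∣ f ∣ ≟ length l) ⌋
    R : Subset n → ℕ
    R f = ind (Rᵇ f)
    R⁻ : ∀ f → Rᵇ f ≡ true → IsRainbow l f × ∣ f ∣ ≡ length l
    R⁻ f = ⌊⌋-true (rainbow? l f ×-dec (∣ f ∣ ≟ length l))
    shift : ∀ y → ind ⌊ col y ≟ᶜ p ⌋ * #rainbow l ≤ ∑ (subsets n) (λ f → ind ⌊ col y ≟ᶜ p ⌋ * (ind (lookup f y) * R (f ▹ y)))
    shift y = ≤-trans here-or-not (≤-reflexive (sym (∑-*ˡ (subsets n) (ind ⌊ col y ≟ᶜ p ⌋) _)))
      where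
      here-or-not : ind ⌊ col y ≟ᶜ p ⌋ * #rainbow l ≤ ind ⌊ col y ≟ᶜ p ⌋ * ∑ (subsets n) (λ f → ind (lookup f y) * R (f ▹ y))
      here-or-not with col y ≟ᶜ p
      ... | no _   = z≤n
      ... | yes eq = *-monoʳ-≤ 1 (≤-trans (∑-mono (subsets n) fresh) (≤-reflexive (sym (∑-∈-shift y (λ f → R (f ▹ y))))))
        where
        fresh : ∀ f → R f ≤ ind (not (lookup f y)) * R ((y ◃ f) ▹ y)
        fresh f with y ∈? f
        ... | no y∉ rewrite ∉⇒false y∉ | ◃-▹ y∉ = ≤-reflexive (sym (*-identityˡ (R f)))
        ... | yes y∈ = ≤-trans (ind-mono {Rᵇ f} {false} (λ t → contradiction (subst (_∈ l) eq (proj₁ (proj₁ (R⁻ f t)) y y∈)) (λ p∈ → All.lookup p∉ p∈ refl))) z≤n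
    chosen : Subset n → Fin n → Bool
    chosen f y = ⌊ col y ≟ᶜ p ⌋ ∧ (lookup f y ∧ Rᵇ (f ▹ y))
    chosen⁻ : ∀ f y → chosen f y ≡ true → col y ≡ p × y ∈ˢ f × IsRainbow l (f ▹ y) × ∣ f ▹ y ∣ ≡ length l
    chosen⁻ f y t with ∧-true {⌊ col y ≟ᶜ p ⌋} t
    ... | a , b with ∧-true {lookup f y} b
    ...   | c , d = ⌊⌋-true (col y ≟ᶜ p) a , true⇒∈ c , R⁻ (f ▹ y) d
    collect : ∀ f → ∑ (allFin n) (λ y → ind ⌊ col y ≟ᶜ p ⌋ * (ind (lookup f y) * R (f ▹ y))) ≤ ind ⌊ rainbow? (p ∷ l) f ×-dec (∣ f ∣ ≟ suc (length l)) ⌋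
    collect f = ≤-trans (≤-reflexive (∑-cong (allFin n) (λ y → sym (trans (ind-∧ ⌊ col y ≟ᶜ p ⌋ _) (cong (ind ⌊ col y ≟ᶜ p ⌋ *_) (ind-∧ (lookup f y) _)))))) go
      where
      go : ∑ (allFin n) (ind ∘ chosen f) ≤ ind ⌊ rainbow? (p ∷ l) f ×-dec (∣ f ∣ ≟ suc (length l)) ⌋
      go with Finₚ.any? (λ y → chosen f y ≟ᵇ true)
      ... | no none = ≤-trans (≤-reflexive (∑-zero (allFin n) (λ y → cong ind (¬true (λ t → none (y , t)))))) z≤n
      ... | yes (y , t) with chosen⁻ f y t
      ...   | eq , y∈ , (coloured , inj) , ∣f▹y∣ = ≤-trans (∑-ind≤1 (Uniqueₚ.allFin⁺ n) (chosen f) once)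
          (≤-reflexive (cong ind (sym (true-⌊⌋ (rainbow? (p ∷ l) f ×-dec (∣ f ∣ ≟ suc (length l))) ((coloured′ , inj′) , trans (∣▹∣ y∈) (cong suc ∣f▹y∣))))))
        where
        other : ∀ z → z ∈ˢ f → z ≢ y → col z ∈ l
        other z z∈ z≢y = coloured z (∈-▹⁺ z∈ z≢y)
        p∉l : p ∉ l
        p∉l p∈ = All.lookup p∉ p∈ refl
        coloured′ : Coloured (p ∷ l) f
        coloured′ z z∈ with z ≟ᶠ y
        ... | yes refl = here eq
        ... | no z≢y   = there (other z z∈ z≢y)
        inj′ : Injective-on f
        inj′ z z∈ z′ z′∈ e with z ≟ᶠ y | z′ ≟ᶠ y
        ... | yes refl | yes refl = refl
        ... | yes refl | no z′≢y  = contradiction (subst (_∈ l) (trans (sym e) eq) (other z′ z′∈ z′≢y)) p∉l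
        ... | no z≢y   | yes refl = contradiction (subst (_∈ l) (trans e eq) (other z z∈ z≢y)) p∉l
        ... | no z≢y   | no z′≢y  = inj z (∈-▹⁺ z∈ z≢y) z′ (∈-▹⁺ z′∈ z′≢y) e
        once : ∀ z z′ → z ∈ allFin n → z′ ∈ allFin n → chosen f z ≡ true → chosen f z′ ≡ true → z ≡ z′
        once z z′ _ _ a b with chosen⁻ f z a | chosen⁻ f z′ b
        ... | ez , z∈ , _ | ez′ , z′∈ , _ = inj′ z z∈ z′ z′∈ (trans ez (sym ez′))

sizes-total : ∀ {n r} (c : Fin n → Fin r) → ∑ (allFin r) (λ p → ∑ (allFin n) (λ x → ind ⌊ c x ≟ᶠ p ⌋)) ≡ n
sizes-total {n} {r} c = trans (∑-swap (allFin r) (allFin n) _) (trans (∑-cong (allFin n) one) (trans (∑-const (allFin n) 1) (trans (*-identityʳ _) (Listₚ.length-tabulate id))))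
  where
  one : ∀ x → ∑ (allFin r) (λ p → ind ⌊ c x ≟ᶠ p ⌋) ≡ 1
  one x = ≤-antisym (∑-ind≤1 (Uniqueₚ.allFin⁺ r) (λ p → ⌊ c x ≟ᶠ p ⌋) (λ p p′ _ _ a b → trans (sym (⌊⌋-true (c x ≟ᶠ p) a)) (⌊⌋-true (c x ≟ᶠ p′) b)))
    (∑-ind≥1 (allFin r) (λ p → ⌊ c x ≟ᶠ p ⌋) (∈-allFin (c x)) (true-⌊⌋ (c x ≟ᶠ c x) refl))

-- a ≤ m (1 + 1/m)^(a − m) for all a, with equality only for a = m and a = m + 1;
-- both sides are multiplied so that no negative exponents occur.
module Tangent (m : ℕ) (m≥1 : 1 ≤ m) where

  F H : ℕ → ℕ
  F a = a * (m ^ a * suc m ^ m)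
  H a = m ^ suc m * suc m ^ a

  private
    p>0 : ∀ j → 0 < m ^ j
    p>0 j = >-nonZero⁻¹ (m ^ j) {{m^n≢0 m j {{>-nonZero m≥1}}}}
    P>0 : ∀ j → 0 < suc m ^ j
    P>0 j = >-nonZero⁻¹ (suc m ^ j) {{m^n≢0 (suc m) j}}

  H>0 : ∀ a → 0 < H a
  H>0 a = *-mono-≤ (p>0 (suc m)) (P>0 a)

  above : ∀ j → (suc m + j) * m ^ j ≤ suc m ^ suc j
  above zero    = ≤-reflexive (lemma m)
    where
    lemma : ∀ m → (suc m + 0) * 1 ≡ suc m * 1
    lemma = solve-∀
  above (suc j) = begin
    (suc m + suc j) * (m * m ^ j)                ≤⟨ m≤m+n _ (suc j * m ^ j) ⟩
    (suc m + suc j) * (m * m ^ j) + suc j * m ^ j  ≡⟨ lemma m j (m ^ j) ⟩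
    suc m * ((suc m + j) * m ^ j)                ≤⟨ *-monoʳ-≤ (suc m) (above j) ⟩
    suc m * suc m ^ suc j                        ∎
    where
    open ≤-Reasoning
    lemma : ∀ m j p → (suc m + suc j) * (m * p) + suc j * p ≡ suc m * ((suc m + j) * p)
    lemma = solve-∀

  above-strict : ∀ j → (suc m + suc j) * m ^ suc j < suc m ^ suc (suc j)
  above-strict j = begin-strict
    (suc m + suc j) * (m * m ^ j)                <⟨ m<m+n _ (*-mono-≤ {1} {suc j} {1} (s≤s z≤n) (p>0 j)) ⟩
    (suc m + suc j) * (m * m ^ j) + suc j * m ^ j  ≡⟨ lemma m j (m ^ j) ⟩
    suc m * ((suc m + j) * m ^ j)                ≤⟨ *-monoʳ-≤ (suc m) (above j) ⟩
    suc m * suc m ^ suc j                        ∎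
    where
    open ≤-Reasoning
    lemma : ∀ m j p → (suc m + suc j) * (m * p) + suc j * p ≡ suc m * ((suc m + j) * p)
    lemma = solve-∀

  below : ∀ j a → m ≡ a + j → suc m ^ j * a ≤ m ^ suc j
  below-strict : ∀ j a → m ≡ a + suc j → suc m ^ suc j * a < m ^ suc (suc j)

  below zero    a eq = ≤-reflexive (trans (+-identityʳ a) (trans (sym (trans eq (+-identityʳ a))) (sym (*-identityʳ m))))
  below (suc j) a eq = <⇒≤ (below-strict j a eq)

  below-strict j a eq = begin-strict
    suc m * suc m ^ j * a        ≡⟨ lemma (suc m) (suc m ^ j) a ⟩
    suc m ^ j * (suc m * a)      <⟨ *-monoʳ-< (suc m ^ j) {{>-nonZero (P>0 j)}} step ⟩
    suc m ^ j * (m * suc a)      ≡⟨ lemma′ (suc m ^ j) m (suc a) ⟩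
    m * (suc m ^ j * suc a)      ≤⟨ *-monoʳ-≤ m (below j (suc a) (trans eq (+-suc a j))) ⟩
    m * m ^ suc j                ∎
    where
    open ≤-Reasoning
    lemma : ∀ a b c → a * b * c ≡ b * (a * c)
    lemma = solve-∀
    lemma′ : ∀ a b c → a * (b * c) ≡ b * (a * c)
    lemma′ = solve-∀
    a<m : a < m
    a<m = ≤-trans (s≤s (m≤m+n a j)) (≤-reflexive (trans (sym (+-suc a j)) (sym eq)))
    step : suc m * a < m * suc a
    step = ≤-trans (+-monoˡ-< (m * a) a<m) (≤-reflexive (sym (*-suc m a)))

  -- The first two cases are those of equality in the tangent inequality, the other two those of
  -- strict inequality.
  data Position : ℕ → Set where
    at-m  : Position m
    at-m⁺ : Position (suc m)
    high  : ∀ j → Position (suc m + suc j)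
    low   : ∀ a j → m ≡ a + suc j → Position a

  position : ∀ a → Position a
  position a with ≤-total a m
  ... | inj₁ a≤m with m ∸ a in eq
  ...   | zero  = subst Position (≤-antisym (m∸n≡0⇒m≤n eq) a≤m) at-m
  ...   | suc j = low a j (trans (sym (m+[n∸m]≡n a≤m)) (cong (λ z → a + z) eq))
  position a | inj₂ m≤a with a ∸ m in eq
  ... | zero        = subst Position (≤-antisym m≤a (m∸n≡0⇒m≤n eq)) at-m
  ... | suc zero    = subst Position (trans (+-comm 1 m) (trans (cong (λ z → m + z) (sym eq)) (m+[n∸m]≡n m≤a))) at-m⁺
  ... | suc (suc j) = subst Position (trans (sym (+-suc m (suc j))) (trans (cong (λ z → m + z) (sym eq)) (m+[n∸m]≡n m≤a))) (high j)

  F-m : F m ≡ H m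
  F-m = sym (*-assoc m (m ^ m) (suc m ^ m))

  F-m⁺ : F (suc m) ≡ H (suc m)
  F-m⁺ = lemma (suc m) (m ^ suc m) (suc m ^ m)
    where
    lemma : ∀ a b c → a * (b * c) ≡ b * (a * c)
    lemma = solve-∀

  F-high : ∀ j → F (suc m + suc j) < H (suc m + suc j)
  F-high j = begin-strict
    (suc m + suc j) * (m ^ (suc m + suc j) * suc m ^ m)
      ≡⟨ cong (λ z → (suc m + suc j) * (z * suc m ^ m)) (^-distribˡ-+-* m (suc m) (suc j)) ⟩
    (suc m + suc j) * (m ^ suc m * m ^ suc j * suc m ^ m)
      ≡⟨ lemma (suc m + suc j) (m ^ suc m) (m ^ suc j) (suc m ^ m) ⟩
    m ^ suc m * (suc m ^ m * ((suc m + suc j) * m ^ suc j))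
      <⟨ *-monoʳ-< (m ^ suc m) {{>-nonZero (p>0 (suc m))}} (*-monoʳ-< (suc m ^ m) {{>-nonZero (P>0 m)}} (above-strict j)) ⟩
    m ^ suc m * (suc m ^ m * suc m ^ suc (suc j))
      ≡⟨ cong (m ^ suc m *_) (trans (sym (^-distribˡ-+-* (suc m) m (suc (suc j)))) (cong (suc m ^_) (+-suc m (suc j)))) ⟩
    m ^ suc m * suc m ^ (suc m + suc j) ∎
    where
    open ≤-Reasoning
    lemma : ∀ a b c d → a * (b * c * d) ≡ b * (d * (a * c))
    lemma = solve-∀

  F-low : ∀ a j → m ≡ a + suc j → F a < H a
  F-low a j eq = begin-strict
    a * (m ^ a * suc m ^ m)
      ≡⟨ cong (λ z → a * (m ^ a * z)) (trans (cong (suc m ^_) eq) (^-distribˡ-+-* (suc m) a (suc j))) ⟩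
    a * (m ^ a * (suc m ^ a * suc m ^ suc j))
      ≡⟨ lemma a (m ^ a) (suc m ^ a) (suc m ^ suc j) ⟩
    m ^ a * suc m ^ a * (suc m ^ suc j * a)
      <⟨ *-monoʳ-< (m ^ a * suc m ^ a) {{m*n≢0 _ _ {{>-nonZero (p>0 a)}} {{>-nonZero (P>0 a)}}}} (below-strict j a eq) ⟩
    m ^ a * suc m ^ a * m ^ suc (suc j)
      ≡⟨ lemma′ (m ^ a) (suc m ^ a) (m ^ suc (suc j)) ⟩
    m ^ a * m ^ suc (suc j) * suc m ^ a
      ≡⟨ cong (_* suc m ^ a) (trans (sym (^-distribˡ-+-* m a (suc (suc j)))) (cong (m ^_) (trans (+-suc a (suc j)) (cong suc (sym eq))))) ⟩
    m ^ suc m * suc m ^ a ∎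
    where
    open ≤-Reasoning
    lemma : ∀ a b c d → a * (b * (c * d)) ≡ b * c * (d * a)
    lemma = solve-∀
    lemma′ : ∀ a b c → a * b * c ≡ a * c * b
    lemma′ = solve-∀

  F≤H : ∀ a → F a ≤ H a
  F≤H a with position a
  ... | at-m       = ≤-reflexive F-m
  ... | at-m⁺      = ≤-reflexive F-m⁺
  ... | high j     = <⇒≤ (F-high j)
  ... | low _ j eq = <⇒≤ (F-low a j eq)

  F≡H : ∀ {a} → a ≡ m ⊎ a ≡ suc m → F a ≡ H a
  F≡H (inj₁ refl) = F-m
  F≡H (inj₂ refl) = F-m⁺

  F≡H⁻ : ∀ a → F a ≡ H a → a ≡ m ⊎ a ≡ suc m
  F≡H⁻ a eq with position a
  ... | at-m        = inj₁ refl
  ... | at-m⁺       = inj₂ refl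
  ... | high j      = contradiction eq (<⇒≢ (F-high j))
  ... | low _ j eq′ = contradiction eq (<⇒≢ (F-low a j eq′))

  product-F : ∀ as → product (map F as) ≡ product as * (m ^ sum as * suc m ^ (m * length as))
  product-F []       = sym (trans (+-identityʳ _) (trans (+-identityʳ _) (cong (suc m ^_) (*-zeroʳ m))))
  product-F (a ∷ as) = begin
    a * (m ^ a * suc m ^ m) * product (map F as)
      ≡⟨ cong (a * (m ^ a * suc m ^ m) *_) (product-F as) ⟩
    a * (m ^ a * suc m ^ m) * (product as * (m ^ sum as * suc m ^ (m * length as)))
      ≡⟨ lemma a (m ^ a) (suc m ^ m) (product as) (m ^ sum as) (suc m ^ (m * length as)) ⟩
    a * product as * (m ^ a * m ^ sum as * (suc m ^ m * suc m ^ (m * length as)))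
      ≡⟨ cong₂ (λ y z → a * product as * (y * z)) (sym (^-distribˡ-+-* m a (sum as)))
           (trans (sym (^-distribˡ-+-* (suc m) m (m * length as))) (cong (suc m ^_) (sym (*-suc m (length as))))) ⟩
    a * product as * (m ^ (a + sum as) * suc m ^ (m * suc (length as))) ∎
    where
    open ≡-Reasoning
    lemma : ∀ a b c d e f → a * (b * c) * (d * (e * f)) ≡ a * d * (b * e * (c * f))
    lemma = solve-∀

  product-H : ∀ as → product (map H as) ≡ (m ^ suc m) ^ length as * suc m ^ sum as
  product-H []       = refl
  product-H (a ∷ as) = begin
    m ^ suc m * suc m ^ a * product (map H as)
      ≡⟨ cong (m ^ suc m * suc m ^ a *_) (product-H as) ⟩
    m ^ suc m * suc m ^ a * ((m ^ suc m) ^ length as * suc m ^ sum as)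
      ≡⟨ lemma (m ^ suc m) (suc m ^ a) _ (suc m ^ sum as) ⟩
    m ^ suc m * (m ^ suc m) ^ length as * (suc m ^ a * suc m ^ sum as)
      ≡⟨ cong (m ^ suc m * (m ^ suc m) ^ length as *_) (sym (^-distribˡ-+-* (suc m) a (sum as))) ⟩
    m ^ suc m * (m ^ suc m) ^ length as * suc m ^ (a + sum as) ∎
    where
    open ≡-Reasoning
    lemma : ∀ a b c d → a * b * (c * d) ≡ a * c * (b * d)
    lemma = solve-∀

  product-mono : ∀ as → product (map F as) ≤ product (map H as)
  product-mono []       = ≤-refl
  product-mono (a ∷ as) = *-mono-≤ (F≤H a) (product-mono as)

  product-H>0 : ∀ as → 0 < product (map H as)
  product-H>0 []       = s≤s z≤n
  product-H>0 (a ∷ as) = *-mono-≤ (H>0 a) (product-H>0 as)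

  product-tight : ∀ as → product (map F as) ≡ product (map H as) → ∀ {a} → a ∈ as → F a ≡ H a
  product-tight (a ∷ as) eq a∈ with m≤n⇒m<n∨m≡n (F≤H a)
  ... | inj₁ lt = contradiction eq (<⇒≢ (≤-trans (s≤s (*-monoʳ-≤ (F a) (product-mono as))) (*-monoˡ-< (product (map H as)) {{>-nonZero (product-H>0 as)}} lt)))
  product-tight (a ∷ as) eq (here refl) | inj₂ eq₁ = eq₁
  product-tight (a ∷ as) eq (there a∈)  | inj₂ eq₁ =
    product-tight as (*-cancelˡ-≡ _ _ (H a) {{>-nonZero (H>0 a)}} (trans (cong (_* product (map F as)) (sym eq₁)) eq)) a∈

  product-balanced : ∀ bs → (∀ {b} → b ∈ bs → b ≡ m ⊎ b ≡ suc m) → product (map F bs) ≡ product (map H bs)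
  product-balanced []       h = refl
  product-balanced (b ∷ bs) h = cong₂ _*_ (F≡H (h (here refl))) (product-balanced bs (h ∘ there))

  module _ (as bs : List ℕ) (len : length as ≡ length bs) (tot : sum as ≡ sum bs) (bal : ∀ {b} → b ∈ bs → b ≡ m ⊎ b ≡ suc m) where

    private
      c : ℕ
      c = m ^ sum bs * suc m ^ (m * length bs)
      c≢0 : NonZero c
      c≢0 = m*n≢0 _ _ {{m^n≢0 m (sum bs) {{>-nonZero m≥1}}}} {{m^n≢0 (suc m) (m * length bs)}}
      as-F : product (map F as) ≡ product as * c
      as-F = trans (product-F as) (cong₂ (λ x y → product as * (m ^ x * suc m ^ (m * y))) tot len)
      as-H : product (map H as) ≡ product bs * c
      as-H = trans (product-H as) (trans (cong₂ (λ x y → (m ^ suc m) ^ y * suc m ^ x) tot len) (trans (sym (product-H bs)) (trans (sym (product-balanced bs bal)) (product-F bs))))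

    -- Multiply the tangent inequalities over all entries. Apart from the product of the entries,
    -- both sides depend only on the sum and the length, which agree for `as` and `bs`; for the
    -- balanced list `bs` equality holds.
    balanced-max : product as ≤ product bs
    balanced-max = *-cancelʳ-≤ _ _ c {{c≢0}} (subst₂ _≤_ as-F as-H (product-mono as))

    balanced-unique : product as ≡ product bs → ∀ {a} → a ∈ as → a ≡ m ⊎ a ≡ suc m
    balanced-unique eq {a} a∈ = F≡H⁻ a (product-tight as (trans as-F (trans (cong (_* c) eq) (sym as-H))) a∈)

bool-ext : ∀ {b c} → (b ≡ true → c ≡ true) → (c ≡ true → b ≡ true) → b ≡ c
bool-ext {true}  {c}     f g = sym (f refl)
bool-ext {false} {true}  f g = g refl
bool-ext {false} {false} f g = refl

sum-tabulate : ∀ n (f : Fin n → ℕ) → Vec.sum (tabulate f) ≡ ∑ (allFin n) f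
sum-tabulate zero    f = refl
sum-tabulate (suc n) f = trans (cong (f zero +_) (sum-tabulate n (f ∘ suc))) (sym (∑-allFin n f))

if≡ind : ∀ b → (if b then 1 else 0) ≡ ind b
if≡ind true  = refl
if≡ind false = refl

all⁺ : {A : Set} (f : A → Bool) (l : List A) → (∀ p → p ∈ l → f p ≡ true) → foldr (λ p b → f p ∧ b) true l ≡ true
all⁺ f []      h = refl
all⁺ f (p ∷ l) h = ∧-intro (h p (here refl)) (all⁺ f l (λ q q∈ → h q (there q∈)))

all⁻ : {A : Set} (f : A → Bool) (l : List A) → foldr (λ p b → f p ∧ b) true l ≡ true → ∀ p → p ∈ l → f p ≡ true
all⁻ f (p ∷ l) t _ (here refl) = proj₁ (∧-true {f p} t)
all⁻ f (p ∷ l) t q (there q∈)  = all⁻ f l (proj₂ (∧-true {f p} t)) q q∈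

∑-toℕ : ∀ n (f : ℕ → ℕ) → ∑ (allFin n) (f ∘ toℕ) ≡ Σ₁ n (λ j → f (j ∸ 1))
∑-toℕ zero    f = refl
∑-toℕ (suc n) f = trans (∑-allFin n (f ∘ toℕ)) (trans (cong (f 0 +_) (trans (∑-toℕ n (f ∘ suc)) (Σ₁-cong n pred-suc)))
  (sym (Σ₁-head n (λ j → f (j ∸ 1)))))
  where
  pred-suc : ∀ j → 1 ≤ j → j ≤ n → f (suc (j ∸ 1)) ≡ f (suc j ∸ 1)
  pred-suc (suc j) _ _ = refl

product-remove : {C : Set} (_≟ᶜ_ : (p p′ : C) → Dec (p ≡ p′)) (f : C → ℕ) → ∀ {p l} → p ∈ l → product (map f l) ≡ f p * product (map f (remove _≟ᶜ_ p l))
product-remove _≟ᶜ_ f {p} {v ∷ l} p∈ with v ≟ᶜ p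
product-remove _≟ᶜ_ f {p} {v ∷ l} p∈          | yes refl = refl
product-remove _≟ᶜ_ f {p} {v ∷ l} (here refl) | no v≢p   = contradiction refl v≢p
product-remove _≟ᶜ_ f {p} {v ∷ l} (there p∈)  | no _     = trans (cong (f v *_) (product-remove _≟ᶜ_ f p∈)) (lemma (f v) (f p) _)
  where
  lemma : ∀ a b c → a * (b * c) ≡ b * (a * c)
  lemma = solve-∀

remove-≢ : {C : Set} (_≟ᶜ_ : (p p′ : C) → Dec (p ≡ p′)) → ∀ {p l} → Unique l → ∀ {u} → u ∈ remove _≟ᶜ_ p l → u ≢ p
remove-≢ _≟ᶜ_ {p} {v ∷ l} (v∉ ∷ un) u∈ with v ≟ᶜ p
remove-≢ _≟ᶜ_ {p} {v ∷ l} (v∉ ∷ un) u∈          | yes refl = λ u≡v → All.lookup v∉ u∈ (sym u≡v)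
remove-≢ _≟ᶜ_ {p} {v ∷ l} (v∉ ∷ un) (here refl) | no v≢p   = v≢p
remove-≢ _≟ᶜ_ {p} {v ∷ l} (v∉ ∷ un) (there u∈)  | no _     = remove-≢ _≟ᶜ_ un u∈

product-lower : {C : Set} (f : C → ℕ) (m : ℕ) (l : List C) → (∀ p → m ≤ f p) → m ^ length l ≤ product (map f l)
product-lower f m []      h = ≤-refl
product-lower f m (p ∷ l) h = *-mono-≤ (h p) (product-lower f m l h)

product-map-cong : {C : Set} (f g : C → ℕ) (l : List C) → (∀ {p} → p ∈ l → f p ≡ g p) → product (map f l) ≡ product (map g l)
product-map-cong f g []      h = refl
product-map-cong f g (p ∷ l) h = cong₂ _*_ (h (here refl)) (product-map-cong f g l (h ∘ there))

∑-tight : {A : Set} (xs : List A) (P Q : A → Bool) → (∀ x → P x ≡ true → Q x ≡ true) → ∑ xs (ind ∘ Q) ≤ ∑ xs (ind ∘ P) →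
  ∀ {x} → x ∈ xs → Q x ≡ true → P x ≡ true
∑-tight (z ∷ xs) P Q PQ le x∈ Qx with P z in p | Q z in q
∑-tight (z ∷ xs) P Q PQ le x∈          Qx | true  | false = ⊥-elim (true≢false (PQ z p) q)
∑-tight (z ∷ xs) P Q PQ le x∈          Qx | false | true  = contradiction le (<⇒≱ (s≤s (∑-mono xs (λ x → ind-mono (PQ x)))))
∑-tight (z ∷ xs) P Q PQ le (here refl) Qx | true  | true  = p
∑-tight (z ∷ xs) P Q PQ le (there x∈)  Qx | true  | true  = ∑-tight xs P Q PQ (≤-pred le) x∈ Qx
∑-tight (z ∷ xs) P Q PQ le (here refl) Qx | false | false = ⊥-elim (true≢false Qx q)
∑-tight (z ∷ xs) P Q PQ le (there x∈)  Qx | false | false = ∑-tight xs P Q PQ le x∈ Qx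

∣allFin∣ : ∀ n → length (allFin n) ≡ n
∣allFin∣ n = Listₚ.length-tabulate id

module Multipartite (r : ℕ) where

  sizeOf : ∀ {n} → (Fin n → Fin r) → Fin r → ℕ
  sizeOf c = Rainbow.size _≟ᶠ_ c

  Complete : ∀ {n} → (Fin n → Fin r) → Subset n → Set
  Complete c S = Rainbow.Injective-on _≟ᶠ_ c S × ∣ S ∣ ≡ r

  -- Written through rainbow sets for all r colours, so that the two bounds on `#rainbow` count
  -- these edges exactly.
  complete : ∀ {n} → (Fin n → Fin r) → Subset n → Bool
  complete c S = ⌊ Rainbow.rainbow? _≟ᶠ_ c (allFin r) S ×-dec (∣ S ∣ ≟ length (allFin r)) ⌋

  complete⁻ : ∀ {n} (c : Fin n → Fin r) {S} → complete c S ≡ true → Complete c S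
  complete⁻ c {S} t with ⌊⌋-true (Rainbow.rainbow? _≟ᶠ_ c (allFin r) S ×-dec (∣ S ∣ ≟ length (allFin r))) t
  ... | (_ , inj) , ∣S∣ = inj , trans ∣S∣ (∣allFin∣ r)

  complete⁺ : ∀ {n} (c : Fin n → Fin r) {S} → Complete c S → complete c S ≡ true
  complete⁺ c {S} (inj , ∣S∣) = true-⌊⌋ (Rainbow.rainbow? _≟ᶠ_ c (allFin r) S ×-dec (∣ S ∣ ≟ length (allFin r)))
    (((λ y _ → ∈-allFin (c y)) , inj) , trans ∣S∣ (sym (∣allFin∣ r)))

  complete-hits : ∀ {n} (c : Fin n → Fin r) {S} → Complete c S → ∀ p → ∃ λ v → v ∈ˢ S × c v ≡ p
  complete-hits c {S} (inj , ∣S∣) p with Finₚ.any? (λ v → (v ∈? S) ×-dec (c v ≟ᶠ p))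
  ... | yes found = found
  ... | no none   = contradiction (Rainbow.rainbow-size _≟ᶠ_ c _ S (Rainbow.rainbow-avoid _≟ᶠ_ c {p = p} ((λ y _ → ∈-allFin (c y)) , inj) (λ v v∈ eq → none (v , v∈ , eq))))
    (<⇒≱ (≤-reflexive (trans (sym (length-remove _≟ᶠ_ (∈-allFin p))) (trans (∣allFin∣ r) (sym ∣S∣)))))

  #complete : ∀ {n} (c : Fin n → Fin r) → ∑ (subsets n) (ind ∘ complete c) ≡ product (map (sizeOf c) (allFin r))
  #complete c = ≤-antisym (Rainbow.#rainbow-≤ _≟ᶠ_ c (allFin r)) (#rainbow-≥ _≟ᶠ_ c (allFin r) (Uniqueₚ.allFin⁺ r))

  module _ {n m : ℕ} (a b : Fin r → ℕ) (total : ∑ (allFin r) a ≡ ∑ (allFin r) b)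
    (bal-a : ∀ p → a p ≡ m ⊎ a p ≡ suc m) (bal-b : ∀ p → b p ≡ m ⊎ b p ≡ suc m) where

    private
      Bal : (Fin r → ℕ) → Set
      Bal a = ∀ p → a p ≡ m ⊎ a p ≡ suc m
      upper : ∀ a → Bal a → ∑ (allFin r) a ≡ r * m + fibre _≟_ a (suc m)
      upper a bal = trans (∑-cong (allFin r) each) (trans (∑-+ (allFin r) (λ _ → m) _) (cong (_+ fibre _≟_ a (suc m)) (trans (∑-const (allFin r) m) (cong (_* m) (∣allFin∣ r)))))
        where
        each : ∀ p → a p ≡ m + ind ⌊ a p ≟ suc m ⌋
        each p with a p ≟ suc m | bal p
        ... | yes eq | _      = trans eq (+-comm 1 m)
        ... | no _   | inj₁ e = trans e (sym (+-identityʳ m))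
        ... | no ¬e  | inj₂ e = contradiction e ¬e
      lower : ∀ a → Bal a → r ≡ fibre _≟_ a m + fibre _≟_ a (suc m)
      lower a bal = trans (sym (trans (∑-const (allFin r) 1) (trans (*-identityʳ _) (∣allFin∣ r)))) (trans (∑-cong (allFin r) each) (∑-+ (allFin r) _ _))
        where
        each : ∀ p → 1 ≡ ind ⌊ a p ≟ m ⌋ + ind ⌊ a p ≟ suc m ⌋
        each p with a p ≟ m | a p ≟ suc m | bal p
        ... | yes e | yes e′ | _      = contradiction (trans (sym e) e′) (<⇒≢ ≤-refl)
        ... | yes _ | no _   | _      = refl
        ... | no _  | yes _  | _      = refl
        ... | no ¬e | no _   | inj₁ e = contradiction e ¬e
        ... | no _  | no ¬e  | inj₂ e = contradiction e ¬e
      same⁺ : fibre _≟_ a (suc m) ≡ fibre _≟_ b (suc m)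
      same⁺ = +-cancelˡ-≡ (r * m) _ _ (trans (sym (upper a bal-a)) (trans total (upper b bal-b)))

    -- Only the sizes m and m + 1 occur, and the total determines how many parts have m + 1
    -- elements.
    balanced-fibres : ∀ i → fibre _≟_ a i ≡ fibre _≟_ b i
    balanced-fibres i with i ≟ m | i ≟ suc m
    ... | yes refl | _        = +-cancelʳ-≡ (fibre _≟_ a (suc m)) _ _ (trans (sym (lower a bal-a)) (trans (lower b bal-b) (cong (fibre _≟_ b m +_) (sym same⁺))))
    ... | no _     | yes refl = same⁺
    ... | no i≢m   | no i≢m⁺  = trans (none a bal-a) (sym (none b bal-b))
      where
      none : ∀ a → Bal a → fibre _≟_ a i ≡ 0
      none a bal = ∑-zero (allFin r) (λ p → cong ind (¬true (λ t → excluded p (⌊⌋-true (a p ≟ i) t))))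
        where
        excluded : ∀ p → a p ≢ i
        excluded p eq with bal p
        ... | inj₁ e = i≢m (trans (sym eq) e)
        ... | inj₂ e = i≢m⁺ (trans (sym eq) e)

  image-size : ∀ {n n′} (f : Fin n → Fin n′) → (∀ {x y} → f x ≡ f y → x ≡ y) → ∀ S → ∣ image f S ∣ ≡ ∣ S ∣
  image-size f inj S = trans (cong ∣_∣ (⊆-antisym {i = image f S} {toSet (map f (elems S))} fwd bwd))
    (trans (∣toSet∣-unique (Uniqueₚ.map⁺ inj (elems-unique S))) (trans (Listₚ.length-map f (elems S)) (length-elems S)))
    where
    fwd : image f S ⊆ˢ toSet (map f (elems S))
    fwd w∈ with image⁻ f S w∈
    ... | i , refl , i∈ = ∈-toSet⁺ (∈-map⁺ f (∈-elems⁺ i∈))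
    bwd : toSet (map f (elems S)) ⊆ˢ image f S
    bwd w∈ with ∈-map⁻ f (∈-toSet⁻ {l = map f (elems S)} w∈)
    ... | i , i∈ , refl = image⁺ f S i (∈-elems⁻ i∈)

  complete-image : ∀ {n} (c c′ : Fin n → Fin r) (σ : Fin r → Fin r) → (∀ {p p′} → σ p ≡ σ p′ → p ≡ p′) →
    (π : Fin n → Fin n) → (∀ {x y} → π x ≡ π y → x ≡ y) → (∀ v → c′ (π v) ≡ σ (c v)) → ∀ S → complete c S ≡ complete c′ (image π S)
  complete-image c c′ σ σ-inj π π-inj comm S = bool-ext (λ t → complete⁺ c′ (fwd (complete⁻ c t))) (λ t → complete⁺ c (bwd (complete⁻ c′ t)))
    where
    fwd : Complete c S → Complete c′ (image π S)
    fwd (inj , ∣S∣) = inj′ , trans (image-size π π-inj S) ∣S∣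
      where
      inj′ : Rainbow.Injective-on _≟ᶠ_ c′ (image π S)
      inj′ y y∈ z z∈ eq with image⁻ π S y∈ | image⁻ π S z∈
      ... | i , refl , i∈ | j , refl , j∈ = cong π (inj i i∈ j j∈ (σ-inj (trans (sym (comm i)) (trans eq (comm j)))))
    bwd : Complete c′ (image π S) → Complete c S
    bwd (inj , ∣S∣) = (λ y y∈ z z∈ eq → π-inj (inj (π y) (image⁺ π S y y∈) (π z) (image⁺ π S z z∈) (trans (comm y) (trans (cong σ eq) (sym (comm z)))))) ,
      trans (sym (image-size π π-inj S)) ∣S∣

-- The Turán hypergraph

module Turan (r : ℕ) .{{_ : NonZero r}} where
  open Multipartite r

  residue : ∀ {n} → Fin n → Fin r
  residue v = fromℕ< (m%n<n (toℕ v) r)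

  toℕ-residue : ∀ {n} (v : Fin n) → toℕ (residue v) ≡ toℕ v % r
  toℕ-residue v = Finₚ.toℕ-fromℕ< (m%n<n (toℕ v) r)

  inPart : ∀ {n} → Subset n → ℕ → Fin n → Bool
  inPart S p v = lookup S v ∧ ⌊ toℕ v % r ≟ p ⌋

  partCount≡ : ∀ {n} (S : Subset n) p → partCount r S p ≡ ∑ (allFin n) (ind ∘ inPart S p)
  partCount≡ {n} S p = trans (sum-tabulate n _) (∑-cong (allFin n) (λ v → if≡ind (inPart S p v)))

  inPart⁻ : ∀ {n} (S : Subset n) {p v} → inPart S p v ≡ true → v ∈ˢ S × toℕ v % r ≡ p
  inPart⁻ S {p} {v} t = true⇒∈ (proj₁ (∧-true {lookup S v} t)) , ⌊⌋-true (toℕ v % r ≟ p) (proj₂ (∧-true {lookup S v} t))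

  inPart⁺ : ∀ {n} (S : Subset n) {p v} → v ∈ˢ S → toℕ v % r ≡ p → inPart S p v ≡ true
  inPart⁺ S {p} {v} v∈ eq = ∧-intro (∈⇒true v∈) (true-⌊⌋ (toℕ v % r ≟ p) eq)

  turanEdge≡complete : ∀ n (S : Subset n) → turanEdge r n S ≡ complete residue S
  turanEdge≡complete n S = bool-ext (λ t → complete⁺ residue (fwd t)) (λ t → bwd (complete⁻ residue t))
    where
    fwd : turanEdge r n S ≡ true → Complete residue S
    fwd t = inj , size
      where
      one : ∀ p → p ∈ upTo r → ∑ (allFin n) (ind ∘ inPart S p) ≡ 1
      one p p∈ = trans (sym (partCount≡ S p)) (⌊⌋-true (partCount r S p ≟ 1) (all⁻ (λ p → ⌊ partCount r S p ≟ 1 ⌋) (upTo r) t p p∈))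
      inj : Rainbow.Injective-on _≟ᶠ_ residue S
      inj y y∈ z z∈ eq = decidable-stable (y ≟ᶠ z) (λ y≢z → contradiction
        (∑-ind≥2 (inPart S (toℕ z % r)) y≢z (inPart⁺ S y∈ (trans (sym (toℕ-residue y)) (trans (cong toℕ eq) (toℕ-residue z)))) (inPart⁺ S z∈ refl))
        (<⇒≱ (s≤s (≤-reflexive (one (toℕ z % r) (∈-upTo⁺ (m%n<n (toℕ z) r)))))))
      size : ∣ S ∣ ≡ r
      size = begin
        ∣ S ∣
          ≡⟨ sym (∣∣-sum S) ⟩
        ∑ (allFin n) (ind ∘ lookup S)
          ≡⟨ ∑-cong (allFin n) by-part ⟩
        ∑ (allFin n) (λ v → ∑ (upTo r) (λ p → ind (inPart S p v)))
          ≡⟨ ∑-swap (allFin n) (upTo r) _ ⟩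
        ∑ (upTo r) (λ p → ∑ (allFin n) (ind ∘ inPart S p))
          ≡⟨ ≤-antisym (∑-mono-∈ (upTo r) (λ p p∈ → ≤-reflexive (one p p∈))) (∑-mono-∈ (upTo r) (λ p p∈ → ≤-reflexive (sym (one p p∈)))) ⟩
        ∑ (upTo r) (λ _ → 1)
          ≡⟨ trans (∑-const (upTo r) 1) (trans (*-identityʳ _) (Listₚ.length-upTo r)) ⟩
        r ∎
        where
        open ≡-Reasoning
        by-part : ∀ v → ind (lookup S v) ≡ ∑ (upTo r) (λ p → ind (inPart S p v))
        by-part v with lookup S v
        ... | false = sym (∑-zero (upTo r) (λ _ → refl))
        ... | true  = ≤-antisym (∑-ind≥1 (upTo r) (λ p → ⌊ toℕ v % r ≟ p ⌋) (∈-upTo⁺ (m%n<n (toℕ v) r)) (true-⌊⌋ (toℕ v % r ≟ toℕ v % r) refl))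
          (∑-ind≤1 (Uniqueₚ.upTo⁺ r) (λ p → ⌊ toℕ v % r ≟ p ⌋) (λ p p′ _ _ a b → trans (sym (⌊⌋-true (toℕ v % r ≟ p) a)) (⌊⌋-true (toℕ v % r ≟ p′) b)))
    bwd : Complete residue S → turanEdge r n S ≡ true
    bwd co@(inj , _) = all⁺ (λ p → ⌊ partCount r S p ≟ 1 ⌋) (upTo r) (λ p p∈ → true-⌊⌋ (partCount r S p ≟ 1) (trans (partCount≡ S p) (≤-antisym at-most (at-least p (∈-upTo⁻ p∈)))))
      where
      at-most : ∀ {p} → ∑ (allFin n) (ind ∘ inPart S p) ≤ 1
      at-most {p} = ∑-ind≤1 (Uniqueₚ.allFin⁺ n) (inPart S p) (λ y z _ _ a b → inj y (proj₁ (inPart⁻ S a)) z (proj₁ (inPart⁻ S b))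
        (Finₚ.toℕ-injective (trans (toℕ-residue y) (trans (proj₂ (inPart⁻ S a)) (trans (sym (proj₂ (inPart⁻ S b))) (sym (toℕ-residue z)))))))
      at-least : ∀ p → p < r → 1 ≤ ∑ (allFin n) (ind ∘ inPart S p)
      at-least p p<r with complete-hits residue co (fromℕ< p<r)
      ... | v , v∈ , eq = ∑-ind≥1 (allFin n) (inPart S p) (∈-allFin v) (inPart⁺ S v∈ (trans (sym (toℕ-residue v)) (trans (cong toℕ eq) (Finₚ.toℕ-fromℕ< p<r))))

  #turan : ℕ → ℕ
  #turan n = numEdges (turanEdge r n)

  #turan≡ : ∀ n → #turan n ≡ product (map (sizeOf (residue {n})) (allFin r))
  #turan≡ n = trans (countSubsets≡∑ n _) (trans (∑-cong (subsets n) (λ S → cong ind (turanEdge≡complete n S))) (#complete (residue {n})))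

  -- Vertices are numbered from 0, whereas `Σ₁` starts at 1; hence the shift by one.
  hits : ℕ → ℕ → ℕ
  hits i j = ind ⌊ (j ∸ 1) % r ≟ i ⌋

  size-residue : ∀ n (p : Fin r) → sizeOf (residue {n}) p ≡ Σ₁ n (hits (toℕ p))
  size-residue n p = trans (∑-cong (allFin n) (λ x → ind-≡
      (λ t → true-⌊⌋ (toℕ x % r ≟ toℕ p) (trans (sym (toℕ-residue x)) (cong toℕ (⌊⌋-true (residue x ≟ᶠ p) t))))
      (λ t → true-⌊⌋ (residue x ≟ᶠ p) (Finₚ.toℕ-injective (trans (toℕ-residue x) (⌊⌋-true (toℕ x % r ≟ toℕ p) t))))))
    (∑-toℕ n (λ j → ind ⌊ j % r ≟ toℕ p ⌋))

  hits-period : ∀ (p : Fin r) → Σ₁ r (hits (toℕ p)) ≡ 1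
  hits-period p = trans (sym (∑-toℕ r (λ j → ind ⌊ j % r ≟ toℕ p ⌋)))
    (≤-antisym (∑-ind≤1 (Uniqueₚ.allFin⁺ r) (λ x → ⌊ toℕ x % r ≟ toℕ p ⌋) (λ x y _ _ a b → trans (hit a) (sym (hit b))))
      (∑-ind≥1 (allFin r) (λ x → ⌊ toℕ x % r ≟ toℕ p ⌋) (∈-allFin p) (true-⌊⌋ (toℕ p % r ≟ toℕ p) (m<n⇒m%n≡m (Finₚ.toℕ<n p)))))
    where
    hit : ∀ {x} → ⌊ toℕ x % r ≟ toℕ p ⌋ ≡ true → x ≡ p
    hit {x} t = Finₚ.toℕ-injective (trans (sym (m<n⇒m%n≡m (Finₚ.toℕ<n x))) (⌊⌋-true (toℕ x % r ≟ toℕ p) t))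

  hits-shift : ∀ (p : Fin r) n → Σ₁ (r + n) (hits (toℕ p)) ≡ suc (Σ₁ n (hits (toℕ p)))
  hits-shift p n = trans (Σ₁-split r n _) (cong₂ _+_ (hits-period p) (Σ₁-cong n shift))
    where
    shift : ∀ j → 1 ≤ j → j ≤ n → hits (toℕ p) (r + j) ≡ hits (toℕ p) j
    shift (suc j) _ _ = cong (λ z → ind ⌊ z ≟ toℕ p ⌋) (trans (cong (λ z → (z ∸ 1) % r) (+-suc r j)) (trans (cong (_% r) (+-comm r j)) ([m+n]%n≡m%n j r)))

  hits-periods : ∀ (p : Fin r) m t → Σ₁ (m * r + t) (hits (toℕ p)) ≡ m + Σ₁ t (hits (toℕ p))
  hits-periods p zero    t = refl
  hits-periods p (suc m) t = trans (cong (λ z → Σ₁ z (hits (toℕ p))) (+-assoc r (m * r) t)) (trans (hits-shift p (m * r + t)) (cong suc (hits-periods p m t)))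

  -- The n / r full periods meet each residue exactly once, and the remaining n % r vertices meet it
  -- at most once.
  balanced : ∀ n (p : Fin r) → sizeOf (residue {n}) p ≡ n / r ⊎ sizeOf (residue {n}) p ≡ suc (n / r)
  balanced n p = cases (Σ₁ (n % r) (hits (toℕ p))) refl short
    where
    eq : sizeOf (residue {n}) p ≡ n / r + Σ₁ (n % r) (hits (toℕ p))
    eq = trans (size-residue n p) (trans (cong (λ z → Σ₁ z (hits (toℕ p))) (trans (m≡m%n+[m/n]*n n r) (+-comm (n % r) _))) (hits-periods p (n / r) (n % r)))
    short : Σ₁ (n % r) (hits (toℕ p)) ≤ 1
    short = ≤-trans (m≤m+n _ _) (≤-reflexive (trans (sym (Σ₁-split (n % r) (r ∸ n % r) (hits (toℕ p))))
      (trans (cong (λ z → Σ₁ z (hits (toℕ p))) (m+[n∸m]≡n (<⇒≤ (m%n<n n r)))) (hits-period p))))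
    cases : ∀ e → Σ₁ (n % r) (hits (toℕ p)) ≡ e → e ≤ 1 → sizeOf (residue {n}) p ≡ n / r ⊎ sizeOf (residue {n}) p ≡ suc (n / r)
    cases zero          h _ = inj₁ (trans eq (trans (cong (n / r +_) h) (+-identityʳ _)))
    cases (suc zero)    h _ = inj₂ (trans eq (trans (cong (n / r +_) h) (+-comm (n / r) 1)))
    cases (suc (suc _)) h (s≤s ())

  size-≥ : ∀ n p → n / r ≤ sizeOf (residue {n}) p
  size-≥ n p with balanced n p
  ... | inj₁ eq = ≤-reflexive (sym eq)
  ... | inj₂ eq = ≤-trans (n≤1+n _) (≤-reflexive (sym eq))

  #turan-≥ : ∀ n → (n / r) ^ r ≤ #turan n
  #turan-≥ n = ≤-trans (subst (λ m → (n / r) ^ m ≤ product (map (sizeOf (residue {n})) (allFin r))) (∣allFin∣ r) (product-lower _ (n / r) (allFin r) (size-≥ n)))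
    (≤-reflexive (sym (#turan≡ n)))

  -- The new vertex joins part n % r and lies in as many edges as the product of the other r - 1
  -- part sizes, each at least n / r. The same power later separates low from high degrees.
  #turan-grow : ∀ n → #turan n + (n / r) ^ (r ∸ 1) ≤ #turan (suc n)
  #turan-grow n = begin
    #turan n + (n / r) ^ (r ∸ 1)
      ≡⟨ cong₂ _+_ (trans (#turan≡ n) (product-remove _≟ᶠ_ a (∈-allFin p))) (cong ((n / r) ^_) (sym ∣rest∣)) ⟩
    a p * P + (n / r) ^ length rest
      ≤⟨ +-monoʳ-≤ (a p * P) (product-lower a (n / r) rest (size-≥ n)) ⟩
    a p * P + P
      ≡⟨ +-comm (a p * P) P ⟩
    suc (a p) * P
      ≡⟨ cong₂ _*_ (sym (trans (grow p) (trans (cong (a p +_) (cong ind (true-⌊⌋ (n % r ≟ toℕ p) (sym toℕ-p)))) (+-comm (a p) 1))))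
           (product-map-cong a a′ rest other) ⟩
    a′ p * product (map a′ rest)
      ≡⟨ sym (trans (#turan≡ (suc n)) (product-remove _≟ᶠ_ a′ (∈-allFin p))) ⟩
    #turan (suc n) ∎
    where
    open ≤-Reasoning
    p : Fin r
    p = fromℕ< (m%n<n n r)
    toℕ-p : toℕ p ≡ n % r
    toℕ-p = Finₚ.toℕ-fromℕ< (m%n<n n r)
    a a′ : Fin r → ℕ
    a = sizeOf (residue {n})
    a′ = sizeOf (residue {suc n})
    rest = remove _≟ᶠ_ p (allFin r)
    P = product (map a rest)
    ∣rest∣ : length rest ≡ r ∸ 1
    ∣rest∣ = trans (cong (_∸ 1) (sym (length-remove _≟ᶠ_ (∈-allFin p)))) (cong (_∸ 1) (∣allFin∣ r))
    grow : ∀ p′ → a′ p′ ≡ a p′ + ind ⌊ n % r ≟ toℕ p′ ⌋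
    grow p′ = trans (size-residue (suc n) p′) (cong (_+ ind ⌊ n % r ≟ toℕ p′ ⌋) (sym (size-residue n p′)))
    other : ∀ {p′} → p′ ∈ rest → a p′ ≡ a′ p′
    other {p′} p′∈ = sym (trans (grow p′) (trans (cong (a p′ +_) (cong ind (¬true (λ t → remove-≢ _≟ᶠ_ (Uniqueₚ.allFin⁺ r) p′∈
      (Finₚ.toℕ-injective (trans (sym (⌊⌋-true (n % r ≟ toℕ p′) t)) (sym toℕ-p))))))) (+-identityʳ _)))

  module _ {n : ℕ} (n/r≥1 : 1 ≤ n / r) (G : Subset n → Bool) (uni : ∀ S → G S ≡ true → ∣ S ∣ ≡ r) (c : Fin n → Fin r)
    (proper : ∀ {z z′} → z ≢ z′ → c z ≡ c z′ → ∀ S → G S ≡ true → z ∈ˢ S → z′ ∈ˢ S → Empty) where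

    private
      m = n / r
      a b : Fin r → ℕ
      a = sizeOf c
      b = sizeOf (residue {n})
      as = map a (allFin r)
      bs = map b (allFin r)
      len : length as ≡ length bs
      len = trans (Listₚ.length-map a (allFin r)) (sym (Listₚ.length-map b (allFin r)))
      tot : sum as ≡ sum bs
      tot = trans (sizes-total c) (sym (sizes-total (residue {n})))
      bal : ∀ {x} → x ∈ bs → x ≡ m ⊎ x ≡ suc m
      bal x∈ with ∈-map⁻ b x∈
      ... | p , _ , refl = balanced n p

    edge⇒complete : ∀ S → G S ≡ true → complete c S ≡ true
    edge⇒complete S g = complete⁺ c ((λ y y∈ z z∈ eq → decidable-stable (y ≟ᶠ z) (λ y≢z → proper y≢z eq S g y∈ z∈)) , uni S g)

    ∑≤#complete : ∑ (subsets n) (ind ∘ G) ≤ product as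
    ∑≤#complete = ≤-trans (∑-mono (subsets n) (λ S → ind-mono (edge⇒complete S))) (≤-reflexive (#complete c))

    partite-≤ : ∑ (subsets n) (ind ∘ G) ≤ #turan n
    partite-≤ = ≤-trans ∑≤#complete (≤-trans (Tangent.balanced-max m n/r≥1 as bs len tot bal) (≤-reflexive (sym (#turan≡ n))))

    -- Equality forces G to contain every transversal of the parts and the part sizes to be
    -- balanced. Then σ matches parts of equal size, and π matches the vertices part by part.
    partite-unique : ∑ (subsets n) (ind ∘ G) ≡ #turan n → Isomorphic G (turanEdge r n)
    partite-unique eq = π , λ S → trans (G≡complete S) (trans
      (complete-image c residue (σ ⟨$⟩ʳ_) (perm-injective σ) (π ⟨$⟩ʳ_) (perm-injective π) (proj₂ matched) S)
      (sym (turanEdge≡complete n (image (π ⟨$⟩ʳ_) S))))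
      where
      product-eq : product as ≡ product bs
      product-eq = ≤-antisym (Tangent.balanced-max m n/r≥1 as bs len tot bal) (≤-trans (≤-reflexive (trans (sym (#turan≡ n)) (sym eq))) ∑≤#complete)
      G≡complete : ∀ S → G S ≡ complete c S
      G≡complete S = bool-ext (edge⇒complete S) (∑-tight (subsets n) G (complete c) edge⇒complete
        (≤-reflexive (trans (#complete c) (trans product-eq (trans (sym (#turan≡ n)) (sym eq))))) (∈-subsets S))
      bal-a : ∀ p → a p ≡ m ⊎ a p ≡ suc m
      bal-a p = Tangent.balanced-unique m n/r≥1 as bs len tot bal product-eq (∈-map⁺ a (∈-allFin p))
      parts : Σ (Permutation′ r) λ σ → ∀ p → b (σ ⟨$⟩ʳ p) ≡ a p
      parts = match-fibres _≟_ a b (balanced-fibres {n} {m} a b tot bal-a (balanced n))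
      σ : Permutation′ r
      σ = proj₁ parts
      perm-injective : ∀ {k} (ρ : Permutation′ k) {x y} → ρ ⟨$⟩ʳ x ≡ ρ ⟨$⟩ʳ y → x ≡ y
      perm-injective ρ e = trans (sym (inverseˡ ρ)) (trans (cong (ρ ⟨$⟩ˡ_) e) (inverseˡ ρ))
      fibres : ∀ p → fibre _≟ᶠ_ (λ v → σ ⟨$⟩ʳ c v) p ≡ fibre _≟ᶠ_ (residue {n}) p
      fibres p = trans (∑-cong (allFin n) (λ v → ind-≡
          (λ t → true-⌊⌋ (c v ≟ᶠ (σ ⟨$⟩ˡ p)) (trans (sym (inverseˡ σ)) (cong (σ ⟨$⟩ˡ_) (⌊⌋-true ((σ ⟨$⟩ʳ c v) ≟ᶠ p) t))))
          (λ t → true-⌊⌋ ((σ ⟨$⟩ʳ c v) ≟ᶠ p) (trans (cong (σ ⟨$⟩ʳ_) (⌊⌋-true (c v ≟ᶠ (σ ⟨$⟩ˡ p)) t)) (inverseʳ σ)))))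
        (trans (sym (proj₂ parts (σ ⟨$⟩ˡ p))) (cong b (inverseʳ σ)))
      matched : Σ (Permutation′ n) λ π → ∀ v → residue (π ⟨$⟩ʳ v) ≡ σ ⟨$⟩ʳ c v
      matched = match-fibres _≟ᶠ_ (λ v → σ ⟨$⟩ʳ c v) residue fibres
      π : Permutation′ n
      π = proj₁ matched

-- Tents in the Turán hypergraph

module _ (r i : ℕ) where

  private
    E₁ E₂ E₃ : Fin (r + r ∸ 1) → Bool
    E₁ x = inRange 1 r (suc (toℕ x))
    E₂ x = inRange 1 i (suc (toℕ x)) ∨ inRange (r + 1) (r + r ∸ i ∸ 1) (suc (toℕ x)) ∨ inRange (r + r ∸ 1) (r + r ∸ 1) (suc (toℕ x))
    E₃ x = inRange (i + 1) r (suc (toℕ x)) ∨ inRange (r + r ∸ i) (r + r ∸ 1) (suc (toℕ x))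

  ∈-tentEdge1⁻ : ∀ {x} → x ∈ˢ tentEdge1 r i → suc (toℕ x) ≤ r
  ∈-tentEdge1⁻ {x} x∈ = proj₂ (inRange⁻ {1} {r} (trans (sym (lookup∘tabulate E₁ x)) (∈⇒true x∈)))

  ∈-tentEdge2-low : ∀ {x} → suc (toℕ x) ≤ i → x ∈ˢ tentEdge2 r i
  ∈-tentEdge2-low {x} ≤i = true⇒∈ (trans (lookup∘tabulate E₂ x) (∨-introˡ _ (inRange⁺ {1} {i} (s≤s z≤n) ≤i)))

  ∈-tentEdge2-last : ∀ {x} → suc (toℕ x) ≡ r + r ∸ 1 → x ∈ˢ tentEdge2 r i
  ∈-tentEdge2-last {x} eq = true⇒∈ (trans (lookup∘tabulate E₂ x) (∨-introʳ (inRange 1 i (suc (toℕ x)))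
    (∨-introʳ (inRange (r + 1) (r + r ∸ i ∸ 1) (suc (toℕ x))) (inRange⁺ {r + r ∸ 1} {r + r ∸ 1} (≤-reflexive (sym eq)) (≤-reflexive eq)))))

  ∈-tentEdge3-high : ∀ {x} → i < suc (toℕ x) → suc (toℕ x) ≤ r → x ∈ˢ tentEdge3 r i
  ∈-tentEdge3-high {x} i< ≤r = true⇒∈ (trans (lookup∘tabulate E₃ x) (∨-introˡ _ (inRange⁺ {i + 1} {r} (subst (_≤ suc (toℕ x)) (+-comm 1 i) i<) ≤r)))

  ∈-tentEdge3-last : ∀ {x} → 1 ≤ i → suc (toℕ x) ≡ r + r ∸ 1 → x ∈ˢ tentEdge3 r i
  ∈-tentEdge3-last {x} i≥1 eq = true⇒∈ (trans (lookup∘tabulate E₃ x) (∨-introʳ (inRange (i + 1) r (suc (toℕ x)))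
    (inRange⁺ {r + r ∸ i} {r + r ∸ 1} (≤-trans (∸-monoʳ-≤ (r + r) i≥1) (≤-reflexive (sym eq))) (≤-reflexive eq))))

  tent₁ : tent r i (tentEdge1 r i) ≡ true
  tent₁ = ∨-introˡ _ (true-⌊⌋ (≡-dec _≟ᵇ_ (tentEdge1 r i) (tentEdge1 r i)) refl)

  tent₂ : tent r i (tentEdge2 r i) ≡ true
  tent₂ = ∨-introʳ ⌊ ≡-dec _≟ᵇ_ (tentEdge2 r i) (tentEdge1 r i) ⌋ (∨-introˡ _ (true-⌊⌋ (≡-dec _≟ᵇ_ (tentEdge2 r i) (tentEdge2 r i)) refl))

  tent₃ : tent r i (tentEdge3 r i) ≡ true
  tent₃ = ∨-introʳ ⌊ ≡-dec _≟ᵇ_ (tentEdge3 r i) (tentEdge1 r i) ⌋ (∨-introʳ ⌊ ≡-dec _≟ᵇ_ (tentEdge3 r i) (tentEdge2 r i) ⌋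
    (true-⌊⌋ (≡-dec _≟ᵇ_ (tentEdge3 r i) (tentEdge3 r i)) refl))

-- The first edge contains a vertex x whose image lies in the part of the image of the apex y.
-- According as the label of x is at most i or not, the second or the third edge contains both x and
-- y, so it meets that part twice.
turan-FFree : ∀ r .{{_ : NonZero r}} → 2 ≤ r → ∀ n k → FFree r k (turanEdge r n)
turan-FFree r r≥2 n k i i≥1 _ (f , f-inj , edges) = conflict (complete-hits residue (partite (tentEdge1 r i) (tent₁ r i)) (residue (f y)))
  where
  open Multipartite r
  open Turan r
  partite : ∀ e → tent r i e ≡ true → Complete residue (image f e)
  partite e t = complete⁻ residue (trans (sym (turanEdge≡complete n (image f e))) (edges e t))
  -- The apex has the label 2r - 1 and hence lies outside the first edge, which makes x and y
  -- distinct.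
  r<2r-1 : suc r ≤ r + r ∸ 1
  r<2r-1 = ≤-trans (≤-reflexive (sym (m+n∸n≡m (suc r) 1))) (∸-monoˡ-≤ 1 (≤-trans (≤-reflexive (trans (+-comm (suc r) 1) (+-comm 2 r))) (+-monoʳ-≤ r r≥2)))
  last-eq : suc (r + r ∸ 1 ∸ 1) ≡ r + r ∸ 1
  last-eq = m+[n∸m]≡n (≤-trans (s≤s z≤n) r<2r-1)
  y : Fin (r + r ∸ 1)
  y = fromℕ< {r + r ∸ 1 ∸ 1} (≤-reflexive last-eq)
  toℕ-y : suc (toℕ y) ≡ r + r ∸ 1
  toℕ-y = trans (cong suc (Finₚ.toℕ-fromℕ< (≤-reflexive last-eq))) last-eq
  clash : ∀ x → x ∈ˢ tentEdge1 r i → residue (f x) ≡ residue (f y) → Empty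
  clash x x∈ eq = <-irrefl (trans (cong (suc ∘ toℕ) (f-inj same)) toℕ-y) (≤-trans (s≤s (∈-tentEdge1⁻ r i x∈)) r<2r-1)
    where
    same : f x ≡ f y
    same with suc (toℕ x) ≤? i
    ... | yes x≤i = proj₁ (partite (tentEdge2 r i) (tent₂ r i)) (f x) (image⁺ f (tentEdge2 r i) x (∈-tentEdge2-low r i x≤i))
                      (f y) (image⁺ f (tentEdge2 r i) y (∈-tentEdge2-last r i toℕ-y)) eq
    ... | no x≰i  = proj₁ (partite (tentEdge3 r i) (tent₃ r i)) (f x) (image⁺ f (tentEdge3 r i) x (∈-tentEdge3-high r i (≰⇒> x≰i) (∈-tentEdge1⁻ r i x∈)))
                      (f y) (image⁺ f (tentEdge3 r i) y (∈-tentEdge3-last r i i≥1 toℕ-y)) eq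
  conflict : (∃ λ v → v ∈ˢ image f (tentEdge1 r i) × residue v ≡ residue (f y)) → Empty
  conflict (v , v∈ , eq) with image⁻ f (tentEdge1 r i) v∈
  ... | x , refl , x∈ = clash x x∈ eq

-- Deleting vertices

module _ {n : ℕ} (v : Fin (suc n)) where

  insert : Bool → Subset n → Subset (suc n)
  insert b S = Vec.insertAt S v b

  delete : (Subset (suc n) → Bool) → Subset n → Bool
  delete G S = G (insert false S)

∣insert∣ : ∀ {n} (v : Fin (suc n)) (S : Subset n) → ∣ insert v false S ∣ ≡ ∣ S ∣
∣insert∣ zero    S           = refl
∣insert∣ (suc v) (true ∷ S)  = cong suc (∣insert∣ v S)
∣insert∣ (suc v) (false ∷ S) = ∣insert∣ v S

∑-insert : ∀ {n} (v : Fin (suc n)) (f : Subset (suc n) → ℕ) →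
  ∑ (subsets (suc n)) f ≡ ∑ (subsets n) (f ∘ insert v true) + ∑ (subsets n) (f ∘ insert v false)
∑-insert {n}     zero    f = ∑-subsets n f
∑-insert {suc n} (suc v) f = begin
  ∑ (subsets (suc (suc n))) f
    ≡⟨ ∑-subsets (suc n) f ⟩
  ∑ (subsets (suc n)) (f ∘ (true ∷_)) + ∑ (subsets (suc n)) (f ∘ (false ∷_))
    ≡⟨ cong₂ _+_ (∑-insert v (f ∘ (true ∷_))) (∑-insert v (f ∘ (false ∷_))) ⟩
  ∑ (subsets n) (λ S → f (true ∷ insert v true S)) + ∑ (subsets n) (λ S → f (true ∷ insert v false S))
    + (∑ (subsets n) (λ S → f (false ∷ insert v true S)) + ∑ (subsets n) (λ S → f (false ∷ insert v false S)))
    ≡⟨ lemma (∑ (subsets n) (λ S → f (true ∷ insert v true S))) (∑ (subsets n) (λ S → f (true ∷ insert v false S))) _ _ ⟩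
  ∑ (subsets n) (λ S → f (true ∷ insert v true S)) + ∑ (subsets n) (λ S → f (false ∷ insert v true S))
    + (∑ (subsets n) (λ S → f (true ∷ insert v false S)) + ∑ (subsets n) (λ S → f (false ∷ insert v false S)))
    ≡⟨ sym (cong₂ _+_ (∑-subsets n (f ∘ insert (suc v) true)) (∑-subsets n (f ∘ insert (suc v) false))) ⟩
  ∑ (subsets (suc n)) (f ∘ insert (suc v) true) + ∑ (subsets (suc n)) (f ∘ insert (suc v) false) ∎
  where
  open ≡-Reasoning
  lemma : ∀ a b c d → a + b + (c + d) ≡ a + c + (b + d)
  lemma = solve-∀

edges-delete : ∀ {n} (v : Fin (suc n)) (G : Subset (suc n) → Bool) →
  ∑ (subsets (suc n)) (ind ∘ G) ≡ degree G v + ∑ (subsets n) (ind ∘ delete v G)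
edges-delete {n} v G = trans (∑-insert v (ind ∘ G)) (cong (_+ ∑ (subsets n) (ind ∘ delete v G)) (sym through))
  where
  through : degree G v ≡ ∑ (subsets n) (ind ∘ G ∘ insert v true)
  through = trans (∑-insert v (λ S → ind (lookup S v) * ind (G S))) (trans (cong₂ _+_
    (∑-cong (subsets n) (λ S → trans (cong (λ b → ind b * ind (G (insert v true S))) (Vecₚ.insertAt-lookup S v true)) (*-identityˡ _)))
    (∑-zero (subsets n) (λ S → cong (λ b → ind b * ind (G (insert v false S))) (Vecₚ.insertAt-lookup S v false))))
    (+-identityʳ _))

contains-delete : ∀ {m n} (T : Subset m → Bool) (v : Fin (suc n)) (G : Subset (suc n) → Bool) → Contains T (delete v G) → Contains T G
contains-delete T v G (f , f-inj , edges) = punchIn v ∘ f , (λ eq → f-inj (Finₚ.punchIn-injective v _ _ eq)) , λ e t → trans (cong G (image-punchIn e)) (edges e t)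
  where
  image-punchIn : ∀ e → image (punchIn v ∘ f) e ≡ insert v false (image f e)
  image-punchIn e = ⊆-antisym {i = image (punchIn v ∘ f) e} {insert v false (image f e)} fwd bwd
    where
    fwd : image (punchIn v ∘ f) e ⊆ˢ insert v false (image f e)
    fwd w∈ with image⁻ (punchIn v ∘ f) e w∈
    ... | i , refl , i∈ = true⇒∈ (trans (Vecₚ.insertAt-punchIn (image f e) v false (f i)) (∈⇒true (image⁺ f e i i∈)))
    bwd : insert v false (image f e) ⊆ˢ image (punchIn v ∘ f) e
    bwd {w} w∈ with v ≟ᶠ w
    ... | yes refl = ⊥-elim (true≢false (∈⇒true w∈) (Vecₚ.insertAt-lookup (image f e) v false))
    ... | no v≢w with image⁻ f e (true⇒∈ {x = punchOut v≢w} (trans (sym (Vecₚ.insertAt-punchIn (image f e) v false (punchOut v≢w)))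
                       (trans (cong (lookup (insert v false (image f e))) (Finₚ.punchIn-punchOut v≢w)) (∈⇒true w∈))))
    ...   | i , eq , i∈ = subst (_∈ˢ image (punchIn v ∘ f) e) (trans (cong (punchIn v) eq) (Finₚ.punchIn-punchOut v≢w)) (image⁺ (punchIn v ∘ f) e i i∈)

length-subsets : ∀ n → length (subsets n) ≡ 2 ^ n
length-subsets zero    = refl
length-subsets (suc n) = trans (Listₚ.length-++ (map (true ∷_) (subsets n))) (trans (cong₂ _+_
  (trans (Listₚ.length-map (true ∷_) (subsets n)) (length-subsets n)) (trans (Listₚ.length-map (false ∷_) (subsets n)) (length-subsets n)))
  (cong (2 ^ n +_) (sym (+-identityʳ (2 ^ n)))))

count≤2^n : ∀ n (P : Subset n → Bool) → ∑ (subsets n) (ind ∘ P) ≤ 2 ^ n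
count≤2^n n P = ≤-trans (∑-mono (subsets n) (λ S → ind≤1 (P S))) (≤-reflexive (trans (∑-const (subsets n) 1) (trans (*-identityʳ _) (length-subsets n))))

module Exact (s′ k l : ℕ) (r≡ : k + l ≡ suc (suc s′)) (k≥1 : 1 ≤ k)
  (tail≤ : Σ₁ l (λ i → reciprocals (suc (suc s′) !) (k + i)) ≤ suc (suc s′) !) where

  private
    s r : ℕ
    s = suc s′
    r = suc s
  open Turan r
  open Constants s′ using (threshold)

  n₁ K : ℕ
  n₁ = suc (threshold + r)
  -- On at most n₁ vertices the surplus is bounded by the number of all subsets.
  K = n₁ + 2 ^ n₁

  Hypergraph : ∀ n → (Subset n → Bool) → Set
  Hypergraph n G = (∀ S → G S ≡ true → ∣ S ∣ ≡ r) × FFree r k G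

  #edges : ∀ {n} → (Subset n → Bool) → ℕ
  #edges {n} G = ∑ (subsets n) (ind ∘ G)

  delete-hypergraph : ∀ {n} v {G} → Hypergraph (suc n) G → Hypergraph n (delete v G)
  delete-hypergraph v {G} (uni , free) = (λ S g → trans (sym (∣insert∣ v S)) (uni (insert v false S) g)) ,
    λ i i≥1 i≤k c → free i i≥1 i≤k (contains-delete (tent r i) v G c)

  low-degree? : ∀ {n} (G : Subset (suc n) → Bool) → Dec (∃ λ v → degree G v < (n / r) ^ s)
  low-degree? {n} G = Finₚ.any? (λ v → degree G v <? (n / r) ^ s)

  -- Deleting a vertex of low degree increases the surplus over the Turán number.
  delete-surplus : ∀ {n e} (G : Subset (suc n) → Bool) v → degree G v < (n / r) ^ s → #turan (suc n) + e ≤ #edges G →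
    #turan n + suc e ≤ #edges (delete v G)
  delete-surplus {n} {e} G v low le = ≤-by _ _ 0 (+-mono-≤ (+-mono-≤ (#turan-grow n) low) (≤-trans le (≤-reflexive (edges-delete v G))))
    (lemma (#turan n) e (#turan (suc n)) ((n / r) ^ s) (degree G v) (#edges (delete v G)))
    where
    lemma : ∀ t e t′ p d E → t + suc e + (t′ + p + (d + E)) + 0 ≡ E + (t + p + suc d + (t′ + e))
    lemma = solve-∀

  module _ {n} (large : n₁ ≤ suc n) (G : Subset (suc n) → Bool) (hyp : Hypergraph (suc n) G)
    (edges : #turan (suc n) ≤ #edges G) (high : ¬ ∃ λ v → degree G v < (n / r) ^ s) where

    private
      n/r≤ : n / r ≤ suc n / r
      n/r≤ = /-monoˡ-≤ r (n≤1+n n)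
      n≤ : suc n ≤ r * suc (n / r)
      n≤ = ≤-trans (s≤s (≤-reflexive (m≡m%n+[m/n]*n n r))) (≤-trans (+-monoˡ-≤ (n / r * r) (m%n<n n r)) (≤-reflexive (trans (cong (r +_) (*-comm (n / r) r)) (sym (*-suc r (n / r))))))
      colouring = MinDegree.proper-colouring s′ k l G (proj₁ hyp) (proj₂ hyp) r≡ k≥1 tail≤
        (≤-trans (s≤s (m≤m+n threshold r)) large) (n / r) n≤
        (≤-trans (^-monoˡ-≤ r n/r≤) (≤-trans (#turan-≥ (suc n)) edges))
        (λ z → ≮⇒≥ (λ lt → high (z , lt)))
      n/r≥1 : 1 ≤ suc n / r
      n/r≥1 = m≥n⇒m/n>0 (≤-trans (≤-trans (m≤n+m r threshold) (n≤1+n _)) large)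

    high-degree-≤ : #edges G ≤ #turan (suc n)
    high-degree-≤ = partite-≤ n/r≥1 G (proj₁ hyp) (proj₁ colouring) (proj₂ colouring)

    high-degree-unique : #edges G ≡ #turan (suc n) → Isomorphic G (turanEdge r (suc n))
    high-degree-unique = partite-unique n/r≥1 G (proj₁ hyp) (proj₁ colouring) (proj₂ colouring)

  -- Deleting a vertex of low degree lowers n by one and raises the surplus by at least one, so the
  -- bound on their sum carries over from n - 1. Above n₁ such a vertex exists, because otherwise G
  -- would be r-partite and have no surplus.
  surplus-bound : ∀ n (G : Subset n → Bool) → Hypergraph n G → ∀ e → #turan n + suc e ≤ #edges G → n + suc e ≤ K
  surplus-bound n G hyp e le with n ≤? n₁
  ... | yes n≤n₁ = +-mono-≤ n≤n₁ (≤-trans (m≤n+m (suc e) (#turan n)) (≤-trans le (≤-trans (count≤2^n n G) (^-monoʳ-≤ 2 n≤n₁))))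
  surplus-bound zero    G hyp e le | no n≰n₁ = contradiction z≤n n≰n₁
  surplus-bound (suc n) G hyp e le | no n≰n₁ with low-degree? G
  ... | yes (v , low) = ≤-trans (≤-reflexive (sym (+-suc n (suc e))))
    (surplus-bound n (delete v G) (delete-hypergraph v hyp) (suc e) (delete-surplus G v low le))
  ... | no high = contradiction (≤-trans (≤-trans (m<m+n (#turan (suc n)) (s≤s z≤n)) le)
    (high-degree-≤ (<⇒≤ (≰⇒> n≰n₁)) G hyp (≤-trans (m≤m+n _ (suc e)) le) high)) (<-irrefl refl)

  extremal : ∀ n → suc K ≤ n → (G : Subset n → Bool) → Hypergraph n G →
    #edges G ≤ #turan n × (#edges G ≡ #turan n → Isomorphic G (turanEdge r n))
  extremal (suc n) K<n G hyp = upper , unique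
    where
    upper : #edges G ≤ #turan (suc n)
    upper = ≮⇒≥ (λ lt → contradiction (surplus-bound (suc n) G hyp 0 (≤-trans (≤-reflexive (+-comm (#turan (suc n)) 1)) lt))
      (<⇒≱ (≤-trans K<n (m≤m+n (suc n) 1))))
    unique : #edges G ≡ #turan (suc n) → Isomorphic G (turanEdge r (suc n))
    unique eq with low-degree? G
    -- With equality, a vertex of low degree would produce a surplus of at least one on n vertices,
    -- and n is still too large for that.
    ... | yes (v , low) = contradiction (surplus-bound n (delete v G) (delete-hypergraph v hyp) 0
            (delete-surplus G v low (≤-reflexive (trans (+-identityʳ _) (sym eq)))))
          (<⇒≱ (≤-trans K<n (≤-reflexive (+-comm 1 n))))
    ... | no high = high-degree-unique (≤-trans (m≤m+n n₁ (2 ^ n₁)) (≤-trans (n≤1+n K) K<n)) G hyp (≤-reflexive (sym eq)) high eq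

theorem1p4 : (r : ℕ) .{{_ : NonZero r}} → 4 ≤ r → (k : ℕ) → IsCeilDivE r k →
    ∃ λ n₀ → ∀ n → n₀ ≤ n →
    IsExF n r k (numEdges (turanEdge r n))
    × (∀ (G : UHypergraph n r) → FFree r k (edge G) →
    numEdges (edge G) ≡ numEdges (turanEdge r n) → Isomorphic (edge G) (turanEdge r n))
theorem1p4 r@(suc (suc s′)) r≥4 k (k≥1 , _ , r≤ke) = suc (Exact.K s′ k′ l r≡ k′≥1 tail≤) , λ n large →
    ((turan n , turan-FFree r (s≤s (s≤s z≤n)) n k , refl) ,
     (λ G free → ≤-trans (≤-reflexive (countSubsets≡∑ n (edge G))) (proj₁ (exact n large G free)))) ,
    λ G free eq → proj₂ (exact n large G free) (trans (sym (countSubsets≡∑ n (edge G))) eq)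
  where
  w = reciprocals (r !)
  split : ∃₂ λ k′ l → k′ ≤ k × k′ + l ≡ r × 1 ≤ k′ × Σ₁ l (λ i → w (k′ + i)) ≤ r !
  split with k ≤? r
  -- For k > r one passes to k′ = r: freeness from the tents up to k includes freeness from those up
  -- to r, and the harmonic tail is empty.
  ... | no k≰r = r , 0 , <⇒≤ (≰⇒> k≰r) , +-identityʳ r , s≤s z≤n , z≤n
  ... | yes k≤r = k , r ∸ k , ≤-refl , k+l , k≥1 ,
      harmonic≤1 (r !) w k (r ∸ k) k≥1 (1≤n! r) (subst (λ m → LeMulE m k) (sym k+l) r≤ke)
        (λ i i≥1 i≤ → reciprocals-! r i i≥1 (≤-trans i≤ (≤-reflexive k+l)))
    where
    k+l : k + (r ∸ k) ≡ r
    k+l = m+[n∸m]≡n k≤r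
  k′ = proj₁ split
  l = proj₁ (proj₂ split)
  k′≤k = proj₁ (proj₂ (proj₂ split))
  r≡ = proj₁ (proj₂ (proj₂ (proj₂ split)))
  k′≥1 = proj₁ (proj₂ (proj₂ (proj₂ (proj₂ split))))
  tail≤ = proj₂ (proj₂ (proj₂ (proj₂ (proj₂ split))))
  turan : ∀ n → UHypergraph n r
  turan n = record { edge = turanEdge r n ; uniform = λ S t → proj₂ (Multipartite.complete⁻ r (Turan.residue r) (trans (sym (Turan.turanEdge≡complete r n S)) t)) }
  exact : ∀ n → suc (Exact.K s′ k′ l r≡ k′≥1 tail≤) ≤ n → (G : UHypergraph n r) → FFree r k (edge G) → _
  exact n large G free = Exact.extremal s′ k′ l r≡ k′≥1 tail≤ n large (edge G) (uniform G , λ i i≥1 i≤k′ → free i i≥1 (≤-trans i≤k′ k′≤k))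
theorem1p4 (suc zero) (s≤s ()) k _
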